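{- For every $\epsilon>0$ and $R>0$ there exists an integer $N=N(\epsilon,R)$ such that for every $\theta\in[0,1)$ and every integer $n\geq N$, the set $\varphi_\theta(\mathbb N)$ is $\epsilon$-close in the open disc of radius $R$ centered at $\varphi_\theta(n)$ to some affine lattice which is equivalent, up to an orientation-preserving affine similarity of $\mathbb C$, to the lattice $\mathbb Z+\mathbb Z\,\frac{4i\pi n}{1+4i\pi\{\theta\} n}$.
   Context: For $\theta\in\mathbb R$, the phyllotactic map $\varphi_\theta:\mathbb N\to\mathbb C$ is $\varphi_\theta(n)=\sqrt{n}\,e^{2i\pi\theta n}$, and $\varphi_\theta(\mathbb N)$ is its image. $\{\theta\}=\theta-\lfloor\theta\rfloor\in[0,1)$ is the fractional part. An affine lattice is a set $\alpha+\Gamma$ with $\alpha\in\mathbb C$ and $\Gamma=\mathbb Z\omega_1+\mathbb Z\omega_2$ for $\mathbb R$-linearly independent $\omega_1,\omega_2\in\mathbb C$; two affine lattices are equivalent if one is the image of the other under a map $z\mapsto \lambda z+\beta$ with $\lambda\in\mathbb C^*$, $\beta\in\mathbb C$. For a metric space $E$, $x\in E$, $\epsilon,R>0$, two discrete subsets $A,B\subset E$ are $\epsilon$-close in the open ball of radius $R$ centered at $x$ if there exist subsets $A'\subset A$, $B'\subset B$ containing all points of $A$, respectively $B$, at distance at most $R$ from $x$, and a bijection $\psi:A'\to B'$ with $\mathrm{dist}(a,\psi(a))<\epsilon$ for all $a\in A'$. Here $E=\mathbb C$ with the Euclidean metric. -}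

module Defs where

open import Data.Integer.Base using (ℤ)
import Data.Integer.Base as ℤ
import Data.Integer.Properties as ℤ
open import Data.Nat.Base as ℕ using (ℕ; zero; suc)
import Data.Nat.Properties as ℕ
open import Data.Bool.Base using (if_then_else_)
open import Data.Product using (Σ; ∃; ∃₂; _×_; _,_; proj₁; proj₂)
open import Data.Rational.Base as ℚ using (ℚ; mkℚ; 0ℚ; 1ℚ; ½)
import Data.Rational.Base
import Data.Rational.Properties as ℚ
open import Data.Rational.Solver using (module +-*-Solver)
import Data.Rational.Unnormalised.Base as ℚᵘ
import Data.Rational.Unnormalised.Properties as ℚᵘ
open import Data.Sum using (inj₁; inj₂)
open import Function.Bundles using (Bijection; _⇔_)
open import Level using (0ℓ)
open import Relation.Binary.Bundles using (Setoid)
open import Relation.Binary.Definitions using (Reflexive; Symmetric; Transitive; _Respects_)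
open import Relation.Binary.PropositionalEquality
  using (_≡_; refl; sym; trans; cong; cong₂; subst)
import Relation.Binary.Construct.On as On
open import Relation.Nullary using (Dec; yes; no; does)
open import Relation.Unary using (Pred)

module Estimates where

  open Data.Rational.Base using (_+_; _*_; _-_; -_; _≤_; _<_; _⊔_) renaming (∣_∣ to abs)
  open +-*-Solver using (solve; _:+_; _:*_; :-_; _:-_; _:=_; con)
  open ℚ.≤-Reasoning

  fromℕ : ℕ → ℚ
  fromℕ n = ℤ.+ n ℚ./ 1

  1/suc : ℕ → ℚ
  1/suc n = ℤ.+ 1 ℚ./ suc n

  abs-sub : ∀ a b → abs (a - b) ≡ abs (b - a)
  abs-sub a b = trans
    (cong abs (solve 2 (λ a b → a :- b := :- (b :- a)) refl a b))
    (ℚ.∣-p∣≡∣p∣ (b - a))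

  abs-tri : ∀ a b c → abs (a - c) ≤ abs (a - b) + abs (b - c)
  abs-tri a b c = begin
    abs (a - c)             ≡⟨ cong abs (solve 3 (λ a b c →
                                 a :- c := (a :- b) :+ (b :- c)) refl a b c) ⟩
    abs ((a - b) + (b - c)) ≤⟨ ℚ.∣p+q∣≤∣p∣+∣q∣ (a - b) (b - c) ⟩
    abs (a - b) + abs (b - c) ∎

  abs-self : ∀ a → abs (a - a) ≡ 0ℚ
  abs-self a = cong abs (ℚ.+-inverseʳ a)

  ≤abs : ∀ a → a ≤ abs a
  ≤abs a with ℚ.≤-total 0ℚ a
  ... | inj₁ 0≤a = ℚ.≤-reflexive (sym (ℚ.0≤p⇒∣p∣≡p 0≤a))
  ... | inj₂ a≤0 = ℚ.≤-trans a≤0 (ℚ.0≤∣p∣ a)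

  abs≤ : ∀ {a b} → a ≤ b → - a ≤ b → abs a ≤ b
  abs≤ {a} a≤b -a≤b with ℚ.∣p∣≡p∨∣p∣≡-p a
  ... | inj₁ e = subst (_≤ _) (sym e) a≤b
  ... | inj₂ e = subst (_≤ _) (sym e) -a≤b

  half+half : ∀ ε → ½ * ε + ½ * ε ≡ ε
  half+half = solve 1 (λ ε → con ½ :* ε :+ con ½ :* ε := ε) refl

  *-pos : ∀ {a b} → 0ℚ < a → 0ℚ < b → 0ℚ < a * b
  *-pos {a} {b} 0<a 0<b = ℚ.positive⁻¹ (a * b)
    {{ℚ.pos*pos⇒pos a {{ℚ.positive 0<a}} b {{ℚ.positive 0<b}}}}

  half-pos : ∀ {ε} → 0ℚ < ε → 0ℚ < ½ * ε
  half-pos = *-pos (ℚ.positive⁻¹ ½)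

  *-mono : ∀ {a b c d} → 0ℚ ≤ b → a ≤ b → 0ℚ ≤ c → c ≤ d → a * c ≤ b * d
  *-mono {a} {b} {c} {d} 0≤b a≤b 0≤c c≤d = ℚ.≤-trans
    (ℚ.*-monoʳ-≤-nonNeg c {{ℚ.nonNegative 0≤c}} a≤b)
    (ℚ.*-monoˡ-≤-nonNeg b {{ℚ.nonNegative 0≤b}} c≤d)

  *-monoʳ-< : ∀ {a b c} → 0ℚ < a → b < c → a * b < a * c
  *-monoʳ-< {a} 0<a = ℚ.*-monoʳ-<-pos a {{ℚ.positive 0<a}}

  *-nonNeg : ∀ {a b} → 0ℚ ≤ a → 0ℚ ≤ b → 0ℚ ≤ a * b
  *-nonNeg {a} {b} 0≤a 0≤b = ℚ.nonNegative⁻¹ (a * b)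
    {{ℚ.nonNeg*nonNeg⇒nonNeg a {{ℚ.nonNegative 0≤a}} b {{ℚ.nonNegative 0≤b}}}}

  +-nonNeg : ∀ {a b} → 0ℚ ≤ a → 0ℚ ≤ b → 0ℚ ≤ a + b
  +-nonNeg = ℚ.+-mono-≤ {0ℚ} {_} {0ℚ}

  sq-nonNeg : ∀ a → 0ℚ ≤ a * a
  sq-nonNeg a with ℚ.≤-total 0ℚ a
  ... | inj₁ 0≤a = *-nonNeg 0≤a 0≤a
  ... | inj₂ a≤0 = subst (0ℚ ≤_)
    (solve 1 (λ a → (:- a) :* (:- a) := a :* a) refl a)
    (*-nonNeg (ℚ.neg-antimono-≤ a≤0) (ℚ.neg-antimono-≤ a≤0))

  ≤-from-sub : ∀ {a b c} → a - b ≤ c → a ≤ c + b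
  ≤-from-sub {a} {b} {c} h = begin
    a           ≡⟨ solve 2 (λ a b → a := (a :- b) :+ b) refl a b ⟩
    a - b + b   ≤⟨ ℚ.+-monoˡ-≤ b h ⟩
    c + b       ∎

  ≤-to-sub : ∀ {a b c} → a ≤ c + b → a - b ≤ c
  ≤-to-sub {a} {b} {c} h = begin
    a - b       ≤⟨ ℚ.+-monoˡ-≤ (- b) h ⟩
    c + b - b   ≡⟨ solve 2 (λ b c → c :+ b :- b := c) refl b c ⟩
    c           ∎

  abs≤⇒abs-sub≤ : ∀ {a b c} → 0ℚ ≤ a → a ≤ c → 0ℚ ≤ b → b ≤ c → abs (a - b) ≤ c
  abs≤⇒abs-sub≤ {a} {b} {c} 0≤a a≤c 0≤b b≤c = abs≤
    (≤-to-sub (ℚ.≤-trans a≤c (subst (_≤ c + b) (ℚ.+-identityʳ c) (ℚ.+-monoʳ-≤ c 0≤b))))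
    (subst (_≤ c) (solve 2 (λ a b → b :- a := :- (a :- b)) refl a b)
      (≤-to-sub (ℚ.≤-trans b≤c (subst (_≤ c + a) (ℚ.+-identityʳ c) (ℚ.+-monoʳ-≤ c 0≤a)))))

  ⊔-lipschitz : ∀ a b c → abs ((a ⊔ c) - (b ⊔ c)) ≤ abs (a - b)
  ⊔-lipschitz a b c = abs≤ (one a b)
    (subst (_≤ abs (a - b)) (solve 2 (λ a b → b :- a := :- (a :- b)) refl (a ⊔ c) (b ⊔ c))
      (subst ((b ⊔ c) - (a ⊔ c) ≤_) (abs-sub b a) (one b a)))
    where
    one : ∀ a b → (a ⊔ c) - (b ⊔ c) ≤ abs (a - b)
    one a b = ≤-to-sub {a ⊔ c} {b ⊔ c} (ℚ.⊔-lub
      (ℚ.≤-trans (≤-from-sub {a} {b} (≤abs (a - b))) (ℚ.+-monoʳ-≤ (abs (a - b)) (ℚ.p≤p⊔q b c)))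
      (ℚ.≤-trans (ℚ.p≤q⊔p b c)
        (subst (_≤ abs (a - b) + (b ⊔ c)) (ℚ.+-identityˡ (b ⊔ c))
          (ℚ.+-monoˡ-≤ (b ⊔ c) (ℚ.0≤∣p∣ (a - b))))))

  toℚᵘ-/ : ∀ i n → ℚ.toℚᵘ (i ℚ./ suc n) ℚᵘ.≃ ℚᵘ.mkℚᵘ i n
  toℚᵘ-/ i n = ℚ.toℚᵘ-fromℚᵘ (ℚᵘ.mkℚᵘ i n)

  /-≤ : ∀ i m j n → i ℤ.* ℤ.+ suc n ℤ.≤ j ℤ.* ℤ.+ suc m → i ℚ./ suc m ≤ j ℚ./ suc n
  /-≤ i m j n h = ℚ.toℚᵘ-cancel-≤
    (ℚᵘ.≤-trans (ℚᵘ.≤-reflexive (toℚᵘ-/ i m))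
      (ℚᵘ.≤-trans (ℚᵘ.*≤* h) (ℚᵘ.≤-reflexive (ℚᵘ.≃-sym (toℚᵘ-/ j n)))))

  1/suc-antitone : ∀ {m n} → m ℕ.≤ n → 1/suc n ≤ 1/suc m
  1/suc-antitone {m} {n} m≤n = /-≤ (ℤ.+ 1) n (ℤ.+ 1) m
    (ℤ.*-monoˡ-≤-nonNeg (ℤ.+ 1) (ℤ.+≤+ (ℕ.s≤s m≤n)))

  1/suc-pos : ∀ n → 0ℚ < 1/suc n
  1/suc-pos n = ℚ.positive⁻¹ (1/suc n) {{ℚ.normalize-pos 1 (suc n)}}

  1/suc-nonNeg : ∀ n → 0ℚ ≤ 1/suc n
  1/suc-nonNeg n = ℚ.<⇒≤ (1/suc-pos n)

  fromℕ-nonNeg : ∀ n → 0ℚ ≤ fromℕ n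
  fromℕ-nonNeg n = ℚ.nonNegative⁻¹ (fromℕ n) {{ℚ.normalize-nonNeg n 1}}

  fromℕ-suc : ∀ n → fromℕ (suc n) ≡ fromℕ n + 1ℚ
  fromℕ-suc n = ℚ.toℚᵘ-injective (ℚᵘ.≃-trans (toℚᵘ-/ (ℤ.+ suc n) 0)
    (ℚᵘ.≃-trans (ℚᵘ.*≡* (cong (ℤ._* ℤ.+ 1) (trans (cong ℤ.+_ (ℕ.+-comm 1 n))
        (cong (ℤ._+ ℤ.+ 1) (sym (ℤ.*-identityʳ (ℤ.+ n)))))))
      (ℚᵘ.≃-trans (ℚᵘ.+-cong (ℚᵘ.≃-sym (toℚᵘ-/ (ℤ.+ n) 0)) (ℚᵘ.≃-refl {ℚ.toℚᵘ 1ℚ}))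
        (ℚᵘ.≃-sym (ℚ.toℚᵘ-homo-+ (fromℕ n) 1ℚ)))))

  1/suc-inverse : ∀ n → fromℕ (suc n) * 1/suc n ≡ 1ℚ
  1/suc-inverse n = ℚ.toℚᵘ-injective (ℚᵘ.≃-trans (ℚ.toℚᵘ-homo-* (fromℕ (suc n)) (1/suc n))
    (ℚᵘ.≃-trans (ℚᵘ.*-cong (toℚᵘ-/ (ℤ.+ suc n) 0) (toℚᵘ-/ (ℤ.+ 1) n))
      (ℚᵘ.*≡* (cong ℤ.+_ lem))))
    where
    lem : suc n ℕ.* 1 ℕ.* 1 ≡ 1 ℕ.* (1 ℕ.* suc n)
    lem = trans (ℕ.*-identityʳ (suc n ℕ.* 1)) (trans (ℕ.*-identityʳ (suc n))
      (sym (trans (ℕ.*-identityˡ (1 ℕ.* suc n)) (ℕ.*-identityˡ (suc n)))))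

  archimedean : ∀ ε → 0ℚ < ε → ∃ λ N → 1/suc N < ε
  archimedean ε@(mkℚ (ℤ.+ suc p) d _) _ = suc d , ℚ.toℚᵘ-cancel-<
    (ℚᵘ.≤-<-trans (ℚᵘ.≤-reflexive (toℚᵘ-/ (ℤ.+ 1) (suc d)))
      (ℚᵘ.*<* (ℤ.+<+ (ℕ.<-≤-trans
        (subst (ℕ._< suc (suc d)) (sym (ℕ.*-identityˡ (suc d))) (ℕ.n<1+n (suc d)))
        (ℕ.m≤n*m (suc (suc d)) (suc p))))))
  archimedean (mkℚ (ℤ.+ zero) _ _) (ℚ.*<* (ℤ.+<+ ()))
  archimedean (mkℚ (ℤ.-[1+ _ ]) _ _) (ℚ.*<* ())

  scale : ∀ K ε → 0ℚ < K → 0ℚ < ε → ∃ λ η → 0ℚ < η × K * η ≡ ε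
  scale K ε 0<K 0<ε = invK * ε
    , *-pos (ℚ.positive⁻¹ invK {{ℚ.1/pos⇒pos K {{ℚ.positive 0<K}}}}) 0<ε
    , trans (sym (ℚ.*-assoc K invK ε)) (trans (cong (_* ε) (ℚ.*-inverseʳ K)) (ℚ.*-identityˡ ε))
    where
    instance
      K≢0 : ℚ.NonZero K
      K≢0 = ℚ.>-nonZero 0<K
    invK : ℚ
    invK = ℚ.1/ K

  archimedean′ : ∀ K ε → 0ℚ ≤ K → 0ℚ < ε → ∃ λ N → K * 1/suc N < ε
  archimedean′ K ε 0≤K 0<ε =
    let η , 0<η , e = scale (K + 1ℚ) ε 0<K+1 0<ε
        N , h       = archimedean η 0<η
    in N , subst (K * 1/suc N <_) e (bound (1/suc N) η (1/suc-nonNeg N) h)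
    where
    0<K+1 : 0ℚ < K + 1ℚ
    0<K+1 = ℚ.+-mono-≤-< {0ℚ} {K} {0ℚ} {1ℚ} 0≤K (ℚ.positive⁻¹ 1ℚ)
    K≤K+1 : K ≤ K + 1ℚ
    K≤K+1 = subst (_≤ K + 1ℚ) (ℚ.+-identityʳ K) (ℚ.+-monoʳ-≤ K (ℚ.nonNegative⁻¹ 1ℚ))
    bound : ∀ x η → 0ℚ ≤ x → x < η → K * x < (K + 1ℚ) * η
    bound x η 0≤x x<η = ℚ.≤-<-trans
      (*-mono {K} {K + 1ℚ} {x} {x} (ℚ.<⇒≤ 0<K+1) K≤K+1 0≤x ℚ.≤-refl)
      (*-monoʳ-< {K + 1ℚ} {x} {η} 0<K+1 x<η)

open Estimates using (fromℕ; 1/suc)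

IsCauchy : (ℕ → ℚ) → Set
IsCauchy s = ∀ ε → 0ℚ ℚ.< ε →
  ∃ λ N → ∀ m n → N ℕ.≤ m → N ℕ.≤ n → ℚ.∣ s m ℚ.- s n ∣ ℚ.< ε

module CauchyProperties where

  open Data.Rational.Base using (_+_; _*_; _-_; -_; _≤_; _<_; _⊔_) renaming (∣_∣ to abs)
  open +-*-Solver using (solve; _:+_; _:*_; :-_; _:-_; _:=_; con)
  open ℚ.≤-Reasoning
  open Estimates hiding (fromℕ; 1/suc)

  abstract
    constant : ∀ q → IsCauchy (λ _ → q)
    constant q ε 0<ε = 0 , λ _ _ _ _ → subst (_< ε) (sym (abs-self q)) 0<ε

  fromTail : ∀ {s} → (∀ ε → 0ℚ < ε → ∃ λ N → ∀ n → N ℕ.≤ n → abs (s n - s N) < ε) → IsCauchy s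
  fromTail {s} h ε 0<ε with h (½ * ε) (half-pos 0<ε)
  ... | N , t = N , λ m n N≤m N≤n → begin-strict
    abs (s m - s n)                     ≤⟨ abs-tri (s m) (s N) (s n) ⟩
    abs (s m - s N) + abs (s N - s n)   ≡⟨ cong (abs (s m - s N) +_) (abs-sub (s N) (s n)) ⟩
    abs (s m - s N) + abs (s n - s N)   <⟨ ℚ.+-mono-< (t m N≤m) (t n N≤n) ⟩
    ½ * ε + ½ * ε                       ≡⟨ half+half ε ⟩
    ε                                   ∎

  abstract
    plus : ∀ {s t} → IsCauchy s → IsCauchy t → IsCauchy (λ k → s k + t k)
    plus {s} {t} cs ct ε 0<ε with cs (½ * ε) (half-pos 0<ε) | ct (½ * ε) (half-pos 0<ε)
    ... | M , f | N , g = M ℕ.⊔ N , λ m n h k → begin-strict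
      abs ((s m + t m) - (s n + t n))     ≡⟨ cong abs (solve 4 (λ a b c d →
                                               (a :+ b) :- (c :+ d) := (a :- c) :+ (b :- d))
                                               refl (s m) (t m) (s n) (t n)) ⟩
      abs ((s m - s n) + (t m - t n))     ≤⟨ ℚ.∣p+q∣≤∣p∣+∣q∣ (s m - s n) (t m - t n) ⟩
      abs (s m - s n) + abs (t m - t n)   <⟨ ℚ.+-mono-<
                                               (f m n (ℕ.m⊔n≤o⇒m≤o M N h) (ℕ.m⊔n≤o⇒m≤o M N k))
                                               (g m n (ℕ.m⊔n≤o⇒n≤o M N h) (ℕ.m⊔n≤o⇒n≤o M N k)) ⟩
      ½ * ε + ½ * ε                       ≡⟨ half+half ε ⟩
      ε                                   ∎

  abstract
    negate : ∀ {s} → IsCauchy s → IsCauchy (λ k → - s k)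
    negate {s} cs ε 0<ε with cs ε 0<ε
    ... | N , f = N , λ m n h k → subst (_< ε)
      (trans (sym (ℚ.∣-p∣≡∣p∣ (s m - s n)))
        (cong abs (solve 2 (λ a b → :- (a :- b) := (:- a) :- (:- b)) refl (s m) (s n))))
      (f m n h k)

  bounded : ∀ {s} → IsCauchy s → ∃ λ B → 0ℚ < B × ∃ λ N → ∀ n → N ℕ.≤ n → abs (s n) ≤ B
  bounded {s} cs with cs 1ℚ (ℚ.positive⁻¹ 1ℚ)
  ... | N , f = abs (s N) + 1ℚ , ℚ.+-mono-≤-< (ℚ.0≤∣p∣ (s N)) (ℚ.positive⁻¹ 1ℚ) , N , λ n h → begin
    abs (s n)                     ≡⟨ cong abs (solve 2 (λ a b → a := b :+ (a :- b)) refl (s n) (s N)) ⟩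
    abs (s N + (s n - s N))       ≤⟨ ℚ.∣p+q∣≤∣p∣+∣q∣ (s N) (s n - s N) ⟩
    abs (s N) + abs (s n - s N)   ≤⟨ ℚ.+-monoʳ-≤ (abs (s N)) (ℚ.<⇒≤ (f n N h ℕ.≤-refl)) ⟩
    abs (s N) + 1ℚ                ∎

  abstract
    times : ∀ {s t} → IsCauchy s → IsCauchy t → IsCauchy (λ k → s k * t k)
    times {s} {t} cs ct ε 0<ε =
      let A , 0<A , L , a = bounded {s} cs
          B , 0<B , M , b = bounded {t} ct
          η , 0<η , e     = scale (A + B) ε (ℚ.+-mono-< {0ℚ} {A} {0ℚ} {B} 0<A 0<B) 0<ε
          P , f           = cs η 0<η
          Q , g           = ct η 0<η
      in (L ℕ.⊔ M) ℕ.⊔ (P ℕ.⊔ Q) , λ m n h k → subst (abs (s m * t m - s n * t n) <_) e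
        (product-close A B η (s m) (t m) (s n) (t n) 0<A 0<B
          (a m (ℕ.m⊔n≤o⇒m≤o L M (ℕ.m⊔n≤o⇒m≤o (L ℕ.⊔ M) (P ℕ.⊔ Q) h)))
          (b n (ℕ.m⊔n≤o⇒n≤o L M (ℕ.m⊔n≤o⇒m≤o (L ℕ.⊔ M) (P ℕ.⊔ Q) k)))
          (f m n (ℕ.m⊔n≤o⇒m≤o P Q (ℕ.m⊔n≤o⇒n≤o (L ℕ.⊔ M) (P ℕ.⊔ Q) h))
                 (ℕ.m⊔n≤o⇒m≤o P Q (ℕ.m⊔n≤o⇒n≤o (L ℕ.⊔ M) (P ℕ.⊔ Q) k)))
          (g m n (ℕ.m⊔n≤o⇒n≤o P Q (ℕ.m⊔n≤o⇒n≤o (L ℕ.⊔ M) (P ℕ.⊔ Q) h))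
                 (ℕ.m⊔n≤o⇒n≤o P Q (ℕ.m⊔n≤o⇒n≤o (L ℕ.⊔ M) (P ℕ.⊔ Q) k))))
      where
      product-close : ∀ A B η x y z w → 0ℚ < A → 0ℚ < B → abs x ≤ A → abs w ≤ B →
        abs (x - z) < η → abs (y - w) < η → abs (x * y - z * w) < (A + B) * η
      product-close A B η x y z w 0<A 0<B x≤A w≤B x-z y-w = begin-strict
        abs (x * y - z * w)
          ≡⟨ cong abs (solve 4 (λ x y z w → x :* y :- z :* w := x :* (y :- w) :+ w :* (x :- z))
               refl x y z w) ⟩
        abs (x * (y - w) + w * (x - z))
          ≤⟨ ℚ.∣p+q∣≤∣p∣+∣q∣ (x * (y - w)) (w * (x - z)) ⟩
        abs (x * (y - w)) + abs (w * (x - z))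
          ≡⟨ cong₂ _+_ (ℚ.∣p*q∣≡∣p∣*∣q∣ x (y - w)) (ℚ.∣p*q∣≡∣p∣*∣q∣ w (x - z)) ⟩
        abs x * abs (y - w) + abs w * abs (x - z)
          ≤⟨ combine (abs x) (abs w) (abs (y - w)) (abs (x - z)) x≤A w≤B
               (ℚ.0≤∣p∣ (y - w)) (ℚ.0≤∣p∣ (x - z)) ⟩
        A * abs (y - w) + B * abs (x - z)
          <⟨ ℚ.+-mono-< {A * abs (y - w)} {A * η} {B * abs (x - z)} {B * η}
               (*-monoʳ-< {A} {abs (y - w)} {η} 0<A y-w)
               (*-monoʳ-< {B} {abs (x - z)} {η} 0<B x-z) ⟩
        A * η + B * η
          ≡⟨ sym (ℚ.*-distribʳ-+ η A B) ⟩
        (A + B) * η ∎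
        where
        combine : ∀ p q u v → p ≤ A → q ≤ B → 0ℚ ≤ u → 0ℚ ≤ v → p * u + q * v ≤ A * u + B * v
        combine p q u v p≤A q≤B 0≤u 0≤v = ℚ.+-mono-≤ {p * u} {A * u} {q * v} {B * v}
          (*-mono {p} {A} {u} {u} (ℚ.<⇒≤ 0<A) p≤A 0≤u ℚ.≤-refl)
          (*-mono {q} {B} {v} {v} (ℚ.<⇒≤ 0<B) q≤B 0≤v ℚ.≤-refl)

  recip : ∀ {ε} → 0ℚ < ε → ℚ → ℚ
  recip {ε} 0<ε a = (ℚ.1/ (a ⊔ ε)) {{ℚ.>-nonZero (ℚ.<-≤-trans 0<ε (ℚ.p≤q⊔p a ε))}}

  abstract
    reciprocal : ∀ {s ε} (0<ε : 0ℚ < ε) → IsCauchy s → IsCauchy (λ k → recip 0<ε (s k))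
    reciprocal {s} {ε} 0<ε cs δ 0<δ =
      let E , 0<E , εE≡1 = scale ε 1ℚ 0<ε (ℚ.positive⁻¹ 1ℚ)
          η , 0<η , e    = scale (E * E) δ (*-pos {E} {E} 0<E 0<E) 0<δ
          N , f          = cs η 0<η
      in N , λ m n h k → subst (abs (r m - r n) <_) e (ℚ.≤-<-trans
        (recip-close E (x m) (x n) (r m) (r n) (abs (s m - s n)) 0<E εE≡1
          (x*r m) (x*r n) (r-nonNeg m) (r-nonNeg n)
          (ℚ.p≤q⊔p (s m) ε) (ℚ.p≤q⊔p (s n) ε) (⊔-lipschitz (s m) (s n) ε))
        (*-monoʳ-< {E * E} {abs (s m - s n)} {η} (*-pos {E} {E} 0<E 0<E) (f m n h k)))
      where
      x r : ℕ → ℚ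
      x k = s k ⊔ ε
      r k = recip 0<ε (s k)
      x-pos : ∀ k → 0ℚ < x k
      x-pos k = ℚ.<-≤-trans 0<ε (ℚ.p≤q⊔p (s k) ε)
      x*r : ∀ k → x k * r k ≡ 1ℚ
      x*r k = ℚ.*-inverseʳ (x k) {{ℚ.>-nonZero (x-pos k)}}
      r-nonNeg : ∀ k → 0ℚ ≤ r k
      r-nonNeg k = ℚ.<⇒≤ (ℚ.positive⁻¹ (r k) {{ℚ.1/pos⇒pos (x k) {{ℚ.positive (x-pos k)}}}})
      recip≤ : ∀ E x r → 0ℚ < E → ε * E ≡ 1ℚ → x * r ≡ 1ℚ → 0ℚ ≤ r → ε ≤ x → r ≤ E
      recip≤ E x r 0<E εE≡1 xr≡1 0≤r ε≤x = begin
        r               ≡⟨ sym (ℚ.*-identityˡ r) ⟩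
        1ℚ * r          ≡⟨ cong (_* r) (sym εE≡1) ⟩
        ε * E * r       ≡⟨ solve 3 (λ a b c → a :* b :* c := b :* (a :* c)) refl ε E r ⟩
        E * (ε * r)     ≤⟨ *-mono {E} {E} {ε * r} {x * r} (ℚ.<⇒≤ 0<E) ℚ.≤-refl
                             (*-nonNeg {ε} {r} (ℚ.<⇒≤ 0<ε) 0≤r)
                             (*-mono {ε} {x} {r} {r} (ℚ.≤-trans (ℚ.<⇒≤ 0<ε) ε≤x) ε≤x 0≤r ℚ.≤-refl) ⟩
        E * (x * r)     ≡⟨ cong (E *_) xr≡1 ⟩
        E * 1ℚ          ≡⟨ ℚ.*-identityʳ E ⟩
        E               ∎
      recip-close : ∀ E x y u v d → 0ℚ < E → ε * E ≡ 1ℚ → x * u ≡ 1ℚ → y * v ≡ 1ℚ →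
        0ℚ ≤ u → 0ℚ ≤ v → ε ≤ x → ε ≤ y → abs (x - y) ≤ d → abs (u - v) ≤ E * E * d
      recip-close E x y u v d 0<E εE≡1 xu≡1 yv≡1 0≤u 0≤v ε≤x ε≤y h = begin
        abs (u - v)                   ≡⟨ cong abs (trans
                                           (cong₂ _-_ (sym (trans (cong (u *_) yv≡1) (ℚ.*-identityʳ u)))
                                                      (sym (trans (cong (v *_) xu≡1) (ℚ.*-identityʳ v))))
                                           (solve 4 (λ u v x y → u :* (y :* v) :- v :* (x :* u)
                                             := u :* v :* (y :- x)) refl u v x y)) ⟩
        abs (u * v * (y - x))         ≡⟨ ℚ.∣p*q∣≡∣p∣*∣q∣ (u * v) (y - x) ⟩
        abs (u * v) * abs (y - x)     ≡⟨ cong₂ _*_ (ℚ.0≤p⇒∣p∣≡p (*-nonNeg {u} {v} 0≤u 0≤v)) (abs-sub y x) ⟩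
        u * v * abs (x - y)           ≤⟨ *-mono {u * v} {E * E} {abs (x - y)} {d}
                                           (*-nonNeg {E} {E} (ℚ.<⇒≤ 0<E) (ℚ.<⇒≤ 0<E))
                                           (*-mono {u} {E} {v} {E} (ℚ.<⇒≤ 0<E)
                                             (recip≤ E x u 0<E εE≡1 xu≡1 0≤u ε≤x) 0≤v
                                             (recip≤ E y v 0<E εE≡1 yv≡1 0≤v ε≤y))
                                           (ℚ.0≤∣p∣ (x - y)) h ⟩
        E * E * d                     ∎

  -- The largest s ≤ b with s² ≤ y, provided 0 ≤ y.
  rootSearch : ℚ → ℕ → ℕ
  rootSearch y zero = zero
  rootSearch y (suc b) =
    if does (fromℕ (suc b) * fromℕ (suc b) ℚ.≤? y) then suc b else rootSearch y b

  -- The numerator of y ≥ 0 is at least y, hence at least the integer part of √ y.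
  ⌊√_⌋ : ℚ → ℕ
  ⌊√ y ⌋ = rootSearch y ℤ.∣ ℚ.↥ y ∣

  -- The square root of max(q , 0), rounded down to a multiple of 1/(k+1).
  √approx : ℕ → ℚ → ℚ
  √approx k q = fromℕ ⌊√ (q ⊔ 0ℚ) * (fromℕ (suc k) * fromℕ (suc k)) ⌋ * 1/suc k

  rootSearch-lower : ∀ y b → 0ℚ ≤ y → fromℕ (rootSearch y b) * fromℕ (rootSearch y b) ≤ y
  rootSearch-lower y zero 0≤y = 0≤y
  rootSearch-lower y (suc b) 0≤y = step (fromℕ (suc b) * fromℕ (suc b) ℚ.≤? y)
    where
    step : (d : Dec (fromℕ (suc b) * fromℕ (suc b) ≤ y)) →
      let s = if does d then suc b else rootSearch y b in fromℕ s * fromℕ s ≤ y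
    step (yes h) = h
    step (no _)  = rootSearch-lower y b 0≤y

  rootSearch-upper : ∀ y b → y < fromℕ (suc b) * fromℕ (suc b) →
    y < fromℕ (suc (rootSearch y b)) * fromℕ (suc (rootSearch y b))
  rootSearch-upper y zero h = h
  rootSearch-upper y (suc b) h = step (fromℕ (suc b) * fromℕ (suc b) ℚ.≤? y)
    where
    step : (d : Dec (fromℕ (suc b) * fromℕ (suc b) ≤ y)) →
      let s = if does d then suc b else rootSearch y b in y < fromℕ (suc s) * fromℕ (suc s)
    step (yes _) = h
    step (no ¬p) = rootSearch-upper y b (ℚ.≰⇒> ¬p)

  ≤numerator : ∀ y → 0ℚ ≤ y → y ≤ fromℕ ℤ.∣ ℚ.↥ y ∣
  ≤numerator (mkℚ (ℤ.+ n) d _) _ = ℚ.toℚᵘ-cancel-≤ (ℚᵘ.≤-trans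
    (ℚᵘ.*≤* (ℤ.*-monoˡ-≤-nonNeg (ℤ.+ n) (ℤ.+≤+ (ℕ.s≤s ℕ.z≤n))))
    (ℚᵘ.≤-reflexive (ℚᵘ.≃-sym (toℚᵘ-/ (ℤ.+ n) 0))))
  ≤numerator (mkℚ (ℤ.-[1+ _ ]) _ _) (ℚ.*≤* ())

  n<[1+n]² : ∀ n → fromℕ n < fromℕ (suc n) * fromℕ (suc n)
  n<[1+n]² n = subst (λ a → fromℕ n < a * a) (sym (fromℕ-suc n)) (square (fromℕ n) (fromℕ-nonNeg n))
    where
    square : ∀ a → 0ℚ ≤ a → a < (a + 1ℚ) * (a + 1ℚ)
    square a 0≤a = begin-strict
      a                       ≡⟨ sym (ℚ.+-identityʳ a) ⟩
      a + 0ℚ                  <⟨ ℚ.+-monoʳ-< a (ℚ.<-≤-trans (ℚ.positive⁻¹ 1ℚ)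
                                   (subst (_≤ 1ℚ + (a + a * a)) (ℚ.+-identityʳ 1ℚ)
                                     (ℚ.+-monoʳ-≤ 1ℚ (+-nonNeg {a} {a * a} 0≤a (sq-nonNeg a))))) ⟩
      a + (1ℚ + (a + a * a))  ≡⟨ solve 1 (λ a → a :+ (con 1ℚ :+ (a :+ a :* a))
                                   := (a :+ con 1ℚ) :* (a :+ con 1ℚ)) refl a ⟩
      (a + 1ℚ) * (a + 1ℚ)     ∎

  √approx-nonNeg : ∀ k q → 0ℚ ≤ √approx k q
  √approx-nonNeg k q = *-nonNeg {fromℕ s} {1/suc k} (fromℕ-nonNeg s) (1/suc-nonNeg k)
    where
    s : ℕ
    s = ⌊√ (q ⊔ 0ℚ) * (fromℕ (suc k) * fromℕ (suc k)) ⌋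

  √approx-bounds : ∀ k q → √approx k q * √approx k q ≤ q ⊔ 0ℚ ×
    q ⊔ 0ℚ < (√approx k q + 1/suc k) * (√approx k q + 1/suc k)
  √approx-bounds k q = rescale (fromℕ (suc k)) (1/suc k) (q ⊔ 0ℚ) (fromℕ s) (fromℕ (suc s))
    (1/suc-inverse k) (1/suc-pos k) (fromℕ-suc s)
    (rootSearch-lower y b 0≤y) (rootSearch-upper y b (ℚ.≤-<-trans (≤numerator y 0≤y) (n<[1+n]² b)))
    where
    y : ℚ
    y = (q ⊔ 0ℚ) * (fromℕ (suc k) * fromℕ (suc k))
    s b : ℕ
    s = ⌊√ y ⌋
    b = ℤ.∣ ℚ.↥ y ∣
    0≤y : 0ℚ ≤ y
    0≤y = *-nonNeg {q ⊔ 0ℚ} {fromℕ (suc k) * fromℕ (suc k)}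
      (ℚ.p≤q⊔p q 0ℚ) (sq-nonNeg (fromℕ (suc k)))
    rescale : ∀ m i p s t → m * i ≡ 1ℚ → 0ℚ < i → t ≡ s + 1ℚ → s * s ≤ p * (m * m) → p * (m * m) < t * t →
      (s * i) * (s * i) ≤ p × p < (s * i + i) * (s * i + i)
    rescale m i p s t mi≡1 0<i t≡s+1 lower upper = lower′ , upper′
      where
      shrink : p * (m * m) * (i * i) ≡ p
      shrink = trans
        (solve 3 (λ p m i → p :* (m :* m) :* (i :* i) := p :* ((m :* i) :* (m :* i))) refl p m i)
        (trans (cong (λ a → p * (a * a)) mi≡1) (ℚ.*-identityʳ p))
      lower′ : (s * i) * (s * i) ≤ p
      lower′ = begin
        (s * i) * (s * i)     ≡⟨ solve 2 (λ s i → (s :* i) :* (s :* i) := (s :* s) :* (i :* i)) refl s i ⟩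
        (s * s) * (i * i)     ≤⟨ ℚ.*-monoʳ-≤-nonNeg (i * i) {{ℚ.nonNegative (sq-nonNeg i)}} lower ⟩
        p * (m * m) * (i * i) ≡⟨ shrink ⟩
        p                     ∎
      upper′ : p < (s * i + i) * (s * i + i)
      upper′ = begin-strict
        p                                   ≡⟨ sym shrink ⟩
        p * (m * m) * (i * i)               <⟨ ℚ.*-monoˡ-<-pos (i * i)
                                                 {{ℚ.positive (*-pos {i} {i} 0<i 0<i)}} upper ⟩
        t * t * (i * i)                     ≡⟨ cong (λ a → a * a * (i * i)) t≡s+1 ⟩
        (s + 1ℚ) * (s + 1ℚ) * (i * i)       ≡⟨ solve 2 (λ s i → (s :+ con 1ℚ) :* (s :+ con 1ℚ) :* (i :* i)
                                                 := (s :* i :+ i) :* (s :* i :+ i)) refl s i ⟩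
        (s * i + i) * (s * i + i)           ∎

  root-close : ∀ e a b i x y → 0ℚ < e → 0ℚ ≤ a → 0ℚ ≤ b → 0ℚ ≤ i → i ≤ e →
    a * a ≤ x → y < (b + i) * (b + i) → x - y ≤ e * e → a - b < e + e
  root-close e a b i x y 0<e 0≤a 0≤b 0≤i i≤e a²≤x y<[b+i]² x-y≤e² = ℚ.≰⇒> λ 2e≤a-b →
    ℚ.<-irrefl refl (contradictory (shift 2e≤a-b))
    where
    0≤e : 0ℚ ≤ e
    0≤e = ℚ.<⇒≤ 0<e
    0≤b+e : 0ℚ ≤ b + e
    0≤b+e = +-nonNeg {b} {e} 0≤b 0≤e
    shift : e + e ≤ a - b → (b + e) + e ≤ a
    shift h = begin
      (b + e) + e     ≡⟨ solve 2 (λ b e → (b :+ e) :+ e := (e :+ e) :+ b) refl b e ⟩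
      (e + e) + b     ≤⟨ ℚ.+-monoˡ-≤ b h ⟩
      (a - b) + b     ≡⟨ solve 2 (λ a b → (a :- b) :+ b := a) refl a b ⟩
      a               ∎
    contradictory : (b + e) + e ≤ a → x < x
    contradictory h = begin-strict
      x                                       ≤⟨ ≤-from-sub {x} {y} {e * e} x-y≤e² ⟩
      e * e + y                               <⟨ ℚ.+-monoʳ-< (e * e) y<[b+i]² ⟩
      e * e + (b + i) * (b + i)               ≤⟨ ℚ.+-monoʳ-≤ (e * e) (*-mono {b + i} {b + e} {b + i} {b + e} 0≤b+e
                                                   (ℚ.+-monoʳ-≤ b i≤e) (+-nonNeg {b} {i} 0≤b 0≤i) (ℚ.+-monoʳ-≤ b i≤e)) ⟩
      e * e + (b + e) * (b + e)               ≡⟨ sym (ℚ.+-identityʳ (e * e + (b + e) * (b + e))) ⟩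
      e * e + (b + e) * (b + e) + 0ℚ          ≤⟨ ℚ.+-monoʳ-≤ (e * e + (b + e) * (b + e))
                                                   (+-nonNeg {(b + e) * e} {(b + e) * e}
                                                     (*-nonNeg {b + e} {e} 0≤b+e 0≤e) (*-nonNeg {b + e} {e} 0≤b+e 0≤e)) ⟩
      e * e + (b + e) * (b + e) + ((b + e) * e + (b + e) * e)
                                              ≡⟨ solve 2 (λ b e → e :* e :+ (b :+ e) :* (b :+ e)
                                                     :+ ((b :+ e) :* e :+ (b :+ e) :* e)
                                                   := ((b :+ e) :+ e) :* ((b :+ e) :+ e)) refl b e ⟩
      ((b + e) + e) * ((b + e) + e)           ≤⟨ *-mono {(b + e) + e} {a} {(b + e) + e} {a} 0≤a h
                                                   (+-nonNeg {b + e} {e} 0≤b+e 0≤e) h ⟩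
      a * a                                   ≤⟨ a²≤x ⟩
      x                                       ∎

  abstract
    squareRoot : ∀ {s} → IsCauchy s → IsCauchy (λ k → √approx k (s k))
    squareRoot {s} cs ε 0<ε =
      let L , hL = archimedean e 0<e
          N , f  = cs (e * e) (*-pos {e} {e} 0<e 0<e)
          close : ∀ m n → L ℕ.⊔ N ℕ.≤ m → L ℕ.⊔ N ℕ.≤ n → √approx m (s m) - √approx n (s n) < ½ * ε
          close m n h k = subst (√approx m (s m) - √approx n (s n) <_) (half+half (½ * ε))
            (root-close e (√approx m (s m)) (√approx n (s n)) (1/suc n) (s m ⊔ 0ℚ) (s n ⊔ 0ℚ)
              0<e (√approx-nonNeg m (s m)) (√approx-nonNeg n (s n)) (1/suc-nonNeg n)
              (ℚ.≤-trans (1/suc-antitone (ℕ.m⊔n≤o⇒m≤o L N k)) (ℚ.<⇒≤ hL))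
              (proj₁ (√approx-bounds m (s m))) (proj₂ (√approx-bounds n (s n)))
              (ℚ.≤-trans (≤abs ((s m ⊔ 0ℚ) - (s n ⊔ 0ℚ)))
                (ℚ.≤-trans (⊔-lipschitz (s m) (s n) 0ℚ)
                  (ℚ.<⇒≤ (f m n (ℕ.m⊔n≤o⇒n≤o L N h) (ℕ.m⊔n≤o⇒n≤o L N k))))))
      in L ℕ.⊔ N , λ m n h k → both (√approx m (s m)) (√approx n (s n)) (close m n h k) (close n m k h)
      where
      e : ℚ
      e = ½ * (½ * ε)
      0<e : 0ℚ < e
      0<e = half-pos (half-pos 0<ε)
      both : ∀ a b → a - b < ½ * ε → b - a < ½ * ε → abs (a - b) < ε
      both a b h k = ℚ.≤-<-trans
        (abs≤ {a - b} {½ * ε} (ℚ.<⇒≤ h)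
          (subst (_≤ ½ * ε) (solve 2 (λ a b → b :- a := :- (a :- b)) refl a b) (ℚ.<⇒≤ k)))
        (begin-strict
          ½ * ε           ≡⟨ sym (ℚ.+-identityʳ (½ * ε)) ⟩
          ½ * ε + 0ℚ      <⟨ ℚ.+-monoʳ-< (½ * ε) (half-pos 0<ε) ⟩
          ½ * ε + ½ * ε   ≡⟨ half+half ε ⟩
          ε               ∎)

  abstract
    diagonal : ∀ {x : ℕ → ℕ → ℚ} → (∀ j → IsCauchy (x j)) →
      (∀ ε → 0ℚ < ε → ∃ λ J → ∀ k i → J ℕ.≤ k → J ℕ.≤ i → abs (x k i - x J i) ≤ ε) →
      IsCauchy (λ k → x k k)
    diagonal {x} cauchy uniform ε 0<ε =
      let J , f = uniform e 0<e
          N , g = cauchy J e 0<e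
      in J ℕ.⊔ N , λ m n h k → triangle (x m m) (x J m) (x J n) (x n n)
           (f m m (ℕ.m⊔n≤o⇒m≤o J N h) (ℕ.m⊔n≤o⇒m≤o J N h))
           (g m n (ℕ.m⊔n≤o⇒n≤o J N h) (ℕ.m⊔n≤o⇒n≤o J N k))
           (f n n (ℕ.m⊔n≤o⇒m≤o J N k) (ℕ.m⊔n≤o⇒m≤o J N k))
      where
      e : ℚ
      e = ½ * (½ * ε)
      0<e : 0ℚ < e
      0<e = half-pos (half-pos 0<ε)
      triangle : ∀ a b c d → abs (a - b) ≤ e → abs (b - c) < e → abs (d - c) ≤ e → abs (a - d) < ε
      triangle a b c d ab bc dc = begin-strict
        abs (a - d)                               ≤⟨ abs-tri a b d ⟩
        abs (a - b) + abs (b - d)                 ≤⟨ ℚ.+-monoʳ-≤ (abs (a - b)) (abs-tri b c d) ⟩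
        abs (a - b) + (abs (b - c) + abs (c - d)) ≡⟨ cong (λ t → abs (a - b) + (abs (b - c) + t)) (abs-sub c d) ⟩
        abs (a - b) + (abs (b - c) + abs (d - c)) <⟨ ℚ.+-mono-≤-< {abs (a - b)} {e} {abs (b - c) + abs (d - c)} {e + e} ab
                                                       (ℚ.+-mono-<-≤ {abs (b - c)} {e} {abs (d - c)} {e} bc dc) ⟩
        e + (e + e)                               ≡⟨ sym (ℚ.+-identityʳ (e + (e + e))) ⟩
        e + (e + e) + 0ℚ                          <⟨ ℚ.+-monoʳ-< (e + (e + e)) 0<e ⟩
        e + (e + e) + e                           ≡⟨ solve 1 (λ e → e :+ (e :+ e) :+ e := (e :+ e) :+ (e :+ e)) refl e ⟩
        (e + e) + (e + e)                         ≡⟨ cong₂ _+_ (half+half (½ * ε)) (half+half (½ * ε)) ⟩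
        ½ * ε + ½ * ε                             ≡⟨ half+half ε ⟩
        ε                                         ∎

  -- 1/(2n+1) - (1/(2n+3) - (1/(2n+5) - …)), with m terms.
  leibniz : ℕ → ℕ → ℚ
  leibniz n zero    = 0ℚ
  leibniz n (suc m) = 1/suc (2 ℕ.* n) - leibniz (suc n) m

  leibniz-bounds : ∀ n m → 0ℚ ≤ leibniz n m × leibniz n m ≤ 1/suc (2 ℕ.* n)
  leibniz-bounds n zero    = ℚ.≤-refl , 1/suc-nonNeg (2 ℕ.* n)
  leibniz-bounds n (suc m) = step (1/suc (2 ℕ.* n)) (1/suc (2 ℕ.* suc n)) (leibniz (suc n) m)
    (1/suc-antitone (ℕ.*-monoʳ-≤ 2 (ℕ.n≤1+n n)))
    (proj₁ (leibniz-bounds (suc n) m)) (proj₂ (leibniz-bounds (suc n) m))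
    where
    step : ∀ a b t → b ≤ a → 0ℚ ≤ t → t ≤ b → 0ℚ ≤ a - t × a - t ≤ a
    step a b t b≤a 0≤t t≤b =
        subst (_≤ a - t) (ℚ.+-inverseʳ t) (ℚ.+-monoˡ-≤ (- t) (ℚ.≤-trans t≤b b≤a))
      , ≤-to-sub {a} {t} {a} (subst (_≤ a + t) (ℚ.+-identityʳ a) (ℚ.+-monoʳ-≤ a 0≤t))

  leibniz-tail : ∀ n m k → m ℕ.≤ k → abs (leibniz n k - leibniz n m) ≤ 1/suc (2 ℕ.* (m ℕ.+ n))
  leibniz-tail n zero k _ = abs≤⇒abs-sub≤ {leibniz n k} {0ℚ}
    (proj₁ (leibniz-bounds n k)) (proj₂ (leibniz-bounds n k)) ℚ.≤-refl (1/suc-nonNeg (2 ℕ.* n))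
  leibniz-tail n (suc m) (suc k) (ℕ.s≤s m≤k) =
    subst (λ t → abs (leibniz n (suc k) - leibniz n (suc m)) ≤ 1/suc (2 ℕ.* t)) (ℕ.+-suc m n)
      (subst (_≤ 1/suc (2 ℕ.* (m ℕ.+ suc n)))
        (flip (1/suc (2 ℕ.* n)) (leibniz (suc n) k) (leibniz (suc n) m))
        (leibniz-tail (suc n) m k m≤k))
    where
    flip : ∀ a b c → abs (b - c) ≡ abs ((a - b) - (a - c))
    flip a b c = trans (abs-sub b c)
      (cong abs (solve 3 (λ a b c → c :- b := (a :- b) :- (a :- c)) refl a b c))

  abstract
    leibniz-cauchy : IsCauchy (leibniz 0)
    leibniz-cauchy = fromTail {leibniz 0} λ ε 0<ε →
      let N , h = archimedean ε 0<ε
      in N , λ k N≤k → ℚ.≤-<-trans (leibniz-tail 0 N k N≤k)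
           (ℚ.≤-<-trans (1/suc-antitone
             (ℕ.≤-trans (ℕ.m≤m+n N 0) (ℕ.m≤n*m (N ℕ.+ 0) 2))) h)

  -- (2M)ⁿ / n!
  majorant : ℚ → ℕ → ℚ
  majorant M zero    = 1ℚ
  majorant M (suc n) = 1/suc n * (M * majorant M n + M * majorant M n)

  majorant-nonNeg : ∀ {M} → 0ℚ ≤ M → ∀ n → 0ℚ ≤ majorant M n
  majorant-nonNeg 0≤M zero = ℚ.nonNegative⁻¹ 1ℚ
  majorant-nonNeg {M} 0≤M (suc n) = *-nonNeg {1/suc n} {M * r + M * r} (1/suc-nonNeg n)
    (+-nonNeg {M * r} {M * r} (*-nonNeg {M} {r} 0≤M 0≤r) (*-nonNeg {M} {r} 0≤M 0≤r))
    where
    r : ℚ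
    r = majorant M n
    0≤r : 0ℚ ≤ r
    0≤r = majorant-nonNeg 0≤M n

  -- From some index on the majorant at least halves at each step.
  majorant-halves : ∀ {M} → 0ℚ ≤ M → ∃ λ J → ∀ n → J ℕ.≤ n →
    majorant M (suc n) + majorant M (suc n) ≤ majorant M n
  majorant-halves {M} 0≤M =
    let J , h = archimedean′ ((M + M) + (M + M)) 1ℚ
                  (+-nonNeg {M + M} {M + M} (+-nonNeg {M} {M} 0≤M 0≤M) (+-nonNeg {M} {M} 0≤M 0≤M))
                  (ℚ.positive⁻¹ 1ℚ)
    in J , λ n J≤n → halve (1/suc J) (1/suc n) (majorant M n) (ℚ.<⇒≤ h)
                       (1/suc-nonNeg n) (1/suc-antitone J≤n) (majorant-nonNeg 0≤M n)
    where
    halve : ∀ j i r → ((M + M) + (M + M)) * j ≤ 1ℚ → 0ℚ ≤ i → i ≤ j → 0ℚ ≤ r →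
      i * (M * r + M * r) + i * (M * r + M * r) ≤ r
    halve j i r h 0≤i i≤j 0≤r = begin
      i * (M * r + M * r) + i * (M * r + M * r) ≡⟨ solve 3 (λ i M r → i :* (M :* r :+ M :* r) :+ i :* (M :* r :+ M :* r)
                                                     := ((M :+ M) :+ (M :+ M)) :* i :* r) refl i M r ⟩
      K * i * r                                 ≤⟨ *-mono {K * i} {1ℚ} {r} {r} (ℚ.nonNegative⁻¹ 1ℚ)
                                                     (ℚ.≤-trans (*-mono {K} {K} {i} {j} 0≤K ℚ.≤-refl 0≤i i≤j) h)
                                                     0≤r ℚ.≤-refl ⟩
      1ℚ * r                                    ≡⟨ ℚ.*-identityˡ r ⟩
      r                                         ∎
      where
      K : ℚ
      K = (M + M) + (M + M)
      0≤K : 0ℚ ≤ K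
      0≤K = +-nonNeg {M + M} {M + M} (+-nonNeg {M} {M} 0≤M 0≤M) (+-nonNeg {M} {M} 0≤M 0≤M)

  majorant-small : ∀ {M} → 0ℚ ≤ M → ∀ ε → 0ℚ < ε → ∃ λ J →
    majorant M J + majorant M J ≤ ε ×
    (∀ n → J ℕ.≤ n → majorant M (suc n) + majorant M (suc n) ≤ majorant M n)
  majorant-small {M} 0≤M ε 0<ε =
    let J , halves = majorant-halves 0≤M
        K , h      = archimedean′ (majorant M J) (½ * ε) (majorant-nonNeg 0≤M J) (half-pos 0<ε)
    in K ℕ.+ J
     , double (majorant M (K ℕ.+ J)) (ℚ.≤-trans (decay J halves K) (ℚ.<⇒≤ h))
     , λ n K+J≤n → halves n (ℕ.≤-trans (ℕ.m≤n+m J K) K+J≤n)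
    where
    double : ∀ r → r ≤ ½ * ε → r + r ≤ ε
    double r h = subst (r + r ≤_) (half+half ε) (ℚ.+-mono-≤ {r} {½ * ε} {r} {½ * ε} h h)

    2/[i+2] : ∀ i → 1/suc i ≤ 1/suc (suc i) + 1/suc (suc i)
    2/[i+2] i = ℚ.≤-trans
      (/-≤ (ℤ.+ 1) i (ℤ.+ 2) (suc i) (ℤ.+≤+ (ℕ.s≤s (bound))))
      (ℚ.≤-reflexive (ℚ.toℚᵘ-injective (ℚᵘ.≃-trans (toℚᵘ-/ (ℤ.+ 2) (suc i))
        (ℚᵘ.≃-trans (ℚᵘ.*≡* double-fraction)
          (ℚᵘ.≃-trans (ℚᵘ.+-cong (ℚᵘ.≃-sym (toℚᵘ-/ (ℤ.+ 1) (suc i))) (ℚᵘ.≃-sym (toℚᵘ-/ (ℤ.+ 1) (suc i))))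
            (ℚᵘ.≃-sym (ℚ.toℚᵘ-homo-+ (1/suc (suc i)) (1/suc (suc i)))))))))
      where
      bound : suc i ℕ.+ 0 ℕ.≤ i ℕ.+ suc (i ℕ.+ 0)
      bound = subst (suc (i ℕ.+ 0) ℕ.≤_) (sym (ℕ.+-suc i (i ℕ.+ 0))) (ℕ.s≤s (ℕ.m≤n+m (i ℕ.+ 0) i))
      double-fraction : ℤ.+ 2 ℤ.* (ℤ.+ suc (suc i) ℤ.* ℤ.+ suc (suc i))
        ≡ (ℤ.+ 1 ℤ.* ℤ.+ suc (suc i) ℤ.+ ℤ.+ 1 ℤ.* ℤ.+ suc (suc i)) ℤ.* ℤ.+ suc (suc i)
      double-fraction = trans (sym (ℤ.*-assoc (ℤ.+ 2) n n))
        (cong (ℤ._* n) (ℤ.*-distribʳ-+ n (ℤ.+ 1) (ℤ.+ 1)))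
        where
        n : ℤ
        n = ℤ.+ suc (suc i)

    decay : ∀ J → (∀ n → J ℕ.≤ n → majorant M (suc n) + majorant M (suc n) ≤ majorant M n) →
      ∀ i → majorant M (i ℕ.+ J) ≤ majorant M J * 1/suc i
    decay J halves zero = ℚ.≤-reflexive (sym (ℚ.*-identityʳ (majorant M J)))
    decay J halves (suc i) = step (majorant M (suc (i ℕ.+ J))) (majorant M (i ℕ.+ J)) (majorant M J)
      (1/suc i) (1/suc (suc i)) (majorant-nonNeg 0≤M J)
      (halves (i ℕ.+ J) (ℕ.m≤n+m J i)) (decay J halves i) (1/suc-nonNeg i) (2/[i+2] i)
      where
      step : ∀ r′ r R a b → 0ℚ ≤ R → r′ + r′ ≤ r → r ≤ R * a → 0ℚ ≤ a → a ≤ b + b → r′ ≤ R * b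
      step r′ r R a b 0≤R h k 0≤a a≤2b = begin
        r′                      ≡⟨ solve 1 (λ r → r := con ½ :* (r :+ r)) refl r′ ⟩
        ½ * (r′ + r′)           ≤⟨ ℚ.*-monoˡ-≤-nonNeg ½ (ℚ.≤-trans h (ℚ.≤-trans k
                                     (*-mono {R} {R} {a} {b + b} 0≤R ℚ.≤-refl 0≤a a≤2b))) ⟩
        ½ * (R * (b + b))       ≡⟨ solve 2 (λ R b → con ½ :* (R :* (b :+ b)) := R :* b) refl R b ⟩
        R * b                   ∎

  series-tail : ∀ {M} → 0ℚ ≤ M → ∀ (p t : ℕ → ℚ) → (∀ n → p (suc n) ≡ p n + t n) →
    (∀ n → abs (t n) ≤ majorant M n) → ∀ {J} →
    (∀ n → J ℕ.≤ n → majorant M (suc n) + majorant M (suc n) ≤ majorant M n) →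
    ∀ k → J ℕ.≤ k → abs (p k - p J) ≤ majorant M J + majorant M J
  series-tail {M} 0≤M p t p-suc t≤ {J} halves k J≤k =
    subst (λ k → abs (p k - p J) ≤ r J + r J) (ℕ.m∸n+n≡m J≤k)
      (drop (abs (p (i ℕ.+ J) - p J)) (r (i ℕ.+ J)) (r J)
        (majorant-nonNeg 0≤M (i ℕ.+ J)) (go i))
    where
    r : ℕ → ℚ
    r = majorant M
    i : ℕ
    i = k ℕ.∸ J
    drop : ∀ a b c → 0ℚ ≤ b → a + (b + b) ≤ c + c → a ≤ c + c
    drop a b c 0≤b h = ℚ.≤-trans
      (subst (_≤ a + (b + b)) (ℚ.+-identityʳ a) (ℚ.+-monoʳ-≤ a (+-nonNeg {b} {b} 0≤b 0≤b))) h
    step : ∀ q q′ b t r r′ c → q′ ≡ q + t → abs t ≤ r → r′ + r′ ≤ r →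
      abs (q - b) + (r + r) ≤ c → abs (q′ - b) + (r′ + r′) ≤ c
    step q q′ b t r r′ c e t≤r h k = begin
      abs (q′ - b) + (r′ + r′)        ≡⟨ cong (λ x → abs (x - b) + (r′ + r′)) e ⟩
      abs (q + t - b) + (r′ + r′)     ≡⟨ cong (λ x → abs x + (r′ + r′))
                                           (solve 3 (λ q t b → q :+ t :- b := (q :- b) :+ t) refl q t b) ⟩
      abs ((q - b) + t) + (r′ + r′)   ≤⟨ ℚ.+-mono-≤ {abs ((q - b) + t)} {abs (q - b) + r} {r′ + r′} {r}
                                           (ℚ.≤-trans (ℚ.∣p+q∣≤∣p∣+∣q∣ (q - b) t) (ℚ.+-monoʳ-≤ (abs (q - b)) t≤r)) h ⟩
      abs (q - b) + r + r             ≡⟨ ℚ.+-assoc (abs (q - b)) r r ⟩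
      abs (q - b) + (r + r)           ≤⟨ k ⟩
      c                               ∎
    go : ∀ i → abs (p (i ℕ.+ J) - p J) + (r (i ℕ.+ J) + r (i ℕ.+ J)) ≤ r J + r J
    go zero = ℚ.≤-reflexive (trans (cong (_+ (r J + r J)) (abs-self (p J))) (ℚ.+-identityˡ (r J + r J)))
    go (suc i) = step (p (i ℕ.+ J)) (p (suc (i ℕ.+ J))) (p J) (t (i ℕ.+ J)) (r (i ℕ.+ J)) (r (suc (i ℕ.+ J)))
      (r J + r J) (p-suc (i ℕ.+ J)) (t≤ (i ℕ.+ J)) (halves (i ℕ.+ J) (ℕ.m≤n+m J i)) (go i)

  abs-* : ∀ {a b A B} → 0ℚ ≤ A → abs a ≤ A → abs b ≤ B → abs (a * b) ≤ A * B
  abs-* {a} {b} {A} {B} 0≤A a≤A b≤B = subst (_≤ A * B) (sym (ℚ.∣p*q∣≡∣p∣*∣q∣ a b))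
    (*-mono {abs a} {A} {abs b} {B} 0≤A a≤A (ℚ.0≤∣p∣ b) b≤B)

  abs-scaled : ∀ {a c C} → 0ℚ ≤ c → abs a ≤ C → abs (c * a) ≤ c * C
  abs-scaled {a} {c} {C} 0≤c a≤C = abs-* {c} {a} {c} {C} 0≤c (ℚ.≤-reflexive (ℚ.0≤p⇒∣p∣≡p 0≤c)) a≤C

  abs-+ : ∀ {a b A B} → abs a ≤ A → abs b ≤ B → abs (a + b) ≤ A + B
  abs-+ {a} {b} {A} {B} h k = ℚ.≤-trans (ℚ.∣p+q∣≤∣p∣+∣q∣ a b) (ℚ.+-mono-≤ {abs a} {A} {abs b} {B} h k)

-- Without quotients, real numbers are compared by _≈_ rather than _≡_.
record ℝ : Set where
  constructor real
  field
    seq    : ℕ → ℚ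
    cauchy : IsCauchy seq

open ℝ public

infix  4 _≈_ _≤_ _<_
infix  8 -_
infixl 7 _*_
infixl 6 _+_ _-_

_≈_ _≤_ _<_ : ℝ → ℝ → Set
x ≈ y = ∀ ε → 0ℚ ℚ.< ε → ∃ λ N → ∀ k → N ℕ.≤ k → ℚ.∣ seq x k ℚ.- seq y k ∣ ℚ.≤ ε
x ≤ y = ∀ ε → 0ℚ ℚ.< ε → ∃ λ N → ∀ k → N ℕ.≤ k → seq x k ℚ.≤ seq y k ℚ.+ ε
x < y = ∃ λ ε → 0ℚ ℚ.< ε × ∃ λ N → ∀ k → N ℕ.≤ k → seq x k ℚ.+ ε ℚ.≤ seq y k

fromℚ : ℚ → ℝ
fromℚ q = real (λ _ → q) (CauchyProperties.constant q)

fromℤ : ℤ → ℝ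
fromℤ i = fromℚ (i ℚ./ 1)

0ℝ 1ℝ : ℝ
0ℝ = fromℚ 0ℚ
1ℝ = fromℚ 1ℚ

_+_ _*_ : ℝ → ℝ → ℝ
x + y = real (λ k → seq x k ℚ.+ seq y k) (CauchyProperties.plus {seq x} {seq y} (cauchy x) (cauchy y))
x * y = real (λ k → seq x k ℚ.* seq y k) (CauchyProperties.times {seq x} {seq y} (cauchy x) (cauchy y))

-_ : ℝ → ℝ
- x = real (λ k → ℚ.- seq x k) (CauchyProperties.negate {seq x} (cauchy x))

_-_ : ℝ → ℝ → ℝ
x - y = x + (- y)

-- The terms are 1 / max(xₖ , ε), where ε is the rational lower bound on x
-- provided by 0ℝ < x.
inverse : (x : ℝ) → 0ℝ < x → ℝ
inverse x (ε , 0<ε , _) =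
  real (λ k → CauchyProperties.recip 0<ε (seq x k)) (CauchyProperties.reciprocal {seq x} 0<ε (cauchy x))

-- The square root of max(x , 0).
√ : ℝ → ℝ
√ x = real (λ k → CauchyProperties.√approx k (seq x k)) (CauchyProperties.squareRoot {seq x} (cauchy x))

-- π = 4 (1 - 1/3 + 1/5 - …)
π : ℝ
π = fromℤ (ℤ.+ 4) * real (CauchyProperties.leibniz 0) CauchyProperties.leibniz-cauchy

-- The floor of a real number is not computable, so ⌊θ⌋ is described by its
-- defining inequalities.
IsFractionalPart : ℝ → ℝ → Set
IsFractionalPart f θ = ∃ λ (i : ℤ) → fromℤ i ≤ θ × θ < fromℤ i + 1ℝ × f ≈ θ - fromℤ i

record ℂ : Set where
  constructor _+i_
  field
    re im : ℝ

open ℂ public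

infix  4 _≈ᶜ_
infixl 7 _*ᶜ_ _·ᶜ_
infixl 6 _+ᶜ_ _-ᶜ_

_≈ᶜ_ : ℂ → ℂ → Set
z ≈ᶜ w = re z ≈ re w × im z ≈ im w

fromℝ : ℝ → ℂ
fromℝ x = x +i 0ℝ

0ℂ 1ℂ iℂ : ℂ
0ℂ = fromℝ 0ℝ
1ℂ = fromℝ 1ℝ
iℂ = 0ℝ +i 1ℝ

_+ᶜ_ _-ᶜ_ _*ᶜ_ : ℂ → ℂ → ℂ
z +ᶜ w = (re z + re w) +i (im z + im w)
z -ᶜ w = (re z - re w) +i (im z - im w)
z *ᶜ w = (re z * re w - im z * im w) +i (re z * im w + im z * re w)

_·ᶜ_ : ℝ → ℂ → ℂ
x ·ᶜ z = (x * re z) +i (x * im z)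

conj : ℂ → ℂ
conj z = re z +i (- im z)

normSq : ℂ → ℝ
normSq z = re z * re z + im z * im z

∣_∣ : ℂ → ℝ
∣ z ∣ = √ (normSq z)

dist : ℂ → ℂ → ℝ
dist z w = ∣ z -ᶜ w ∣

NonZero : ℂ → Set
NonZero z = 0ℝ < normSq z

divide : (z w : ℂ) → NonZero w → ℂ
divide z w w≠0 = inverse (normSq w) w≠0 ·ᶜ (z *ᶜ conj w)

-- zⁿ / n!
expTerm : ℂ → ℕ → ℂ
expTerm z zero    = 1ℂ
expTerm z (suc n) = fromℚ (1/suc n) ·ᶜ (z *ᶜ expTerm z n)

expSum : ℂ → ℕ → ℂ
expSum z zero    = 0ℂ
expSum z (suc n) = expSum z n +ᶜ expTerm z n

module ExpConvergence (z : ℂ) where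

  open CauchyProperties
  open Estimates using (1/suc-nonNeg)

  part-bound : ∃ λ M → 0ℚ ℚ.≤ M × ∃ λ N → ∀ k → N ℕ.≤ k →
    ℚ.∣ seq (re z) k ∣ ℚ.≤ M × ℚ.∣ seq (im z) k ∣ ℚ.≤ M
  part-bound =
    let A , 0<A , P , f = bounded {seq (re z)} (cauchy (re z))
        B , 0<B , Q , g = bounded {seq (im z)} (cauchy (im z))
    in A ℚ.⊔ B , ℚ.≤-trans (ℚ.<⇒≤ 0<A) (ℚ.p≤p⊔q A B) , P ℕ.⊔ Q , λ k h →
         ℚ.≤-trans (f k (ℕ.m⊔n≤o⇒m≤o P Q h)) (ℚ.p≤p⊔q A B)
       , ℚ.≤-trans (g k (ℕ.m⊔n≤o⇒n≤o P Q h)) (ℚ.p≤q⊔p A B)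

  term-bound : ∀ {M} → 0ℚ ℚ.≤ M → ∀ k → ℚ.∣ seq (re z) k ∣ ℚ.≤ M → ℚ.∣ seq (im z) k ∣ ℚ.≤ M →
    ∀ n → ℚ.∣ seq (re (expTerm z n)) k ∣ ℚ.≤ majorant M n × ℚ.∣ seq (im (expTerm z n)) k ∣ ℚ.≤ majorant M n
  term-bound 0≤M k x≤M y≤M zero = ℚ.≤-refl , ℚ.nonNegative⁻¹ 1ℚ
  term-bound {M} 0≤M k x≤M y≤M (suc n) =
    step (1/suc n) (seq (re z) k) (seq (im z) k) (seq (re (expTerm z n)) k) (seq (im (expTerm z n)) k)
      (majorant M n) (1/suc-nonNeg n) x≤M y≤M
      (proj₁ (term-bound 0≤M k x≤M y≤M n)) (proj₂ (term-bound 0≤M k x≤M y≤M n))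
    where
    step : ∀ c x y u v r → 0ℚ ℚ.≤ c → ℚ.∣ x ∣ ℚ.≤ M → ℚ.∣ y ∣ ℚ.≤ M → ℚ.∣ u ∣ ℚ.≤ r → ℚ.∣ v ∣ ℚ.≤ r →
      ℚ.∣ c ℚ.* (x ℚ.* u ℚ.+ ℚ.- (y ℚ.* v)) ∣ ℚ.≤ c ℚ.* (M ℚ.* r ℚ.+ M ℚ.* r) ×
      ℚ.∣ c ℚ.* (x ℚ.* v ℚ.+ y ℚ.* u) ∣ ℚ.≤ c ℚ.* (M ℚ.* r ℚ.+ M ℚ.* r)
    step c x y u v r 0≤c x≤ y≤ u≤ v≤ =
        abs-scaled {x ℚ.* u ℚ.+ ℚ.- (y ℚ.* v)} {c} 0≤c (abs-+ {x ℚ.* u} {ℚ.- (y ℚ.* v)}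
          (abs-* {x} {u} {M} {r} 0≤M x≤ u≤)
          (subst (ℚ._≤ M ℚ.* r) (sym (ℚ.∣-p∣≡∣p∣ (y ℚ.* v))) (abs-* {y} {v} {M} {r} 0≤M y≤ v≤)))
      , abs-scaled {x ℚ.* v ℚ.+ y ℚ.* u} {c} 0≤c (abs-+ {x ℚ.* v} {y ℚ.* u}
          (abs-* {x} {v} {M} {r} 0≤M x≤ v≤) (abs-* {y} {u} {M} {r} 0≤M y≤ u≤))

  converges : (part : ℂ → ℝ) →
    (∀ n k → seq (part (expSum z (suc n))) k ≡ seq (part (expSum z n)) k ℚ.+ seq (part (expTerm z n)) k) →
    (∀ {M} → 0ℚ ℚ.≤ M → ∀ k → ℚ.∣ seq (re z) k ∣ ℚ.≤ M → ℚ.∣ seq (im z) k ∣ ℚ.≤ M →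
      ∀ n → ℚ.∣ seq (part (expTerm z n)) k ∣ ℚ.≤ majorant M n) →
    IsCauchy (λ n → seq (part (expSum z n)) n)
  converges part additive bound =
    diagonal {λ n k → seq (part (expSum z n)) k} (λ n → cauchy (part (expSum z n))) λ ε 0<ε →
      let M , 0≤M , N , z≤M   = part-bound
          J , 2r≤ε , halves   = majorant-small 0≤M ε 0<ε
          halves′ : ∀ n → N ℕ.+ J ℕ.≤ n → majorant M (suc n) ℚ.+ majorant M (suc n) ℚ.≤ majorant M n
          halves′ n h = halves n (ℕ.≤-trans (ℕ.m≤n+m J N) h)
      in N ℕ.+ J , λ n k h h′ →
        let N≤k = ℕ.≤-trans (ℕ.m≤m+n N J) h′
        in ℚ.≤-trans
          (series-tail 0≤M (λ n → seq (part (expSum z n)) k) (λ n → seq (part (expTerm z n)) k)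
            (λ n → additive n k) (bound 0≤M k (proj₁ (z≤M k N≤k)) (proj₂ (z≤M k N≤k)))
            {N ℕ.+ J} halves′ n h)
          (ℚ.≤-trans (shrinks 0≤M J halves N) 2r≤ε)
    where
    shrinks : ∀ {M} → 0ℚ ℚ.≤ M → ∀ J →
      (∀ n → J ℕ.≤ n → majorant M (suc n) ℚ.+ majorant M (suc n) ℚ.≤ majorant M n) →
      ∀ i → majorant M (i ℕ.+ J) ℚ.+ majorant M (i ℕ.+ J) ℚ.≤ majorant M J ℚ.+ majorant M J
    shrinks 0≤M J halves zero = ℚ.≤-refl
    shrinks {M} 0≤M J halves (suc i) = ℚ.≤-trans (halves (i ℕ.+ J) (ℕ.m≤n+m J i))
      (ℚ.≤-trans (dup (majorant M (i ℕ.+ J)) (majorant-nonNeg 0≤M (i ℕ.+ J))) (shrinks 0≤M J halves i))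
      where
      dup : ∀ r → 0ℚ ℚ.≤ r → r ℚ.≤ r ℚ.+ r
      dup r 0≤r = subst (ℚ._≤ r ℚ.+ r) (ℚ.+-identityʳ r) (ℚ.+-monoʳ-≤ r 0≤r)

  re-converges : IsCauchy (λ n → seq (re (expSum z n)) n)
  re-converges = converges re (λ _ _ → refl) λ 0≤M k h h′ n → proj₁ (term-bound 0≤M k h h′ n)

  im-converges : IsCauchy (λ n → seq (im (expSum z n)) n)
  im-converges = converges im (λ _ _ → refl) λ 0≤M k h h′ n → proj₂ (term-bound 0≤M k h h′ n)

-- The limit of the partial sums of the exponential series, taken along the
-- diagonal of their approximating sequences.
exp : ℂ → ℂ
exp z = real (λ n → seq (re (expSum z n)) n) (ExpConvergence.re-converges z)
     +i real (λ n → seq (im (expSum z n)) n) (ExpConvergence.im-converges z)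

module Equality where

  open Estimates hiding (fromℕ; 1/suc)

  ≈-refl : Reflexive _≈_
  ≈-refl {x} ε 0<ε = 0 , λ k _ → subst (ℚ._≤ ε) (sym (abs-self (seq x k))) (ℚ.<⇒≤ 0<ε)

  ≈-sym : Symmetric _≈_
  ≈-sym {x} {y} h ε 0<ε = let N , f = h ε 0<ε in
    N , λ k N≤k → subst (ℚ._≤ ε) (abs-sub (seq x k) (seq y k)) (f k N≤k)

  ≈-trans : Transitive _≈_
  ≈-trans {x} {y} {z} h g ε 0<ε =
    let M , p = h (½ ℚ.* ε) (half-pos 0<ε)
        N , q = g (½ ℚ.* ε) (half-pos 0<ε)
    in M ℕ.⊔ N , λ k l → ℚ.≤-trans (abs-tri (seq x k) (seq y k) (seq z k))
         (subst (ℚ.∣ seq x k ℚ.- seq y k ∣ ℚ.+ ℚ.∣ seq y k ℚ.- seq z k ∣ ℚ.≤_) (half+half ε)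
           (ℚ.+-mono-≤ (p k (ℕ.m⊔n≤o⇒m≤o M N l)) (q k (ℕ.m⊔n≤o⇒n≤o M N l))))

  ≈ᶜ-refl : Reflexive _≈ᶜ_
  ≈ᶜ-refl {z} = ≈-refl {re z} , ≈-refl {im z}

  ≈ᶜ-sym : Symmetric _≈ᶜ_
  ≈ᶜ-sym {z} {w} (p , q) = ≈-sym {re z} {re w} p , ≈-sym {im z} {im w} q

  ≈ᶜ-trans : Transitive _≈ᶜ_
  ≈ᶜ-trans {z} {w} {u} (p , q) (p′ , q′) =
    ≈-trans {re z} {re w} {re u} p p′ , ≈-trans {im z} {im w} {im u} q q′

ℂ-setoid : Setoid 0ℓ 0ℓ
ℂ-setoid = record
  { Carrier       = ℂ
  ; _≈_           = _≈ᶜ_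
  ; isEquivalence = record
    { refl  = λ {z} → Equality.≈ᶜ-refl {z}
    ; sym   = λ {z} {w} → Equality.≈ᶜ-sym {z} {w}
    ; trans = λ {z} {w} {u} → Equality.≈ᶜ-trans {z} {w} {u}
    }
  }

infix 4 _∈_ _⊆_

record Subset : Set₁ where
  field
    member   : Pred ℂ 0ℓ
    respects : member Respects _≈ᶜ_

open Subset public

_∈_ : ℂ → Subset → Set
z ∈ A = member A z

_⊆_ : Subset → Subset → Set
A ⊆ B = ∀ z → z ∈ A → z ∈ B

subsetoid : Subset → Setoid 0ℓ 0ℓ
subsetoid A = On.setoid ℂ-setoid (proj₁ {A = ℂ} {B = _∈ A})

ContainsNear : Subset → Subset → ℂ → ℝ → Set
ContainsNear A′ A x R = ∀ a → a ∈ A → dist a x ≤ R → a ∈ A′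

MovesLessThan : ∀ {A B : Subset} → ℝ → Bijection (subsetoid A) (subsetoid B) → Set
MovesLessThan {A} {B} ε ψ = ∀ (a : Σ ℂ (_∈ A)) → dist (proj₁ a) (proj₁ (Bijection.to ψ a)) < ε

CloseInBall : ℝ → ℝ → ℂ → Subset → Subset → Set₁
CloseInBall ε R x A B = ∃₂ λ (A′ B′ : Subset) →
  A′ ⊆ A × B′ ⊆ B × ContainsNear A′ A x R × ContainsNear B′ B x R ×
  (∃ λ (ψ : Bijection (subsetoid A′) (subsetoid B′)) → MovesLessThan {A′} {B′} ε ψ)

φ : ℝ → ℕ → ℂ
φ θ n = √ (fromℤ (ℤ.+ n)) ·ᶜ exp ((fromℤ (ℤ.+ 2) * π * θ * fromℤ (ℤ.+ n)) ·ᶜ iℂ)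

φ[ℕ] : ℝ → Subset
φ[ℕ] θ = record
  { member   = λ z → ∃ λ n → z ≈ᶜ φ θ n
  ; respects = λ { {z} {w} z≈w (n , z≈φn) →
      n , Equality.≈ᶜ-trans {w} {z} {φ θ n} (Equality.≈ᶜ-sym {z} {w} z≈w) z≈φn }
  }

affineSpan : ℂ → ℂ → ℂ → Subset
affineSpan α ω₁ ω₂ = record
  { member   = λ z → ∃₂ λ a b → z ≈ᶜ point a b
  ; respects = λ { {z} {w} z≈w (a , b , z≈p) →
      a , b , Equality.≈ᶜ-trans {w} {z} {point a b} (Equality.≈ᶜ-sym {z} {w} z≈w) z≈p }
  }
  where
  point : ℤ → ℤ → ℂ
  point a b = α +ᶜ (fromℤ a ·ᶜ ω₁ +ᶜ fromℤ b ·ᶜ ω₂)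

record AffineLattice : Set where
  field
    α ω₁ ω₂     : ℂ
    independent : ∀ (a b : ℝ) → a ·ᶜ ω₁ +ᶜ b ·ᶜ ω₂ ≈ᶜ 0ℂ → a ≈ 0ℝ × b ≈ 0ℝ

  points : Subset
  points = affineSpan α ω₁ ω₂

-- A is the image of B under some z ↦ l z + b with l ≠ 0.
Equivalent : Subset → Subset → Set
Equivalent A B = ∃₂ λ (l b : ℂ) → NonZero l ×
  (∀ w → w ∈ A ⇔ (∃ λ z → z ∈ B × w ≈ᶜ l *ᶜ z +ᶜ b))

1+yi≠0 : ∀ y → NonZero (1ℂ +ᶜ y ·ᶜ iℂ)
1+yi≠0 y = 1ℚ , ℚ.positive⁻¹ 1ℚ , 0 , λ k _ → bound (seq y k)
  where
  open +-*-Solver using (solve; _:+_; _:*_; _:=_; con)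
  bound : ∀ q → 0ℚ ℚ.+ 1ℚ ℚ.≤
    (1ℚ ℚ.+ q ℚ.* 0ℚ) ℚ.* (1ℚ ℚ.+ q ℚ.* 0ℚ) ℚ.+ (0ℚ ℚ.+ q ℚ.* 1ℚ) ℚ.* (0ℚ ℚ.+ q ℚ.* 1ℚ)
  bound q = subst (1ℚ ℚ.≤_)
    (solve 1 (λ q → con 1ℚ :+ q :* q := (con 1ℚ :+ q :* con 0ℚ) :* (con 1ℚ :+ q :* con 0ℚ)
      :+ (con 0ℚ :+ q :* con 1ℚ) :* (con 0ℚ :+ q :* con 1ℚ)) refl q)
    (subst (ℚ._≤ 1ℚ ℚ.+ q ℚ.* q) (ℚ.+-identityʳ 1ℚ) (ℚ.+-monoʳ-≤ 1ℚ (Estimates.sq-nonNeg q)))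

τ : ℝ → ℕ → ℂ
τ f n = divide ((4π * fromℤ (ℤ.+ n)) ·ᶜ iℂ) (1ℂ +ᶜ (4π * f * fromℤ (ℤ.+ n)) ·ᶜ iℂ)
  (1+yi≠0 (4π * f * fromℤ (ℤ.+ n)))
  where
  4π : ℝ
  4π = fromℤ (ℤ.+ 4) * π

ℤ+ℤ_ : ℂ → Subset
ℤ+ℤ t = affineSpan 0ℂ 1ℂ t

{-# OPTIONS --safe #-}
-- Write u = e^{2πiθn}, s = √n, r = √j, κ = j - n, and let m be an integer with
-- t = θκ + m of absolute value at most 11/20.  Then
--   φ(j) = u r e^{2πit},
-- and the affine lattice is the set of the points
--   u s (1 + κ/2n + 2πit)     (κ, m ∈ ℤ),
-- the linearisation of φ at n: it is spanned from φ(n) by ω₁ = u s (1/2n + 2πiθ)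
-- and ω₂ = 2πi u s, and ω₂/ω₁ = 4πin/(1 + 4πiθn).  A point of either set within ρ
-- of φ(n) has κ² ≤ 9ρ²n and nt² ≤ 50ρ²; for φ this uses
--   |φ(j) - φ(n)|² = (r - s)² + rs |e^{2πit} - 1|²   and   |e^{2πit} - 1|² ≥ t²/25.
-- For such pairs (κ, m) Taylor expansion bounds the distance of the two points
-- by a constant times ρ²/√n.  If n is large compared with ρ² then m is determined
-- by κ, so that pairing the two points is a bijection.
--
-- The π of the statement is a series, so it must be linked to the exponential.
-- With h = Δ/(1 + x²) and x = j Δ, the point (1 + ix)²/(1 + x²) of the unit circle
-- turns by 2h + O(Δ²) from x to x + Δ; from x = 0 to x = 1 it moves from 1 to i, so
-- cos vanishes at twice the limit of Σ h.  This sum is a Riemann sum of ∫ dx/(1 + x²),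
-- and expanding the integrand compares it with the partial sums of Leibniz' series.
module Submission where

open import Defs using (module Estimates; module CauchyProperties)
open import Algebra.Bundles using (AbelianGroup; CommutativeRing; RawRing)
import Algebra.Properties.Group as GroupProperties
import Algebra.Solver.Ring as RingSolver
open import Algebra.Solver.Ring.AlmostCommutativeRing using (fromCommutativeRing; _-Raw-AlmostCommutative⟶_)
import Algebra.Solver.Ring.NaturalCoefficients.Default as NaturalSolver
open import Data.Bool.Base using (T)
open import Data.Empty using (⊥-elim)
open import Data.Integer.Base using (ℤ)
import Data.Integer.Base as ℤ
import Data.Integer.DivMod as ℤ
import Data.Integer.Properties as ℤ
import Data.Integer.Solver as ℤ
open import Data.Maybe.Base using (Maybe; just; nothing; is-just)
open import Data.Nat.Base as ℕ using (ℕ; zero; suc)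
import Data.Nat.Properties as ℕ
open import Data.Product using (Σ; ∃; ∃₂; _×_; _,_; proj₁; proj₂)
open import Data.Rational.Base as ℚ using (ℚ; mkℚ; 0ℚ; 1ℚ; ½)
import Data.Rational.Base
import Data.Rational.Properties as ℚ
open import Data.Rational.Solver using (module +-*-Solver)
import Data.Rational.Unnormalised.Base as ℚᵘ
import Data.Rational.Unnormalised.Properties as ℚᵘ
open import Data.Sum using (_⊎_; inj₁; inj₂)
import Data.Vec.Base as Vec
open import Data.Vec.N-ary using (N-ary; _$ⁿ_; curryⁿ; curryⁿ-cong; Eq)
open import Function.Base using (_∘_)
open import Function.Bundles using (Bijection; mk⇔)
open import Level using (0ℓ)
open import Relation.Binary.PropositionalEquality as ≡ using (_≡_; cong; cong₂; subst)
open import Relation.Nullary using (yes; no)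
open import Relation.Nullary.Decidable using (True; toWitness)

open Estimates using (fromℕ; 1/suc)
open CauchyProperties using (leibniz)

-- The order of Cauchy reals is not decidable, and this shapes the proof. It never splits on the
-- sign of a real number or rounds one exactly: integers are found within 11/20 instead of 1/2, a
-- bound on an absolute value is a pair of inequalities, a positive divisor comes with an explicit
-- inverse, and most inequalities are polynomial identities that exhibit a difference as a sum of
-- products of nonnegative terms. Nor can it be decided whether a point lies within R of φ(n). The
-- two sets that are paired are therefore cut out by bounds on (κ, m) that hold near φ(n) and
-- suffice for the error estimate. All this takes place in an abstract ordered ring, which keeps
-- approximating sequences out of sight; the reals are supplied afterwards. Constants: nearness
-- gives κ² ≤ 9ρ²n and nt² ≤ 50ρ²; as (2π)² < 50, n(2πt)² ≤ 2500ρ²; and n times the squared error is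
-- at most 2(9ρ² + 3·2500ρ²)² = 2(7509ρ²)². None of them involves θ, so N does not depend on θ.

4/5 : ℚ
4/5 = ℤ.+ 4 ℚ./ 5

-- Inequalities in an abstract ordered ring over the rationals.

record OrderedRing : Set₁ where
  field
    commutativeRing : CommutativeRing 0ℓ 0ℓ
  open CommutativeRing commutativeRing public
  field
    ι              : ℚ → Carrier
    ι-+            : ∀ p q → ι (p ℚ.+ q) ≈ ι p + ι q
    ι-*            : ∀ p q → ι (p ℚ.* q) ≈ ι p * ι q
    ι-neg          : ∀ p → ι (ℚ.- p) ≈ - ι p
    ι-0            : ι 0ℚ ≈ 0#
    ι-1            : ι 1ℚ ≈ 1#
    NonNeg         : Carrier → Set
    nonNeg-resp    : ∀ {x y} → x ≈ y → NonNeg x → NonNeg y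
    nonNeg-+       : ∀ {x y} → NonNeg x → NonNeg y → NonNeg (x + y)
    nonNeg-*       : ∀ {x y} → NonNeg x → NonNeg y → NonNeg (x * y)
    nonNeg-square  : ∀ x → NonNeg (x * x)
    nonNeg-ι       : ∀ q → 0ℚ ℚ.≤ q → NonNeg (ι q)
    nonNeg-closed  : ∀ x → (∀ q → 0ℚ ℚ.< q → NonNeg (x + ι q)) → NonNeg x
    nonNeg-antisym : ∀ x → NonNeg x → NonNeg (- x) → x ≈ 0#

module OrderedRingProperties (O : OrderedRing) where

  open OrderedRing O public

  ℚ-rawRing : RawRing 0ℓ 0ℓ
  ℚ-rawRing = CommutativeRing.rawRing ℚ.+-*-commutativeRing

  -- Gives the ring solver rational coefficients, so that weights such as ½ or 4/5 in a
  -- nonnegativity certificate are normalised with the rest.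
  ι-homomorphism : ℚ-rawRing -Raw-AlmostCommutative⟶ fromCommutativeRing commutativeRing
  ι-homomorphism = record
    { ⟦_⟧ = ι ; +-homo = ι-+ ; *-homo = ι-* ; -‿homo = ι-neg ; 0-homo = ι-0 ; 1-homo = ι-1 }

  ι-cong : ∀ {p q} → p ≡ q → ι p ≈ ι q
  ι-cong ≡.refl = refl

  ι-≟ : ∀ p q → Maybe (ι p ≈ ι q)
  ι-≟ p q with p ℚ.≟ q
  ... | yes e = just (ι-cong e)
  ... | no _  = nothing

  open RingSolver ℚ-rawRing (fromCommutativeRing commutativeRing) ι-homomorphism ι-≟ public
    using (Polynomial; var; ⟦_⟧; normalise; _≟N_; ⟦_⟧N-cong; prove; _:+_; _:*_; :-_; _:-_; _:=_; con)

  -- Comparing the normal forms syntactically keeps them out of the proof term.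
  private
    close : ∀ n → N-ary n (Polynomial n) (Polynomial n × Polynomial n) → Polynomial n × Polynomial n
    close n f = f $ⁿ Vec.map var (Vec.allFin n)

    equalNormalForms : ∀ {n} (p q : Polynomial n) → T (is-just (normalise p ≟N normalise q)) → ∀ ρ → ⟦ p ⟧ ρ ≈ ⟦ q ⟧ ρ
    equalNormalForms p q t ρ with normalise p ≟N normalise q
    ... | just e = prove ρ p q (⟦ e ⟧N-cong ρ)

  solve : ∀ n (f : N-ary n (Polynomial n) (Polynomial n × Polynomial n)) →
    {T (is-just (normalise (proj₁ (close n f)) ≟N normalise (proj₂ (close n f))))} →
    Eq n _≈_ (curryⁿ ⟦ proj₁ (close n f) ⟧) (curryⁿ ⟦ proj₂ (close n f) ⟧)
  solve n f {t} = curryⁿ-cong _≈_ ⟦ proj₁ (close n f) ⟧ ⟦ proj₂ (close n f) ⟧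
    (equalNormalForms (proj₁ (close n f)) (proj₂ (close n f)) t)

  infix 9 #_
  #_ : ∀ {n} → ℕ → Polynomial n
  # k = con (fromℕ k)

  infix 4 _≤_ ∣_∣≤_

  _≤_ : Carrier → Carrier → Set
  x ≤ y = NonNeg (y - x)

  ∣_∣≤_ : Carrier → Carrier → Set
  ∣ x ∣≤ c = NonNeg (c - x) × NonNeg (c + x)

  constant : ∀ q → {True (0ℚ ℚ.≤? q)} → NonNeg (ι q)
  constant q {t} = nonNeg-ι q (toWitness t)

  nonNeg-0 : NonNeg 0#
  nonNeg-0 = nonNeg-resp ι-0 (constant 0ℚ)

  ≈⇒nonNeg : ∀ {x} → x ≈ 0# → NonNeg x
  ≈⇒nonNeg e = nonNeg-resp (sym e) nonNeg-0

  -- Division by `c` is multiplication by `i`. The interface has no strict order; wherever a factor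
  -- has to be cancelled, such a nonnegative inverse stands for its positivity.
  nonNeg-cancel : ∀ {x} i c → i * c ≈ 1# → NonNeg i → NonNeg (c * x) → NonNeg x
  nonNeg-cancel {x} i c e 0≤i h = nonNeg-resp
    (trans (sym (*-assoc i c x)) (trans (*-congʳ e) (*-identityˡ x)))
    (nonNeg-* 0≤i h)

  nonNeg-scale : ∀ {x} q → {True (0ℚ ℚ.≤? q)} → NonNeg x → NonNeg (ι q * x)
  nonNeg-scale q {t} = nonNeg-* (constant q {t})

  ≤-refl : ∀ {x} → x ≤ x
  ≤-refl {x} = ≈⇒nonNeg (-‿inverseʳ x)

  ≤-trans : ∀ {x y z} → x ≤ y → y ≤ z → x ≤ z
  ≤-trans {x} {y} {z} p q = nonNeg-resp
    (solve 3 (λ x y z → (y :- x) :+ (z :- y) := z :- x) x y z) (nonNeg-+ p q)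

  ≤-resp : ∀ {x y u v} → x ≈ u → y ≈ v → x ≤ y → u ≤ v
  ≤-resp p q = nonNeg-resp (+-cong q (-‿cong p))

  ≤-antisym : ∀ {x y} → x ≤ y → y ≤ x → x ≈ y
  ≤-antisym {x} {y} p q = trans (solve 2 (λ x y → x := (x :- y) :+ y) x y)
    (trans (+-congʳ (nonNeg-antisym (x - y) q
      (nonNeg-resp (solve 2 (λ x y → y :- x := :- (x :- y)) x y) p))) (+-identityˡ y))

  ≤-+ : ∀ {x y u v} → x ≤ y → u ≤ v → x + u ≤ y + v
  ≤-+ {x} {y} {u} {v} p q = nonNeg-resp
    (solve 4 (λ x y u v → (y :- x) :+ (v :- u) := (y :+ v) :- (x :+ u)) x y u v) (nonNeg-+ p q)

  ≤-*ˡ : ∀ {x y} c → NonNeg c → x ≤ y → c * x ≤ c * y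
  ≤-*ˡ {x} {y} c 0≤c p = nonNeg-resp
    (solve 3 (λ c x y → c :* (y :- x) := c :* y :- c :* x) c x y) (nonNeg-* 0≤c p)

  ι-≤ : ∀ {p q} → p ℚ.≤ q → ι p ≤ ι q
  ι-≤ {p} {q} h = nonNeg-resp (trans (ι-+ q (ℚ.- p)) (+-congˡ (ι-neg p)))
    (nonNeg-ι (q ℚ.- p) (subst (ℚ._≤ q ℚ.- p) (ℚ.+-inverseʳ p) (ℚ.+-monoˡ-≤ (ℚ.- p) h)))

  nonNeg-≤ : ∀ {x y} → NonNeg x → x ≤ y → NonNeg y
  nonNeg-≤ {x} {y} p q = nonNeg-resp (solve 2 (λ x y → x :+ (y :- x) := y) x y) (nonNeg-+ p q)

  ∣∣≤-resp : ∀ {x y c d} → x ≈ y → c ≈ d → ∣ x ∣≤ c → ∣ y ∣≤ d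
  ∣∣≤-resp p q (u , v) = nonNeg-resp (+-cong q (-‿cong p)) u , nonNeg-resp (+-cong q p) v

  ∣∣≤-weaken : ∀ {x c d} → c ≤ d → ∣ x ∣≤ c → ∣ x ∣≤ d
  ∣∣≤-weaken {x} {c} {d} h (u , v) =
      nonNeg-resp (solve 3 (λ x c d → (d :- c) :+ (c :- x) := d :- x) x c d) (nonNeg-+ h u)
    , nonNeg-resp (solve 3 (λ x c d → (d :- c) :+ (c :+ x) := d :+ x) x c d) (nonNeg-+ h v)

  ∣∣≤-neg : ∀ {x c} → ∣ x ∣≤ c → ∣ - x ∣≤ c
  ∣∣≤-neg {x} {c} (u , v) = nonNeg-resp (solve 2 (λ x c → c :+ x := c :- (:- x)) x c) v , u

  ∣∣≤-+ : ∀ {x y c d} → ∣ x ∣≤ c → ∣ y ∣≤ d → ∣ x + y ∣≤ c + d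
  ∣∣≤-+ {x} {y} {c} {d} (p , q) (u , v) =
      nonNeg-resp (solve 4 (λ x y c d → (c :- x) :+ (d :- y) := (c :+ d) :- (x :+ y)) x y c d) (nonNeg-+ p u)
    , nonNeg-resp (solve 4 (λ x y c d → (c :+ x) :+ (d :+ y) := (c :+ d) :+ (x :+ y)) x y c d) (nonNeg-+ q v)

  -- No signs are needed: `2(cd - xy) = (c - x)(d + y) + (c + x)(d - y)`, and similarly for `cd +
  -- xy`.
  ∣∣≤-* : ∀ {x y c d} → ∣ x ∣≤ c → ∣ y ∣≤ d → ∣ x * y ∣≤ c * d
  ∣∣≤-* {x} {y} {c} {d} (p , q) (u , v) =
      nonNeg-resp (solve 4 (λ x y c d → con ½ :* ((c :- x) :* (d :+ y) :+ (c :+ x) :* (d :- y)) := c :* d :- x :* y) x y c d)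
        (nonNeg-scale ½ (nonNeg-+ (nonNeg-* p v) (nonNeg-* q u)))
    , nonNeg-resp (solve 4 (λ x y c d → con ½ :* ((c :- x) :* (d :- y) :+ (c :+ x) :* (d :+ y)) := c :* d :+ x :* y) x y c d)
        (nonNeg-scale ½ (nonNeg-+ (nonNeg-* p u) (nonNeg-* q v)))

  ∣∣≤-scale : ∀ {x c} a → NonNeg a → ∣ x ∣≤ c → ∣ a * x ∣≤ a * c
  ∣∣≤-scale {x} {c} a 0≤a (u , v) =
      nonNeg-resp (solve 3 (λ a x c → a :* (c :- x) := a :* c :- a :* x) a x c) (nonNeg-* 0≤a u)
    , nonNeg-resp (solve 3 (λ a x c → a :* (c :+ x) := a :* c :+ a :* x) a x c) (nonNeg-* 0≤a v)

  ∣∣≤-self : ∀ {x} → NonNeg x → ∣ x ∣≤ x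
  ∣∣≤-self {x} h = ≤-refl , nonNeg-+ h h

  -- `2c(c - x) = (c - x)² + (c² - x²)` is nonnegative and `c` cancels; likewise for `c + x`.
  square≤⇒∣∣≤ : ∀ {x} c i → c * i ≈ 1# → NonNeg i → x * x ≤ c * c → ∣ x ∣≤ c
  square≤⇒∣∣≤ {x} c i e 0≤i h =
      nonNeg-cancel i c i*c 0≤i (nonNeg-resp
        (solve 2 (λ c x → con ½ :* ((c :- x) :* (c :- x) :+ (c :* c :- x :* x)) := c :* (c :- x)) c x)
        (nonNeg-scale ½ (nonNeg-+ (nonNeg-square (c - x)) h)))
    , nonNeg-cancel i c i*c 0≤i (nonNeg-resp
        (solve 2 (λ c x → con ½ :* ((c :+ x) :* (c :+ x) :+ (c :* c :- x :* x)) := c :* (c :+ x)) c x)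
        (nonNeg-scale ½ (nonNeg-+ (nonNeg-square (c + x)) h)))
    where
    i*c : i * c ≈ 1#
    i*c = trans (*-comm i c) e

  ∣∣≤⇒square≤ : ∀ {x c} → ∣ x ∣≤ c → x * x ≤ c * c
  ∣∣≤⇒square≤ {x} {c} (u , v) = nonNeg-resp
    (solve 2 (λ c x → (c :- x) :* (c :+ x) := c :* c :- x :* x) c x) (nonNeg-* u v)

  ι-inverse : ∀ q → (0<q : 0ℚ ℚ.< q) → ∃ λ p → 0ℚ ℚ.≤ p × ι q * ι p ≈ 1#
  ι-inverse q 0<q = let p , 0<p , e = Estimates.scale q 1ℚ 0<q (ℚ.positive⁻¹ 1ℚ) in
    p , ℚ.<⇒≤ 0<p , trans (sym (ι-* q p)) (trans (ι-cong e) ι-1)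

  small⇒≈0 : ∀ {x} → (∀ q → 0ℚ ℚ.< q → ∣ x ∣≤ ι q) → x ≈ 0#
  small⇒≈0 {x} h = nonNeg-antisym x
    (nonNeg-closed x λ q 0<q → nonNeg-resp (+-comm (ι q) x) (proj₂ (h q 0<q)))
    (nonNeg-closed (- x) λ q 0<q → nonNeg-resp (+-comm (ι q) (- x)) (proj₁ (h q 0<q)))

  -- `x² ≤ 0 ≤ q²` gives `|x| ≤ q` for every positive rational `q`, and such an `x` vanishes by the
  -- Archimedean property.
  square≤0⇒≈0 : ∀ {x} → x * x ≤ 0# → x ≈ 0#
  square≤0⇒≈0 {x} h = small⇒≈0 λ q 0<q → let p , 0≤p , e = ι-inverse q 0<q in
    square≤⇒∣∣≤ (ι q) (ι p) e (nonNeg-ι p 0≤p) (≤-trans h (nonNeg-resp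
      (trans (solve 1 (λ a → a := a :- con 0ℚ) (ι q * ι q)) (+-congˡ (-‿cong ι-0)))
      (nonNeg-square (ι q))))

  -- A record rather than an inequality: the type checker then compares two such
  -- statements point by point and does not unfold rational arithmetic.
  record Within (r x y x′ y′ : Carrier) : Set where
    constructor within
    field
      squared≤ : (x - x′) * (x - x′) + (y - y′) * (y - y′) ≤ r

  open Within public

  within-cong : ∀ {r x y x′ y′ u v u′ v′} → x ≈ u → y ≈ v → x′ ≈ u′ → y′ ≈ v′ → Within r x y x′ y′ → Within r u v u′ v′
  within-cong p q p′ q′ (within h) = within (≤-resp
    (+-cong (*-cong (+-cong p (-‿cong p′)) (+-cong p (-‿cong p′))) (*-cong (+-cong q (-‿cong q′)) (+-cong q (-‿cong q′)))) refl h)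

infixl 7 _/1
_/1 : ℕ → ℚ
n /1 = fromℕ n

-- Trigonometry from addition theorems and quadratic Taylor bounds.

-- Nothing here links `¼π` with `cos` and `sin`: it is only the sum of Leibniz' series, with the
-- usual bound for the tail. That its double is a zero of `cos` is proved in `cos½π`.
record Trigonometry (O : OrderedRing) : Set where
  open OrderedRingProperties O
  field
    cos sin      : Carrier → Carrier
    cos-cong     : ∀ {x y} → x ≈ y → cos x ≈ cos y
    sin-cong     : ∀ {x y} → x ≈ y → sin x ≈ sin y
    cos-+        : ∀ x y → cos (x + y) ≈ cos x * cos y - sin x * sin y
    sin-+        : ∀ x y → sin (x + y) ≈ cos x * sin y + sin x * cos y
    cos-neg      : ∀ x → cos (- x) ≈ cos x
    sin-neg      : ∀ x → sin (- x) ≈ - sin x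
    cos-taylor   : ∀ x → x * x ≤ ι 1ℚ → ∣ cos x - ι 1ℚ ∣≤ ι 4/5 * (x * x)
    sin-taylor   : ∀ x → x * x ≤ ι 1ℚ → ∣ sin x - x ∣≤ ι 4/5 * (x * x)
    ¼π           : Carrier
    leibniz-tail : ∀ K → ∣ ¼π - ι (leibniz 0 K) ∣≤ ι (1/suc (2 ℕ.* K))

module TrigonometryProperties (O : OrderedRing) (T : Trigonometry O) where

  open OrderedRingProperties O
  open Trigonometry T

  0≤1 : NonNeg (ι 1ℚ)
  0≤1 = constant 1ℚ

  1*1 : ι 1ℚ * ι 1ℚ ≈ ι 1ℚ
  1*1 = solve 0 (con 1ℚ :* con 1ℚ := con 1ℚ)

  ∣∣≤1 : ∀ {x} → x * x ≤ ι 1ℚ → ∣ x ∣≤ ι 1ℚ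
  ∣∣≤1 h = square≤⇒∣∣≤ (ι 1ℚ) (ι 1ℚ) (trans 1*1 ι-1) 0≤1 (≤-resp refl (sym 1*1) h)

  vanishing : ∀ {x c} → c ≈ ι 0ℚ → ∣ x ∣≤ c → x ≈ ι 0ℚ
  vanishing {x} {c} e (u , v) = ≤-antisym (≤-resp refl e u)
    (nonNeg-resp (trans (+-congʳ e) (solve 1 (λ x → con 0ℚ :+ x := x :- con 0ℚ) x)) v)

  0≈ι0 : 0# ≈ ι 0ℚ
  0≈ι0 = sym ι-0

  small-0 : ∀ {x} → x ≈ ι 0ℚ → x * x ≤ ι 1ℚ
  small-0 {x} e = ≤-resp (sym (trans (*-cong e e) (solve 0 (con 0ℚ :* con 0ℚ := con 0ℚ)))) refl (ι-≤ (ℚ.nonNegative⁻¹ 1ℚ))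

  taylor-0 : ∀ {x} → x ≈ ι 0ℚ → ι 4/5 * (x * x) ≈ ι 0ℚ
  taylor-0 e = trans (*-congˡ (*-cong e e)) (solve 0 (con 4/5 :* (con 0ℚ :* con 0ℚ) := con 0ℚ))

  -- At 0 the Taylor bound has radius 0 and forces the value.
  cos-0 : ∀ {x} → x ≈ ι 0ℚ → cos x ≈ ι 1ℚ
  cos-0 {x} e = trans (solve 2 (λ c x → c := (c :- con 1ℚ) :+ con 1ℚ) (cos x) x)
    (trans (+-congʳ (vanishing (taylor-0 e) (cos-taylor x (small-0 e)))) (solve 0 (con 0ℚ :+ con 1ℚ := con 1ℚ)))

  sin-0 : ∀ {x} → x ≈ ι 0ℚ → sin x ≈ ι 0ℚ
  sin-0 {x} e = trans (solve 2 (λ s x → s := (s :- x) :+ x) (sin x) x)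
    (trans (+-cong (vanishing (taylor-0 e) (sin-taylor x (small-0 e))) e) (solve 0 (con 0ℚ :+ con 0ℚ := con 0ℚ)))

  -- The addition theorem for `x + (- x)`, whose cosine is 1.
  cos²+sin² : ∀ x → cos x * cos x + sin x * sin x ≈ ι 1ℚ
  cos²+sin² x = trans (sym (trans (cos-+ x (- x))
      (trans (+-cong (*-congˡ (cos-neg x)) (-‿cong (*-congˡ (sin-neg x))))
        (solve 2 (λ c s → c :* c :- s :* (:- s) := c :* c :+ s :* s) (cos x) (sin x)))))
    (cos-0 (trans (-‿inverseʳ x) 0≈ι0))

  ∣cos∣≤1 : ∀ x → ∣ cos x ∣≤ ι 1ℚ
  ∣cos∣≤1 x = ∣∣≤1 (nonNeg-resp (trans (solve 2 (λ c s → s :* s := (c :* c :+ s :* s) :- c :* c) (cos x) (sin x))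
    (+-congʳ (cos²+sin² x))) (nonNeg-square (sin x)))

  ∣sin∣≤1 : ∀ x → ∣ sin x ∣≤ ι 1ℚ
  ∣sin∣≤1 x = ∣∣≤1 (nonNeg-resp (trans (solve 2 (λ c s → c :* c := (c :* c :+ s :* s) :- s :* s) (cos x) (sin x))
    (+-congʳ (cos²+sin² x))) (nonNeg-square (cos x)))

  cos-double : ∀ x → cos (x + x) ≈ ι (2 /1) * (cos x * cos x) - ι 1ℚ
  cos-double x = trans (cos-+ x x) (trans
    (solve 2 (λ c s → c :* c :- s :* s := # 2 :* (c :* c) :- (c :* c :+ s :* s)) (cos x) (sin x))
    (+-congˡ (-‿cong (cos²+sin² x))))

  sin-double : ∀ x → sin (x + x) ≈ ι (2 /1) * (cos x * sin x)
  sin-double x = trans (sin-+ x x)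
    (solve 2 (λ c s → c :* s :+ s :* c := # 2 :* (c :* s)) (cos x) (sin x))

  -- Powers, Riemann sums on [0, 1] and Leibniz' series.

  infixr 8 _^_
  _^_ : Carrier → ℕ → Carrier
  x ^ zero  = ι 1ℚ
  x ^ suc p = x * x ^ p

  1^ : ∀ {x} p → x ≈ ι 1ℚ → x ^ p ≈ ι 1ℚ
  1^ zero    e = refl
  1^ (suc p) e = trans (*-cong e (1^ p e)) 1*1

  ^-nonNeg : ∀ {x} p → NonNeg x → NonNeg (x ^ p)
  ^-nonNeg zero    h = 0≤1
  ^-nonNeg (suc p) h = nonNeg-* h (^-nonNeg p h)

  ι-suc : ∀ n → ι (fromℕ (suc n)) ≈ ι (fromℕ n) + ι 1ℚ
  ι-suc n = trans (ι-cong (Estimates.fromℕ-suc n)) (ι-+ (fromℕ n) 1ℚ)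

  0≤n : ∀ n → NonNeg (ι (fromℕ n))
  0≤n n = nonNeg-ι (fromℕ n) (Estimates.fromℕ-nonNeg n)

  n/n : ∀ n → ι (1/suc n) * ι (fromℕ (suc n)) ≈ ι 1ℚ
  n/n n = trans (sym (ι-* (1/suc n) (fromℕ (suc n))))
    (ι-cong (≡.trans (ℚ.*-comm (1/suc n) (fromℕ (suc n))) (Estimates.1/suc-inverse n)))

  -- One half of the mean value inequality for x^(q+1), with the derivative at its minimum `a`;
  -- `^-difference-upper` takes it at `b`. Summed over a grid, the two compare Σ Δ x^q with the
  -- integral 1/(q+1).
  ^-difference-lower : ∀ {a b} q → NonNeg a → a ≤ b →
    ι (fromℕ (suc q)) * (a ^ q * (b - a)) ≤ b ^ suc q - a ^ suc q
  ^-difference-lower {a} {b} zero 0≤a a≤b = nonNeg-resp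
    (solve 2 (λ a b → con 0ℚ := (b :* con 1ℚ :- a :* con 1ℚ) :- # 1 :* (con 1ℚ :* (b :- a))) a b)
    (constant 0ℚ)
  ^-difference-lower {a} {b} (suc q) 0≤a a≤b = ≤-resp (*-congʳ (sym (ι-suc (suc q)))) refl (nonNeg-resp
    (solve 5 (λ a b A B N → b :* (b :* B :- a :* A :- N :* (A :* (b :- a))) :+ N :* (A :* ((b :- a) :* (b :- a)))
      := (b :* (b :* B) :- a :* (a :* A)) :- (N :+ con 1ℚ) :* ((a :* A) :* (b :- a))) a b (a ^ q) (b ^ q) (ι (fromℕ (suc q))))
    (nonNeg-+ (nonNeg-* (nonNeg-≤ 0≤a a≤b) (^-difference-lower q 0≤a a≤b))
      (nonNeg-* (0≤n (suc q)) (nonNeg-* (^-nonNeg q 0≤a) (nonNeg-square (b - a))))))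

  ^-mono : ∀ {a b} q → NonNeg a → a ≤ b → a ^ suc q ≤ b ^ suc q
  ^-mono {a} q 0≤a a≤b = nonNeg-≤ (nonNeg-* (0≤n (suc q)) (nonNeg-* (^-nonNeg q 0≤a) a≤b)) (^-difference-lower q 0≤a a≤b)

  ^-difference-upper : ∀ {a b} q → NonNeg a → a ≤ b →
    b ^ suc q - a ^ suc q ≤ ι (fromℕ (suc q)) * (b ^ q * (b - a))
  ^-difference-upper {a} {b} zero 0≤a a≤b = nonNeg-resp
    (solve 2 (λ a b → con 0ℚ := # 1 :* (con 1ℚ :* (b :- a)) :- (b :* con 1ℚ :- a :* con 1ℚ)) a b)
    (constant 0ℚ)
  ^-difference-upper {a} {b} (suc q) 0≤a a≤b = ≤-resp refl (*-congʳ (sym (ι-suc (suc q)))) (nonNeg-resp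
    (solve 5 (λ a b A B N → b :* (N :* (B :* (b :- a)) :- (b :* B :- a :* A)) :+ (b :- a) :* (b :* B :- a :* A)
      := (N :+ con 1ℚ) :* ((b :* B) :* (b :- a)) :- (b :* (b :* B) :- a :* (a :* A))) a b (a ^ q) (b ^ q) (ι (fromℕ (suc q))))
    (nonNeg-+ (nonNeg-* (nonNeg-≤ 0≤a a≤b) (^-difference-upper q 0≤a a≤b)) (nonNeg-* a≤b (^-mono q 0≤a a≤b))))

  sum : (ℕ → Carrier) → ℕ → Carrier
  sum f zero    = ι 0ℚ
  sum f (suc j) = sum f j + f j

  sum-nonNeg : ∀ {f} → (∀ j → NonNeg (f j)) → ∀ n → NonNeg (sum f n)
  sum-nonNeg h zero    = constant 0ℚ
  sum-nonNeg h (suc n) = nonNeg-+ (sum-nonNeg h n) (h n)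

  sum-+ : ∀ {f g h} → (∀ j → f j + g j ≈ h j) → ∀ n → sum f n + sum g n ≈ sum h n
  sum-+ e zero = solve 0 (con 0ℚ :+ con 0ℚ := con 0ℚ)
  sum-+ {f} {g} {h} e (suc n) = trans
    (solve 4 (λ a b c d → (a :+ b) :+ (c :+ d) := (a :+ c) :+ (b :+ d)) (sum f n) (f n) (sum g n) (g n))
    (+-cong (sum-+ e n) (e n))

  -- Riemann sums with suc n′ steps over [0 , 1].
  module Quadrature (n′ : ℕ) where

    n : ℕ
    n = suc n′

    Δ : Carrier
    Δ = ι (1/suc n′)

    0≤Δ : NonNeg Δ
    0≤Δ = nonNeg-ι (1/suc n′) (Estimates.1/suc-nonNeg n′)

    X : ℕ → Carrier
    X j = ι (fromℕ j) * Δ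

    0≤X : ∀ j → NonNeg (X j)
    0≤X j = nonNeg-* (0≤n j) 0≤Δ

    X-0 : X 0 ≈ ι 0ℚ
    X-0 = solve 1 (λ d → # 0 :* d := con 0ℚ) Δ

    X-n : X n ≈ ι 1ℚ
    X-n = trans (*-comm (ι (fromℕ n)) Δ) (n/n n′)

    X-suc : ∀ j → X (suc j) ≈ X j + Δ
    X-suc j = trans (*-congʳ (ι-suc j)) (solve 2 (λ m d → (m :+ con 1ℚ) :* d := m :* d :+ d) (ι (fromℕ j)) Δ)

    X-step : ∀ j → X (suc j) - X j ≈ Δ
    X-step j = trans (+-congʳ (X-suc j)) (solve 2 (λ x d → x :+ d :- x := d) (X j) Δ)

    X≤X : ∀ j → X j ≤ X (suc j)
    X≤X j = nonNeg-resp (sym (X-step j)) 0≤Δ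

    ι-mono : ∀ {i j} → i ℕ.≤ j → ι (fromℕ i) ≤ ι (fromℕ j)
    ι-mono {i} {j} i≤j = subst (λ j → ι (fromℕ i) ≤ ι (fromℕ j)) (ℕ.m∸n+n≡m i≤j) (go (j ℕ.∸ i))
      where
      go : ∀ d → ι (fromℕ i) ≤ ι (fromℕ (d ℕ.+ i))
      go zero    = ≤-refl
      go (suc d) = ≤-trans (go d) (≤-resp refl (sym (ι-suc (d ℕ.+ i)))
        (nonNeg-resp (solve 1 (λ x → con 1ℚ := x :+ con 1ℚ :- x) (ι (fromℕ (d ℕ.+ i)))) 0≤1))

    X≤1 : ∀ {j} → j ℕ.≤ n → X j ≤ ι 1ℚ
    X≤1 {j} h = ≤-resp (*-comm Δ (ι (fromℕ j))) (n/n n′) (≤-*ˡ Δ 0≤Δ (ι-mono h))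

    module _ (q : ℕ) where

      N : Carrier
      N = ι (fromℕ (suc q))

      power : ℕ → Carrier
      power j = Δ * X j ^ q

      power-upper : ∀ j → N * sum power j ≤ X j ^ suc q
      power-upper zero    = nonNeg-resp
        (solve 2 (λ N y → y := y :- N :* con 0ℚ) N (X 0 ^ suc q)) (^-nonNeg (suc q) (0≤X 0))
      power-upper (suc j) = nonNeg-resp
        (trans (+-congˡ (+-congˡ (-‿cong (*-congˡ (*-congˡ (X-step j))))))
          (solve 6 (λ N s p y z d → (y :- N :* s) :+ (z :- y :- N :* (p :* d))
              := z :- N :* (s :+ d :* p)) N (sum power j) (X j ^ q) (X j ^ suc q) (X (suc j) ^ suc q) Δ))
        (nonNeg-+ (power-upper j) (^-difference-lower q (0≤X j) (X≤X j)))

      -- The additional summand at `X j` turns the left sum into the right sum plus the nonnegative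
      -- term at 0, and the right sum of an increasing function dominates its integral.
      power-lower : ∀ j → X j ^ suc q ≤ N * (sum power j + Δ * X j ^ q)
      power-lower zero    = nonNeg-resp
        (trans (solve 3 (λ N d p → N :* (d :* p) := N :* (con 0ℚ :+ d :* p) :- con 0ℚ :* p) N Δ (X 0 ^ q))
          (+-congˡ (-‿cong (*-congʳ (sym X-0)))))
        (nonNeg-* (0≤n (suc q)) (nonNeg-* 0≤Δ (^-nonNeg q (0≤X 0))))
      power-lower (suc j) = nonNeg-resp
        (trans (+-congˡ (+-congʳ (*-congˡ (*-congˡ (X-step j)))))
          (solve 7 (λ N s p p′ y z d → (N :* (s :+ d :* p) :- y) :+ (N :* (p′ :* d) :- (z :- y))
              := N :* ((s :+ d :* p) :+ d :* p′) :- z) N (sum power j) (X j ^ q) (X (suc j) ^ q) (X j ^ suc q) (X (suc j) ^ suc q) Δ))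
        (nonNeg-+ (power-lower j) (^-difference-upper q (0≤X j) (X≤X j)))

      power-sum≤ : sum power n ≤ ι (1/suc q)
      power-sum≤ = nonNeg-resp
        (trans (+-congˡ (-‿cong (trans (sym (*-assoc (ι (1/suc q)) N (sum power n))) (*-congʳ (n/n q)))))
          (solve 2 (λ i s → i :* con 1ℚ :- con 1ℚ :* s := i :- s) (ι (1/suc q)) (sum power n)))
        (≤-*ˡ (ι (1/suc q)) (nonNeg-ι (1/suc q) (Estimates.1/suc-nonNeg q))
          (≤-resp refl (1^ (suc q) X-n) (power-upper n)))

      ≤power-sum : ι (1/suc q) ≤ sum power n + Δ
      ≤power-sum = nonNeg-resp
        (trans (+-congʳ (trans (sym (*-assoc (ι (1/suc q)) N (sum power n + Δ * ι 1ℚ))) (*-congʳ (n/n q))))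
          (solve 3 (λ i s d → con 1ℚ :* (s :+ d :* con 1ℚ) :- i :* con 1ℚ := (s :+ d) :- i) (ι (1/suc q)) (sum power n) Δ))
        (≤-*ˡ (ι (1/suc q)) (nonNeg-ι (1/suc q) (Estimates.1/suc-nonNeg q))
          (≤-resp (1^ (suc q) X-n) (*-congˡ (+-congˡ (*-congˡ (1^ q X-n)))) (power-lower n)))

      -- The error `Δ` is the same for all `q`, so that using m such sums costs only m Δ.
      power-sum : ∣ sum power n - ι (1/suc q) ∣≤ Δ
      power-sum =
          nonNeg-resp (solve 3 (λ i s d → d :+ (i :- s) := d :- (s :- i)) (ι (1/suc q)) (sum power n) Δ) (nonNeg-+ 0≤Δ power-sum≤)
        , nonNeg-resp (solve 3 (λ i s d → (s :+ d) :- i := d :+ (s :- i)) (ι (1/suc q)) (sum power n) Δ) ≤power-sum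

    0<1+x² : ∀ q → 0ℚ ℚ.< 1ℚ ℚ.+ q ℚ.* q
    0<1+x² q = ℚ.<-≤-trans (ℚ.positive⁻¹ 1ℚ)
      (subst (ℚ._≤ 1ℚ ℚ.+ q ℚ.* q) (ℚ.+-identityʳ 1ℚ) (ℚ.+-monoʳ-≤ 1ℚ (Estimates.sq-nonNeg q)))

    -- 1/(1 + x²) at x = `X j`, computed in ℚ because the grid points are rational and the ring has
    -- no division.
    A : ℕ → Carrier
    A j = ι (proj₁ (ι-inverse (1ℚ ℚ.+ (fromℕ j ℚ.* 1/suc n′) ℚ.* (fromℕ j ℚ.* 1/suc n′)) (0<1+x² (fromℕ j ℚ.* 1/suc n′))))

    0≤A : ∀ j → NonNeg (A j)
    0≤A j = nonNeg-ι _ (proj₁ (proj₂ (ι-inverse (1ℚ ℚ.+ (fromℕ j ℚ.* 1/suc n′) ℚ.* (fromℕ j ℚ.* 1/suc n′)) (0<1+x² (fromℕ j ℚ.* 1/suc n′)))))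

    A*[1+x²] : ∀ j → A j * (ι 1ℚ + X j * X j) ≈ ι 1ℚ
    A*[1+x²] j = trans (*-comm (A j) _) (trans (*-congʳ (sym (trans (ι-+ 1ℚ (x ℚ.* x))
        (+-congˡ (trans (ι-* x x) (*-cong (ι-* (fromℕ j) (1/suc n′)) (ι-* (fromℕ j) (1/suc n′))))))))
      (trans (proj₂ (proj₂ (ι-inverse (1ℚ ℚ.+ x ℚ.* x) (0<1+x² x)))) (sym ι-1)))
      where
      x : ℚ
      x = fromℕ j ℚ.* 1/suc n′

    -- The Riemann summand of x^(2p)/(1 + x²); for `p` = 0 it is the half-angle h of one rotation
    -- step.
    weighted : ℕ → ℕ → Carrier
    weighted p j = Δ * (X j ^ (2 ℕ.* p) * A j)

    H : ℕ → Carrier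
    H p = sum (weighted p) n

    0≤H : ∀ p → NonNeg (H p)
    0≤H p = sum-nonNeg (λ j → nonNeg-* 0≤Δ (nonNeg-* (^-nonNeg (2 ℕ.* p) (0≤X j)) (0≤A j))) n

    H+H : ∀ p → H p + H (suc p) ≈ sum (power (2 ℕ.* p)) n
    H+H p = sum-+ {weighted p} {weighted (suc p)} {power (2 ℕ.* p)} (λ j → trans
      (+-congˡ (*-congˡ (*-congʳ (reflexive (cong (X j ^_) (cong suc (ℕ.+-suc p (p ℕ.+ 0))))))))
      (trans (solve 4 (λ d P a x → d :* (P :* a) :+ d :* ((x :* (x :* P)) :* a)
          := d :* P :* (a :* (con 1ℚ :+ x :* x))) Δ (X j ^ (2 ℕ.* p)) (A j) (X j))
        (trans (*-congˡ (A*[1+x²] j)) (solve 2 (λ d P → d :* P :* con 1ℚ := d :* P) Δ (X j ^ (2 ℕ.* p)))))) n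

    H≤ : ∀ p → H p ≤ ι (1/suc (2 ℕ.* p))
    H≤ p = ≤-trans (nonNeg-resp
      (trans (solve 2 (λ h g → g := (h :+ g) :- h) (H p) (H (suc p))) (+-congʳ (H+H p))) (0≤H (suc p)))
      (power-sum≤ (2 ℕ.* p))

    -- By `H+H`, `H p` is 1/(2p+1) - `H (suc p)` up to `Δ`, which is the recursion of `leibniz`.
    -- After `m` steps the errors add up to m Δ, and the integral that is left over is at most
    -- 1/(2(m+p)+1).
    H-leibniz : ∀ p m → ∣ H p - ι (leibniz p m) ∣≤ ι (fromℕ m) * Δ + ι (1/suc (2 ℕ.* (m ℕ.+ p)))
    H-leibniz p zero =
        nonNeg-resp (solve 3 (λ h i d → i :- h := # 0 :* d :+ i :- (h :- con 0ℚ)) (H p) (ι (1/suc (2 ℕ.* p))) Δ) (H≤ p)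
      , nonNeg-resp (solve 3 (λ h i d → h :+ i := # 0 :* d :+ i :+ (h :- con 0ℚ)) (H p) (ι (1/suc (2 ℕ.* p))) Δ)
          (nonNeg-+ (0≤H p) (nonNeg-ι (1/suc (2 ℕ.* p)) (Estimates.1/suc-nonNeg (2 ℕ.* p))))
    H-leibniz p (suc m) = ∣∣≤-resp
      (trans (+-congʳ (+-congʳ (sym (H+H p))))
        (trans (solve 4 (λ h g i l → ((h :+ g) :- i) :+ (:- (g :- l)) := h :- (i :+ (:- l)))
            (H p) (H (suc p)) (ι (1/suc (2 ℕ.* p))) (ι (leibniz (suc p) m)))
          (+-congˡ (-‿cong (sym (trans (ι-+ (1/suc (2 ℕ.* p)) (ℚ.- leibniz (suc p) m)) (+-congˡ (ι-neg (leibniz (suc p) m)))))))))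
      (trans (solve 3 (λ d m i → d :+ (m :* d :+ i) := (m :+ con 1ℚ) :* d :+ i) Δ (ι (fromℕ m)) (ι (1/suc (2 ℕ.* (m ℕ.+ suc p)))))
        (+-cong (*-congʳ (sym (ι-suc m))) (reflexive (cong (λ k → ι (1/suc (2 ℕ.* k))) (ℕ.+-suc m p)))))
      (∣∣≤-+ (power-sum (2 ℕ.* p)) (∣∣≤-neg (H-leibniz (suc p) m)))

  -- The rational parametrisation of the circle and the zero of the cosine.

  16/5 124/5 : ℚ
  16/5  = ℤ.+ 16 ℚ./ 5
  124/5 = ℤ.+ 124 ℚ./ 5

  double : Carrier → Carrier
  double x = ι (2 /1) * x

  -- `c * q - s * p` is the cross product of (c, s) and (p, q). It is invariant when both vectors
  -- are rotated by (γ, σ).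
  turn : ∀ c s γ σ p q → γ * γ + σ * σ ≈ ι 1ℚ →
    c * q - s * p ≈ (c * γ - s * σ) * (γ * q + σ * p) - (c * σ + s * γ) * (γ * p - σ * q)
  turn c s γ σ p q e = trans
    (solve 4 (λ c s p q → c :* q :- s :* p := (c :* q :- s :* p) :* con 1ℚ) c s p q)
    (trans (*-congˡ (sym e))
      (solve 6 (λ c s γ σ p q → (c :* q :- s :* p) :* (γ :* γ :+ σ :* σ)
        := (c :* γ :- s :* σ) :* (γ :* q :+ σ :* p) :- (c :* σ :+ s :* γ) :* (γ :* p :- σ :* q)) c s γ σ p q))

  -- (c, s) is rotated exactly, (p, q) only to first order in the angle `h`. Once `turn` has rotated
  -- both exactly, each coordinate contributes an error `e` from the motion of (p, q) and `2k` from
  -- replacing (γ, σ) by (1, h).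
  turn-bound : ∀ {c s γ σ p q p′ q′ c′ s′ h k e} →
    γ * γ + σ * σ ≈ ι 1ℚ → c′ ≈ c * γ - s * σ → s′ ≈ c * σ + s * γ →
    ∣ c′ ∣≤ ι 1ℚ → ∣ s′ ∣≤ ι 1ℚ → ∣ p ∣≤ ι 1ℚ → ∣ q ∣≤ ι 1ℚ → ∣ γ - ι 1ℚ ∣≤ k → ∣ σ - h ∣≤ k →
    ∣ p′ - (p - h * q) ∣≤ e → ∣ q′ - (q + h * p) ∣≤ e →
    ∣ (c′ * q′ - s′ * p′) - (c * q - s * p) ∣≤ ι (2 /1) * (e + ι (2 /1) * k)
  turn-bound {c} {s} {γ} {σ} {p} {q} {p′} {q′} {c′} {s′} {h} {k} {e} unit c′≈ s′≈ ∣c′∣ ∣s′∣ ∣p∣ ∣q∣ ∣γ-1∣ ∣σ-h∣ ∣e₁∣ ∣e₂∣ = ∣∣≤-resp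
    (sym (trans (+-congˡ (-‿cong (trans (turn c s γ σ p q unit) (+-cong (*-congʳ (sym c′≈)) (-‿cong (*-congʳ (sym s′≈)))))))
      (solve 9 (λ c′ s′ γ σ p q p′ q′ h →
        (c′ :* q′ :- s′ :* p′) :- (c′ :* (γ :* q :+ σ :* p) :- s′ :* (γ :* p :- σ :* q))
        := c′ :* ((q′ :- (q :+ h :* p)) :- ((γ :- con 1ℚ) :* q :+ (σ :- h) :* p))
           :+ (:- (s′ :* ((p′ :- (p :- h :* q)) :- ((γ :- con 1ℚ) :* p :+ (:- ((σ :- h) :* q)))))))
        c′ s′ γ σ p q p′ q′ h)))
    (solve 2 (λ e k → con 1ℚ :* (e :+ (k :* con 1ℚ :+ k :* con 1ℚ)) :+ con 1ℚ :* (e :+ (k :* con 1ℚ :+ k :* con 1ℚ))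
      := # 2 :* (e :+ # 2 :* k)) e k)
    (∣∣≤-+
      (∣∣≤-* ∣c′∣ (∣∣≤-+ ∣e₂∣ (∣∣≤-neg (∣∣≤-+ (∣∣≤-* ∣γ-1∣ ∣q∣) (∣∣≤-* ∣σ-h∣ ∣p∣)))))
      (∣∣≤-neg (∣∣≤-* ∣s′∣ (∣∣≤-+ ∣e₁∣ (∣∣≤-neg (∣∣≤-+ (∣∣≤-* ∣γ-1∣ ∣p∣) (∣∣≤-neg (∣∣≤-* ∣σ-h∣ ∣q∣))))))))

  -- v = a(1 + ix)² = (1 + ix)/(1 - ix) is the point of the unit circle at
  -- angle 2 arctan x; moving x to y = x + d turns it by 2ad up to
  -- - 2 d² a² b (1 + ix)² (1 + iy).
  module Defect {x d a b : Carrier}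
    (a*[1+x²] : a * (ι 1ℚ + x * x) ≈ ι 1ℚ) (b*[1+y²] : b * (ι 1ℚ + (x + d) * (x + d)) ≈ ι 1ℚ) where

    u v y : Carrier
    y = x + d
    u = a * (ι 1ℚ + x * x)
    v = b * (ι 1ℚ + y * y)

    re-defect : b * (ι 1ℚ - y * y) - (a * (ι 1ℚ - x * x) - double (d * a) * double (x * a))
      ≈ - (ι (2 /1) * (d * d)) * ((a * a) * (b * (ι 1ℚ - x * x - ι (2 /1) * (x * y))))
    -- Both sides are made homogeneous: factors 1 are inserted and then replaced by `a * (1 + x²)`
    -- or `b * (1 + y²)`, after which the equation is a polynomial identity. The same is done for
    -- `im-defect`.
    re-defect = trans
      (solve 5 (λ x d a b y → b :* (con 1ℚ :- y :* y) :- (a :* (con 1ℚ :- x :* x) :- # 2 :* (d :* a) :* (# 2 :* (x :* a)))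
        := b :* (con 1ℚ :- y :* y) :* (con 1ℚ :* con 1ℚ)
           :- (a :* (con 1ℚ :- x :* x) :* (con 1ℚ :* con 1ℚ) :- # 2 :* (d :* a) :* (# 2 :* (x :* a)) :* con 1ℚ)) x d a b y)
      (trans (+-cong (*-congˡ (sym (*-cong a*[1+x²] a*[1+x²])))
          (-‿cong (+-cong (*-congˡ (sym (*-cong a*[1+x²] b*[1+y²]))) (-‿cong (*-congˡ (sym b*[1+y²]))))))
        (solve 4 (λ x d a b →
          b :* (con 1ℚ :- (x :+ d) :* (x :+ d)) :* ((a :* (con 1ℚ :+ x :* x)) :* (a :* (con 1ℚ :+ x :* x)))
            :- (a :* (con 1ℚ :- x :* x) :* ((a :* (con 1ℚ :+ x :* x)) :* (b :* (con 1ℚ :+ (x :+ d) :* (x :+ d))))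
              :- # 2 :* (d :* a) :* (# 2 :* (x :* a)) :* (b :* (con 1ℚ :+ (x :+ d) :* (x :+ d))))
          := (:- (# 2 :* (d :* d))) :* ((a :* a) :* (b :* (con 1ℚ :- x :* x :- # 2 :* (x :* (x :+ d)))))) x d a b))

    im-defect : double (y * b) - (double (x * a) + double (d * a) * (a * (ι 1ℚ - x * x)))
      ≈ - (ι (2 /1) * (d * d)) * ((a * a) * (b * (ι (2 /1) * x + y * (ι 1ℚ - x * x))))
    im-defect = trans
      (solve 5 (λ x d a b y → # 2 :* (y :* b) :- (# 2 :* (x :* a) :+ # 2 :* (d :* a) :* (a :* (con 1ℚ :- x :* x)))
        := # 2 :* (y :* b) :* (con 1ℚ :* con 1ℚ)
           :- (# 2 :* (x :* a) :* (con 1ℚ :* con 1ℚ) :+ # 2 :* (d :* a) :* (a :* (con 1ℚ :- x :* x)) :* con 1ℚ)) x d a b y)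
      (trans (+-cong (*-congˡ (sym (*-cong a*[1+x²] a*[1+x²])))
          (-‿cong (+-cong (*-congˡ (sym (*-cong a*[1+x²] b*[1+y²]))) (*-congˡ (sym b*[1+y²])))))
        (solve 4 (λ x d a b →
          # 2 :* ((x :+ d) :* b) :* ((a :* (con 1ℚ :+ x :* x)) :* (a :* (con 1ℚ :+ x :* x)))
            :- (# 2 :* (x :* a) :* ((a :* (con 1ℚ :+ x :* x)) :* (b :* (con 1ℚ :+ (x :+ d) :* (x :+ d))))
              :+ # 2 :* (d :* a) :* (a :* (con 1ℚ :- x :* x)) :* (b :* (con 1ℚ :+ (x :+ d) :* (x :+ d))))
          := (:- (# 2 :* (d :* d))) :* ((a :* a) :* (b :* (# 2 :* x :+ (x :+ d) :* (con 1ℚ :- x :* x))))) x d a b))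

  module Arctangent (n′ : ℕ) (Δ≤½ : ι (1/suc n′) ≤ ι ½) where

    open Quadrature n′

    -- P + iQ is the point (1 + ix)²/(1 + x²) at x = `X j`. `W` is its cross product with the unit
    -- vector at angle `double (turned j)`, that is, the sine of the angle by which the sum of the
    -- steps misses the point.
    P Q turned W : ℕ → Carrier
    P j = A j * (ι 1ℚ - X j * X j)
    Q j = double (X j * A j)
    turned j = sum (weighted 0) j
    W j = cos (double (turned j)) * Q j - sin (double (turned j)) * P j

    ∣A∣≤1 : ∀ j → ∣ A j ∣≤ ι 1ℚ
    ∣A∣≤1 j = nonNeg-resp (trans (solve 2 (λ a x → a :* (x :* x) := a :* (con 1ℚ :+ x :* x) :- a) (A j) (X j)) (+-congʳ (A*[1+x²] j)))
        (nonNeg-* (0≤A j) (nonNeg-square (X j)))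
      , nonNeg-+ 0≤1 (0≤A j)

    ∣X∣≤1 : ∀ {j} → j ℕ.≤ n → ∣ X j ∣≤ ι 1ℚ
    ∣X∣≤1 {j} h = X≤1 h , nonNeg-+ 0≤1 (0≤X j)

    ∣P∣≤1 : ∀ j → ∣ P j ∣≤ ι 1ℚ
    ∣P∣≤1 j =
        nonNeg-resp (trans (solve 2 (λ a x → # 2 :* (a :* (x :* x)) := a :* (con 1ℚ :+ x :* x) :- a :* (con 1ℚ :- x :* x)) (A j) (X j))
          (+-congʳ (A*[1+x²] j))) (nonNeg-scale (2 /1) (nonNeg-* (0≤A j) (nonNeg-square (X j))))
      , nonNeg-resp (trans (solve 2 (λ a x → # 2 :* a := a :* (con 1ℚ :+ x :* x) :+ a :* (con 1ℚ :- x :* x)) (A j) (X j))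
          (+-congʳ (A*[1+x²] j))) (nonNeg-scale (2 /1) (0≤A j))

    ∣Q∣≤1 : ∀ j → ∣ Q j ∣≤ ι 1ℚ
    ∣Q∣≤1 j =
        nonNeg-resp (trans (solve 2 (λ a x → a :* ((con 1ℚ :- x) :* (con 1ℚ :- x)) := a :* (con 1ℚ :+ x :* x) :- # 2 :* (x :* a)) (A j) (X j))
          (+-congʳ (A*[1+x²] j))) (nonNeg-* (0≤A j) (nonNeg-square (ι 1ℚ - X j)))
      , nonNeg-+ 0≤1 (nonNeg-scale (2 /1) (nonNeg-* (0≤X j) (0≤A j)))

    weighted-0 : ∀ j → weighted 0 j ≈ Δ * A j
    weighted-0 j = solve 2 (λ d a → d :* (con 1ℚ :* a) := d :* a) Δ (A j)

    -- In each coordinate the exact defect is 2Δ²a²b times a polynomial in x and y bounded by 3 on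
    -- [0, 1], and a, b ≤ 1.
    step-defect : ∀ j → suc j ℕ.≤ n →
      ∣ P (suc j) - (P j - double (Δ * A j) * Q j) ∣≤ ι (6 /1) * (Δ * Δ) ×
      ∣ Q (suc j) - (Q j + double (Δ * A j) * P j) ∣≤ ι (6 /1) * (Δ * Δ)
    step-defect j h =
        ∣∣≤-resp (sym (trans (+-congʳ P-suc) re-defect)) (solve 1 (λ d → # 2 :* (d :* d) :* (con 1ℚ :* (con 1ℚ :* # 3))
            := # 6 :* (d :* d)) Δ)
          (∣∣≤-* ∣2d²∣ (∣∣≤-* (∣∣≤-resp refl 1*1 (∣∣≤-* (∣A∣≤1 j) (∣A∣≤1 j))) (∣∣≤-* (∣A∣≤1 (suc j)) re-bound)))
      , ∣∣≤-resp (sym (trans (+-congʳ Q-suc) im-defect)) (solve 1 (λ d → # 2 :* (d :* d) :* (con 1ℚ :* (con 1ℚ :* # 3))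
          := # 6 :* (d :* d)) Δ)
          (∣∣≤-* ∣2d²∣ (∣∣≤-* (∣∣≤-resp refl 1*1 (∣∣≤-* (∣A∣≤1 j) (∣A∣≤1 j))) (∣∣≤-* (∣A∣≤1 (suc j)) im-bound)))
      where
      open Defect {X j} {Δ} {A j} {A (suc j)} (A*[1+x²] j)
        (trans (*-congˡ (+-congˡ (sym (*-cong (X-suc j) (X-suc j))))) (A*[1+x²] (suc j)))
      P-suc : P (suc j) ≈ A (suc j) * (ι 1ℚ - y * y)
      P-suc = *-congˡ (+-congˡ (-‿cong (*-cong (X-suc j) (X-suc j))))
      Q-suc : Q (suc j) ≈ double (y * A (suc j))
      Q-suc = *-congˡ (*-congʳ (X-suc j))
      ∣2d²∣ : ∣ - (ι (2 /1) * (Δ * Δ)) ∣≤ ι (2 /1) * (Δ * Δ)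
      ∣2d²∣ = ∣∣≤-neg (∣∣≤-self (nonNeg-scale (2 /1) (nonNeg-square Δ)))
      ∣x∣ : ∣ X j ∣≤ ι 1ℚ
      ∣x∣ = ∣X∣≤1 (ℕ.≤-trans (ℕ.n≤1+n j) h)
      ∣y∣ : ∣ y ∣≤ ι 1ℚ
      ∣y∣ = ∣∣≤-resp (X-suc j) refl (∣X∣≤1 h)
      ∣1-x²∣ : ∣ ι 1ℚ - X j * X j ∣≤ ι 1ℚ
      ∣1-x²∣ =
          nonNeg-resp (solve 1 (λ x → x :* x := con 1ℚ :- (con 1ℚ :- x :* x)) (X j)) (nonNeg-square (X j))
        , nonNeg-resp (solve 1 (λ x → con 1ℚ :+ (con 1ℚ :* con 1ℚ :- x :* x) := con 1ℚ :+ (con 1ℚ :- x :* x)) (X j))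
            (nonNeg-+ 0≤1 (∣∣≤⇒square≤ ∣x∣))
      re-bound : ∣ ι 1ℚ - X j * X j - ι (2 /1) * (X j * y) ∣≤ ι (3 /1)
      re-bound = ∣∣≤-resp refl (solve 0 (con 1ℚ :+ # 2 :* (con 1ℚ :* con 1ℚ) := # 3))
        (∣∣≤-+ ∣1-x²∣ (∣∣≤-neg (∣∣≤-scale (ι (2 /1)) (constant (2 /1)) (∣∣≤-* ∣x∣ ∣y∣))))
      im-bound : ∣ ι (2 /1) * X j + y * (ι 1ℚ - X j * X j) ∣≤ ι (3 /1)
      im-bound = ∣∣≤-resp refl (solve 0 (# 2 :* con 1ℚ :+ con 1ℚ :* con 1ℚ := # 3))
        (∣∣≤-+ (∣∣≤-scale (ι (2 /1)) (constant (2 /1)) ∣x∣) (∣∣≤-* ∣y∣ ∣1-x²∣))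

    taylor-bound : ∀ j → ι 4/5 * (double (weighted 0 j) * double (weighted 0 j)) ≤ ι 16/5 * (Δ * Δ)
    taylor-bound j = nonNeg-resp
      (trans (solve 2 (λ d a → con 16/5 :* ((d :* d) :* (con 1ℚ :* con 1ℚ :- a :* a))
          := con 16/5 :* (d :* d) :- con 4/5 :* ((# 2 :* (d :* a)) :* (# 2 :* (d :* a)))) Δ (A j))
        (+-congˡ (-‿cong (*-congˡ (*-cong (*-congˡ (sym (weighted-0 j))) (*-congˡ (sym (weighted-0 j))))))))
      (nonNeg-scale 16/5 (nonNeg-* (nonNeg-square Δ) (∣∣≤⇒square≤ (∣A∣≤1 j))))

    double≤1 : ∀ j → double (weighted 0 j) * double (weighted 0 j) ≤ ι 1ℚ
    double≤1 j = ≤-resp (*-cong (*-congˡ (sym (weighted-0 j))) (*-congˡ (sym (weighted-0 j)))) 1*1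
      (∣∣≤⇒square≤ (∣∣≤-resp refl (solve 0 (# 2 :* (con ½ :* con 1ℚ) := con 1ℚ))
        (∣∣≤-scale (ι (2 /1)) (constant (2 /1)) (∣∣≤-* (∣∣≤-weaken Δ≤½ (∣∣≤-self 0≤Δ)) (∣A∣≤1 j)))))

    -- 124/5 = 2(6 + 2·16/5), with 6 from `step-defect` and 16/5 from the Taylor bounds at the angle
    -- 2ΔA.
    W-step : ∀ j → suc j ℕ.≤ n → ∣ W (suc j) - W j ∣≤ ι 124/5 * (Δ * Δ)
    W-step j h = ∣∣≤-resp refl
      (solve 1 (λ d → # 2 :* (# 6 :* (d :* d) :+ # 2 :* (con 16/5 :* (d :* d))) := con 124/5 :* (d :* d)) Δ)
      (turn-bound (cos²+sin² (double w))
        (trans (cos-cong split) (cos-+ (double (turned j)) (double w)))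
        (trans (sin-cong split) (sin-+ (double (turned j)) (double w)))
        (∣cos∣≤1 (double (turned (suc j)))) (∣sin∣≤1 (double (turned (suc j)))) (∣P∣≤1 j) (∣Q∣≤1 j)
        (∣∣≤-weaken (taylor-bound j) (cos-taylor (double w) (double≤1 j)))
        (∣∣≤-resp (+-congˡ (-‿cong (*-congˡ (weighted-0 j)))) refl
          (∣∣≤-weaken (taylor-bound j) (sin-taylor (double w) (double≤1 j))))
        (proj₁ (step-defect j h)) (proj₂ (step-defect j h)))
      where
      w : Carrier
      w = weighted 0 j
      split : double (turned (suc j)) ≈ double (turned j) + double w
      split = distribˡ (ι (2 /1)) (turned j) w

    ∣W∣≤ : ∀ j → j ℕ.≤ n → ∣ W j ∣≤ ι (fromℕ j) * (ι 124/5 * (Δ * Δ))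
    ∣W∣≤ zero h = ∣∣≤-resp (sym W-0) (solve 1 (λ d → con 0ℚ := # 0 :* (con 124/5 :* (d :* d))) Δ) (∣∣≤-self (constant 0ℚ))
      where
      W-0 : W 0 ≈ ι 0ℚ
      W-0 = trans (+-cong (*-congˡ (*-congˡ (*-congʳ X-0))) (-‿cong (*-congʳ (sin-0 (solve 0 (# 2 :* con 0ℚ := con 0ℚ))))))
        (solve 3 (λ c a p → c :* (# 2 :* (con 0ℚ :* a)) :- con 0ℚ :* p := con 0ℚ) (cos (double (turned 0))) (A 0) (P 0))
    ∣W∣≤ (suc j) h = ∣∣≤-resp
      (solve 2 (λ a b → a :+ (b :- a) := b) (W j) (W (suc j)))
      (trans (solve 2 (λ m k → m :* k :+ k := (m :+ con 1ℚ) :* k) (ι (fromℕ j)) (ι 124/5 * (Δ * Δ))) (*-congʳ (sym (ι-suc j))))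
      (∣∣≤-+ (∣W∣≤ j (ℕ.≤-trans (ℕ.n≤1+n j) h)) (W-step j h))

    -- At x = 1 the point is i, so `W n` is this cosine. Its n errors of size Δ² sum to one of size
    -- Δ because nΔ = 1.
    ∣cos2H∣≤ : ∣ cos (double (H 0)) ∣≤ ι 124/5 * Δ
    ∣cos2H∣≤ = ∣∣≤-resp W-n
      (trans (solve 2 (λ m d → m :* (con 124/5 :* (d :* d)) := con 124/5 :* d :* (d :* m)) (ι (fromℕ n)) Δ)
        (trans (*-congˡ (n/n n′)) (solve 1 (λ d → con 124/5 :* d :* con 1ℚ := con 124/5 :* d) Δ)))
      (∣W∣≤ n ℕ.≤-refl)
      where
      2a : ι (2 /1) * A n ≈ ι 1ℚ
      2a = trans (solve 1 (λ a → # 2 :* a := a :* (con 1ℚ :+ con 1ℚ :* con 1ℚ)) (A n))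
        (trans (*-congˡ (+-congˡ (sym (*-cong X-n X-n)))) (A*[1+x²] n))
      W-n : W n ≈ cos (double (H 0))
      W-n = trans (+-cong (*-congˡ (*-congˡ (*-congʳ X-n))) (-‿cong (*-congˡ (*-congˡ (+-congˡ (-‿cong (*-cong X-n X-n)))))))
        (trans (solve 3 (λ c s a → c :* (# 2 :* (con 1ℚ :* a)) :- s :* (a :* (con 1ℚ :- con 1ℚ :* con 1ℚ)) := c :* (# 2 :* a))
            (cos (double (H 0))) (sin (double (H 0))) (A n))
          (trans (*-congˡ 2a) (solve 1 (λ c → c :* con 1ℚ := c) (cos (double (H 0))))))

  -- With δ = π/4 - `H 0`, the addition theorem bounds the cosine by |cos 2H| + |sin 2δ|. The first
  -- is at most e because 124/5 < 25. Further |δ| ≤ 3e: the Leibniz tail, the Riemann error mΔ and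
  -- the leftover integral give e each. Hence |sin 2δ| ≤ 12e, the quadratic Taylor term being
  -- absorbed thanks to 6e ≤ 1.
  cos½π-small : ∀ m n′ e → 0ℚ ℚ.≤ e → e ℚ.≤ 1/suc 15 → 1/suc m ℚ.≤ e →
    (fromℕ m ℚ.+ 25 /1) ℚ.* 1/suc n′ ℚ.≤ e → ∣ cos (double ¼π) ∣≤ ι (13 /1 ℚ.* e)
  cos½π-small m n′ e 0≤e e≤1/16 1/m≤e [m+25]/n≤e = ∣∣≤-resp
    (sym (trans (cos-cong split) (cos-+ (double (H 0)) (double δ))))
    (trans (solve 1 (λ e → e :* con 1ℚ :+ con 1ℚ :* (# 12 :* e) := # 13 :* e) (ι e)) (sym (ι-* (13 /1) e)))
    (∣∣≤-+ (∣∣≤-* (∣∣≤-weaken 25Δ≤e (Arctangent.∣cos2H∣≤ n′ Δ≤½)) (∣cos∣≤1 (double δ)))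
      (∣∣≤-neg (∣∣≤-* (∣sin∣≤1 (double (H 0))) ∣sin∣)))
    where
    open Quadrature n′ using (H; Δ; 0≤Δ; H-leibniz)
    δ : Carrier
    δ = ¼π - H 0
    split : double ¼π ≈ double (H 0) + double δ
    split = solve 2 (λ p h → # 2 :* p := # 2 :* h :+ # 2 :* (p :- h)) ¼π (H 0)
    0≤ιe : NonNeg (ι e)
    0≤ιe = nonNeg-ι e 0≤e
    [m+25]Δ≤e : (ι (fromℕ m) + ι (25 /1)) * Δ ≤ ι e
    [m+25]Δ≤e = ≤-resp (trans (ι-* (fromℕ m ℚ.+ 25 /1) (1/suc n′)) (*-congʳ (ι-+ (fromℕ m) (25 /1)))) refl (ι-≤ [m+25]/n≤e)
    mΔ≤e : ι (fromℕ m) * Δ ≤ ι e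
    mΔ≤e = ≤-trans (nonNeg-resp (solve 2 (λ m d → # 25 :* d := (m :+ # 25) :* d :- m :* d) (ι (fromℕ m)) Δ)
      (nonNeg-scale (25 /1) 0≤Δ)) [m+25]Δ≤e
    25Δ≤e : ι 124/5 * Δ ≤ ι e
    25Δ≤e = ≤-trans (nonNeg-resp
      (solve 2 (λ m d → con (1/suc 4) :* d :+ m :* d := (m :+ # 25) :* d :- con 124/5 :* d) (ι (fromℕ m)) Δ)
      (nonNeg-+ (nonNeg-scale (1/suc 4) 0≤Δ) (nonNeg-* (0≤n m) 0≤Δ))) [m+25]Δ≤e
    ιe≤1/16 : ι e ≤ ι (1/suc 15)
    ιe≤1/16 = ι-≤ e≤1/16
    Δ≤½ : Δ ≤ ι ½
    Δ≤½ = ≤-trans (nonNeg-resp (solve 2 (λ m d → # 24 :* d :+ m :* d := (m :+ # 25) :* d :- d) (ι (fromℕ m)) Δ)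
      (nonNeg-+ (nonNeg-scale (24 /1) 0≤Δ) (nonNeg-* (0≤n m) 0≤Δ)))
      (≤-trans [m+25]Δ≤e (≤-trans ιe≤1/16 (ι-≤ (toWitness {a? = 1/suc 15 ℚ.≤? ½} _))))
    tail≤e : ι (1/suc (2 ℕ.* m)) ≤ ι e
    tail≤e = ι-≤ (ℚ.≤-trans (Estimates.1/suc-antitone (ℕ.m≤m+n m (m ℕ.+ 0))) 1/m≤e)
    ∣δ∣ : ∣ δ ∣≤ ι e + (ι e + ι e)
    ∣δ∣ = ∣∣≤-resp (solve 3 (λ p h l → (p :- l) :+ (:- (h :- l)) := p :- h) ¼π (H 0) (ι (leibniz 0 m))) refl
      (∣∣≤-+ (∣∣≤-weaken tail≤e (leibniz-tail m)) (∣∣≤-neg (∣∣≤-weaken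
        (≤-+ mΔ≤e (≤-resp (reflexive (cong (λ k → ι (1/suc (2 ℕ.* k))) (≡.sym (ℕ.+-identityʳ m)))) refl tail≤e))
        (H-leibniz 0 m))))
    ∣2δ∣ : ∣ double δ ∣≤ ι (6 /1) * ι e
    ∣2δ∣ = ∣∣≤-resp refl (solve 1 (λ e → # 2 :* (e :+ (e :+ e)) := # 6 :* e) (ι e))
      (∣∣≤-scale (ι (2 /1)) (constant (2 /1)) ∣δ∣)
    ∣2δ∣≤1 : ∣ double δ ∣≤ ι 1ℚ
    ∣2δ∣≤1 = ∣∣≤-weaken (≤-trans (≤-*ˡ (ι (6 /1)) (constant (6 /1)) ιe≤1/16)
      (nonNeg-resp (solve 0 (con (ℤ.+ 5 ℚ./ 8) := con 1ℚ :- # 6 :* con (1/suc 15))) (constant (ℤ.+ 5 ℚ./ 8)))) ∣2δ∣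
    ∣sin∣ : ∣ sin (double δ) ∣≤ ι (12 /1) * ι e
    ∣sin∣ = ∣∣≤-resp (solve 2 (λ s d → (s :- d) :+ d := s) (sin (double δ)) (double δ))
      (solve 1 (λ e → (# 6 :* e) :+ (# 6 :* e) := # 12 :* e) (ι e))
      (∣∣≤-+ (∣∣≤-weaken quadratic (sin-taylor (double δ) (≤-resp refl 1*1 (∣∣≤⇒square≤ ∣2δ∣≤1)))) ∣2δ∣)
      where
      quadratic : ι 4/5 * (double δ * double δ) ≤ ι (6 /1) * ι e
      quadratic = nonNeg-resp
        (solve 2 (λ d e → con 4/5 :* (con 1ℚ :* (# 6 :* e) :- d :* d) :+ con (ℤ.+ 6 ℚ./ 5) :* e
            := # 6 :* e :- con 4/5 :* (d :* d)) (double δ) (ι e))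
        (nonNeg-+ (nonNeg-scale 4/5 (proj₁ (∣∣≤-* ∣2δ∣≤1 ∣2δ∣))) (nonNeg-scale (ℤ.+ 6 ℚ./ 5) 0≤ιe))

  cos½π : cos (double ¼π) ≈ ι 0ℚ
  cos½π = trans (small⇒≈0 λ q 0<q →
    -- 16e = min(q, 1) ensures 13e ≤ q as well as e ≤ 1/16. The number of grid steps is chosen after
    -- m because the Riemann error grows like mΔ.
    let q₁        = q ℚ.⊓ 1ℚ
        e , 0<e , 16e = Estimates.scale (16 /1) q₁ (ℚ.positive⁻¹ (16 /1)) (⊓-pos q 0<q)
        m , m≤    = Estimates.archimedean e 0<e
        n′ , n′≤  = Estimates.archimedean′ (fromℕ m ℚ.+ 25 /1) e
                      (Estimates.+-nonNeg {fromℕ m} {25 /1} (Estimates.fromℕ-nonNeg m) (ℚ.nonNegative⁻¹ (25 /1))) 0<e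
    in ∣∣≤-weaken (ι-≤ (ℚ.≤-trans (≡.subst (13 /1 ℚ.* e ℚ.≤_) 16e
           (ℚ.*-monoʳ-≤-nonNeg e {{ℚ.nonNegative (ℚ.<⇒≤ 0<e)}} (toWitness {a? = 13 /1 ℚ.≤? 16 /1} _))) (ℚ.p⊓q≤p q 1ℚ)))
         (cos½π-small m n′ e (ℚ.<⇒≤ 0<e) (≤1/16 e (≡.subst (ℚ._≤ 1ℚ) (≡.sym 16e) (ℚ.p⊓q≤q q 1ℚ))) (ℚ.<⇒≤ m≤) (ℚ.<⇒≤ n′≤)))
    0≈ι0
    where
    ⊓-pos : ∀ q → 0ℚ ℚ.< q → 0ℚ ℚ.< q ℚ.⊓ 1ℚ
    ⊓-pos q 0<q with ℚ.⊓-sel q 1ℚ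
    ... | inj₁ e = subst (0ℚ ℚ.<_) (≡.sym e) 0<q
    ... | inj₂ e = subst (0ℚ ℚ.<_) (≡.sym e) (ℚ.positive⁻¹ 1ℚ)
    ≤1/16 : ∀ e → 16 /1 ℚ.* e ℚ.≤ 1ℚ → e ℚ.≤ 1/suc 15
    ≤1/16 e h = ≡.subst (ℚ._≤ 1/suc 15)
      (+-*-Solver.solve 1 (λ e → +-*-Solver.con (1/suc 15) +-*-Solver.:* (+-*-Solver.con (16 /1) +-*-Solver.:* e) +-*-Solver.:= e) ≡.refl e)
      (ℚ.*-monoˡ-≤-nonNeg (1/suc 15) h)

  -- An enclosure of π, and periodicity.

  2/3 13/15 : ℚ
  2/3   = ℤ.+ 2 ℚ./ 3
  13/15 = ℤ.+ 13 ℚ./ 15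

  -- After 1 - 1/3 the remainder `leibniz 2 K` lies between 0 and 1/5. This encloses π/4 between 2/3
  -- and 13/15.
  leibniz-expand : ∀ K → leibniz 0 (2 ℕ.+ K) ≡ 2/3 ℚ.+ leibniz 2 K
  leibniz-expand K = +-*-Solver.solve 1 (λ l → +-*-Solver.con 1ℚ +-*-Solver.:- (+-*-Solver.con (1/suc 2) +-*-Solver.:- l)
    +-*-Solver.:= +-*-Solver.con 2/3 +-*-Solver.:+ l) ≡.refl (leibniz 2 K)

  tail-small : ∀ q → 0ℚ ℚ.< q → ∃ λ K → NonNeg (ι q - ι (1/suc (2 ℕ.* (2 ℕ.+ K))))
  tail-small q 0<q = let K , h = Estimates.archimedean q 0<q in
    K , ι-≤ (ℚ.≤-trans (Estimates.1/suc-antitone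
      (ℕ.≤-trans (ℕ.m≤n+m K 2) (ℕ.m≤m+n (2 ℕ.+ K) ((2 ℕ.+ K) ℕ.+ 0)))) (ℚ.<⇒≤ h))

  2/3≤¼π : ι 2/3 ≤ ¼π
  2/3≤¼π = nonNeg-closed (¼π - ι 2/3) λ q 0<q →
    let K , h = tail-small q 0<q in nonNeg-resp
      (trans (+-congʳ (+-congʳ (+-congˡ (+-congˡ (-‿cong (trans (ι-cong (leibniz-expand K)) (ι-+ 2/3 (leibniz 2 K))))))))
        (solve 4 (λ p i l q → ((i :+ (p :- (con 2/3 :+ l))) :+ l) :+ (q :- i) := (p :- con 2/3) :+ q)
          ¼π (ι (1/suc (2 ℕ.* (2 ℕ.+ K)))) (ι (leibniz 2 K)) (ι q)))
      (nonNeg-+ (nonNeg-+ (proj₂ (leibniz-tail (2 ℕ.+ K))) (nonNeg-ι _ (proj₁ (CauchyProperties.leibniz-bounds 2 K)))) h)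

  ¼π≤13/15 : ¼π ≤ ι 13/15
  ¼π≤13/15 = nonNeg-closed (ι 13/15 - ¼π) λ q 0<q →
    let K , h = tail-small q 0<q in nonNeg-resp
      (trans (+-congʳ (+-congʳ (+-congˡ (-‿cong (+-congˡ (-‿cong (trans (ι-cong (leibniz-expand K)) (ι-+ 2/3 (leibniz 2 K)))))))))
        (solve 4 (λ p i l q → ((i :- (p :- (con 2/3 :+ l))) :+ (con (1/suc 4) :- l)) :+ (q :- i) := (con 13/15 :- p) :+ q)
          ¼π (ι (1/suc (2 ℕ.* (2 ℕ.+ K)))) (ι (leibniz 2 K)) (ι q)))
      (nonNeg-+ (nonNeg-+ (proj₁ (leibniz-tail (2 ℕ.+ K))) (ι-≤ (proj₂ (CauchyProperties.leibniz-bounds 2 K)))) h)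

  0≤¼π : NonNeg ¼π
  0≤¼π = nonNeg-≤ (constant 2/3) 2/3≤¼π

  -- Bracketed as `fromℤ 2 * π` unfolds over the reals, so that the angle of φ agrees with it
  -- definitionally.
  2π : Carrier
  2π = ι (2 /1) * (ι (4 /1) * ¼π)

  private
    ½π : Carrier
    ½π = double ¼π
    π : Carrier
    π = ½π + ½π
    2π≈ : 2π ≈ π + π
    2π≈ = solve 1 (λ p → # 2 :* (# 4 :* p) := (# 2 :* p :+ # 2 :* p) :+ (# 2 :* p :+ # 2 :* p)) ¼π
    cosπ : cos π ≈ - ι 1ℚ
    cosπ = trans (cos-double ½π) (trans (+-congʳ (*-congˡ (*-cong cos½π cos½π)))
      (solve 0 (# 2 :* (con 0ℚ :* con 0ℚ) :- con 1ℚ := :- con 1ℚ)))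
    sinπ : sin π ≈ ι 0ℚ
    sinπ = trans (sin-double ½π) (trans (*-congˡ (*-congʳ cos½π))
      (solve 1 (λ s → # 2 :* (con 0ℚ :* s) := con 0ℚ) (sin ½π)))

  cos2π : cos 2π ≈ ι 1ℚ
  cos2π = trans (cos-cong 2π≈) (trans (cos-double π) (trans (+-congʳ (*-congˡ (*-cong cosπ cosπ)))
    (solve 0 (# 2 :* ((:- con 1ℚ) :* (:- con 1ℚ)) :- con 1ℚ := con 1ℚ))))

  sin2π : sin 2π ≈ ι 0ℚ
  sin2π = trans (sin-cong 2π≈) (trans (sin-double π) (trans (*-congˡ (*-congˡ sinπ))
    (solve 1 (λ c → # 2 :* (c :* con 0ℚ) := con 0ℚ) (cos π))))

  cos-multiple : ∀ m → cos (ι (fromℕ m) * 2π) ≈ ι 1ℚ × sin (ι (fromℕ m) * 2π) ≈ ι 0ℚ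
  cos-multiple zero    = cos-0 0*2π , sin-0 0*2π
    where
    0*2π : ι (fromℕ 0) * 2π ≈ ι 0ℚ
    0*2π = solve 1 (λ p → # 0 :* p := con 0ℚ) 2π
  cos-multiple (suc m) = let c , s = cos-multiple m in
      trans (cos-cong e) (trans (cos-+ (ι (fromℕ m) * 2π) 2π) (trans (+-cong (*-cong c cos2π) (-‿cong (*-cong s sin2π)))
        (solve 0 (con 1ℚ :* con 1ℚ :- con 0ℚ :* con 0ℚ := con 1ℚ))))
    , trans (sin-cong e) (trans (sin-+ (ι (fromℕ m) * 2π) 2π) (trans (+-cong (*-cong c sin2π) (*-cong s cos2π))
        (solve 0 (con 1ℚ :* con 0ℚ :+ con 0ℚ :* con 1ℚ := con 0ℚ))))
    where
    e : ι (fromℕ (suc m)) * 2π ≈ ι (fromℕ m) * 2π + 2π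
    e = trans (*-congʳ (ι-suc m)) (solve 2 (λ m p → (m :+ con 1ℚ) :* p := m :* p :+ p) (ι (fromℕ m)) 2π)

  cos-integer : ∀ (m : ℤ) → cos (ι (m ℚ./ 1) * 2π) ≈ ι 1ℚ × sin (ι (m ℚ./ 1) * 2π) ≈ ι 0ℚ
  cos-integer (ℤ.+ m)      = cos-multiple m
  cos-integer (ℤ.-[1+ m ]) = let c , s = cos-multiple (suc m) in
      trans (cos-cong e) (trans (cos-neg _) c)
    , trans (sin-cong e) (trans (sin-neg _) (trans (-‿cong s) (solve 0 (:- con 0ℚ := con 0ℚ))))
    where
    e : ι (ℤ.-[1+ m ] ℚ./ 1) * 2π ≈ - (ι (fromℕ (suc m)) * 2π)
    e = trans (*-congʳ (ι-neg (fromℕ (suc m)))) (solve 2 (λ m p → (:- m) :* p := :- (m :* p)) (ι (fromℕ (suc m))) 2π)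

  cos-period : ∀ x m → cos (x + ι (m ℚ./ 1) * 2π) ≈ cos x
  cos-period x m = let c , s = cos-integer m in trans (cos-+ x (ι (m ℚ./ 1) * 2π))
    (trans (+-cong (*-congˡ c) (-‿cong (*-congˡ s))) (solve 2 (λ c s → c :* con 1ℚ :- s :* con 0ℚ := c) (cos x) (sin x)))

  sin-period : ∀ x m → sin (x + ι (m ℚ./ 1) * 2π) ≈ sin x
  sin-period x m = let c , s = cos-integer m in trans (sin-+ x (ι (m ℚ./ 1) * 2π))
    (trans (+-cong (*-congˡ s) (*-congˡ c)) (solve 2 (λ c s → c :* con 0ℚ :+ s :* con 1ℚ := s) (cos x) (sin x)))

  -- Lower bounds for chords of the unit circle.

  11/20 1/25 16/25 : ℚ
  11/20 = ℤ.+ 11 ℚ./ 20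
  1/25  = ℤ.+ 1 ℚ./ 25
  16/25 = ℤ.+ 16 ℚ./ 25

  -- 2 - 2 cos 4z = 16 cos²z sin²z.
  chord-quarter : ∀ z → z * z ≤ ι 1ℚ → ι 16/25 * (ι 1/25 * (z * z)) ≤ ι (2 /1) - ι (2 /1) * cos ((z + z) + (z + z))
  chord-quarter z z²≤1 = nonNeg-resp
    (trans (solve 3 (λ c d z →
        # 16 :* ((c :* c) :* (d :* d :- con 1/25 :* (z :* z))) :+ # 16 :* ((con 1/25 :* (z :* z)) :* (c :* c :- con 1/25))
        := # 4 :* ((# 2 :* (c :* d)) :* (# 2 :* (c :* d))) :- con 16/25 :* (con 1/25 :* (z :* z))) c d z)
      (+-congʳ (sym chord)))
    (nonNeg-+ (nonNeg-scale (16 /1) (nonNeg-* (nonNeg-square c) d²≥))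
      (nonNeg-scale (16 /1) (nonNeg-* (nonNeg-scale 1/25 (nonNeg-square z)) c²≥)))
    where
    c d : Carrier
    c = cos z
    d = sin z
    chord : ι (2 /1) - ι (2 /1) * cos ((z + z) + (z + z)) ≈ ι (4 /1) * ((ι (2 /1) * (c * d)) * (ι (2 /1) * (c * d)))
    chord = trans (+-congˡ (-‿cong (*-congˡ (trans (cos-double (z + z)) (+-congʳ (*-congˡ
        (trans (solve 2 (λ c s → c :* c := (c :* c :+ s :* s) :- s :* s) (cos (z + z)) (sin (z + z))) (+-congʳ (cos²+sin² (z + z))))))))))
      (trans (solve 1 (λ s → # 2 :- # 2 :* (# 2 :* (con 1ℚ :- s :* s) :- con 1ℚ) := # 4 :* (s :* s)) (sin (z + z)))
        (*-congˡ (*-cong (sin-double z) (sin-double z))))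
    c≥ : NonNeg (c - ι (1/suc 4))
    c≥ = nonNeg-resp (solve 2 (λ c z → (con 4/5 :* (z :* z) :+ (c :- con 1ℚ)) :+ con 4/5 :* (con 1ℚ :- z :* z) := c :- con (1/suc 4)) c z)
      (nonNeg-+ (proj₂ (cos-taylor z z²≤1)) (nonNeg-scale 4/5 z²≤1))
    c²≥ : ι 1/25 ≤ c * c
    c²≥ = nonNeg-resp (solve 1 (λ c → (c :- con (1/suc 4)) :* ((c :- con (1/suc 4)) :+ con (ℤ.+ 2 ℚ./ 5)) := c :* c :- con 1/25) c)
      (nonNeg-* c≥ (nonNeg-+ c≥ (constant (ℤ.+ 2 ℚ./ 5))))
    d²≥ : ι 1/25 * (z * z) ≤ d * d
    d²≥ = nonNeg-resp
      (solve 2 (λ d z →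
        con 4/5 :* ((z :+ con (ℤ.+ 5 ℚ./ 4) :* (d :- z)) :* (z :+ con (ℤ.+ 5 ℚ./ 4) :* (d :- z)))
          :+ (con (1/suc 3) :* ((con 4/5 :* (z :* z)) :* (con 4/5 :* (z :* z)) :- (d :- z) :* (d :- z))
            :+ con (ℤ.+ 4 ℚ./ 25) :* ((z :* z) :* (con 1ℚ :- z :* z)))
        := d :* d :- con 1/25 :* (z :* z)) d z)
      (nonNeg-+ (nonNeg-scale 4/5 (nonNeg-square _))
        (nonNeg-+ (nonNeg-scale (1/suc 3) (∣∣≤⇒square≤ (sin-taylor z z²≤1)))
          (nonNeg-scale (ℤ.+ 4 ℚ./ 25) (nonNeg-* (nonNeg-square z) z²≤1))))

  -- The angle 2πt is quartered to reach the range of the Taylor bounds: z = πt/2 satisfies |z| ≤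
  -- 2·(13/15)·(11/20) = 143/150. Conversely π/4 ≥ 2/3 gives z² ≥ 16t²/9, and
  -- 25·(16/25)·(1/25)·(16/9) = 256/225 exceeds 1.
  chord-lower : ∀ t → ∣ t ∣≤ ι 11/20 → t * t ≤ ι (25 /1) * (ι (2 /1) - ι (2 /1) * cos (2π * t))
  chord-lower t ∣t∣ = ≤-trans t²≤
    (≤-*ˡ (ι (25 /1)) (constant (25 /1)) (≤-resp refl (+-congˡ (-‿cong (*-congˡ (cos-cong 4z≈)))) (chord-quarter z z²≤1)))
    where
    z : Carrier
    z = ι (2 /1) * (¼π * t)
    4z≈ : (z + z) + (z + z) ≈ 2π * t
    4z≈ = solve 2 (λ p t → (# 2 :* (p :* t) :+ # 2 :* (p :* t)) :+ (# 2 :* (p :* t) :+ # 2 :* (p :* t))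
      := # 2 :* (# 4 :* p) :* t) ¼π t
    ∣¼π∣ : ∣ ¼π ∣≤ ι 13/15
    ∣¼π∣ = ¼π≤13/15 , nonNeg-+ (constant 13/15) 0≤¼π
    z²≤1 : z * z ≤ ι 1ℚ
    z²≤1 = ≤-resp refl 1*1 (∣∣≤⇒square≤ (∣∣≤-weaken
      (nonNeg-resp (solve 0 (con (ℤ.+ 7 ℚ./ 150) := con 1ℚ :- # 2 :* (con 13/15 :* con 11/20))) (constant (ℤ.+ 7 ℚ./ 150)))
      (∣∣≤-scale (ι (2 /1)) (constant (2 /1)) (∣∣≤-* ∣¼π∣ ∣t∣))))
    t²≤ : t * t ≤ ι (25 /1) * (ι 16/25 * (ι 1/25 * (z * z)))
    t²≤ = nonNeg-resp
      (solve 2 (λ p t → con (ℤ.+ 64 ℚ./ 25) :* ((t :* t) :* ((p :- con 2/3) :* ((p :- con 2/3) :+ con (ℤ.+ 4 ℚ./ 3)))) :+ con (ℤ.+ 31 ℚ./ 225) :* (t :* t)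
        := # 25 :* (con 16/25 :* (con 1/25 :* ((# 2 :* (p :* t)) :* (# 2 :* (p :* t))))) :- t :* t) ¼π t)
      (nonNeg-+ (nonNeg-scale (ℤ.+ 64 ℚ./ 25) (nonNeg-* (nonNeg-square t) (nonNeg-* 2/3≤¼π (nonNeg-+ 2/3≤¼π (constant (ℤ.+ 4 ℚ./ 3))))))
        (nonNeg-scale (ℤ.+ 31 ℚ./ 225) (nonNeg-square t)))

  -- Estimates near φ(n), with the rotation by u removed.

  module _ {s i : Carrier} (0≤s : NonNeg s) (0≤i : NonNeg i) (i*s : i * s ≈ ι 1ℚ) where

    cancel : ∀ {x} → NonNeg (s * x) → NonNeg x
    cancel = nonNeg-cancel i s (trans i*s ι-1) 0≤i

    cancel² : ∀ {x} → NonNeg ((s * s) * x) → NonNeg x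
    cancel² {x} h = cancel (cancel (nonNeg-resp (*-assoc s s x) h))

    square≤⇒∣∣≤s : ∀ {x} → x * x ≤ s * s → ∣ x ∣≤ s
    square≤⇒∣∣≤s = square≤⇒∣∣≤ s i (trans (*-comm s i) (trans i*s ι-1)) 0≤i

    -- Here s = √n, r = √j, y = 2πt, and (c, d) stands for (cos y, sin y). `A` and `Y` bound κ²/n
    -- and n y², both of which are bounded independently of n for points near φ(n).
    module Linearisation {r y c d A Y : Carrier} (0≤r : NonNeg r)
      (κ-bound : (r * r - s * s) * (r * r - s * s) ≤ A * (s * s))
      (y-bound : (s * s) * (y * y) ≤ Y)
      (A≤s² : A ≤ s * s)
      (cos-bound : ∣ c - ι 1ℚ ∣≤ ι 4/5 * (y * y))
      (sin-bound : ∣ d - y ∣≤ ι 4/5 * (y * y)) where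

      private
        8/5 : ℚ
        8/5 = ℤ.+ 8 ℚ./ 5
        bound : Carrier
        bound = A + ι (3 /1) * Y

      -- κ² = (s - r)²(s + r)², and (s + r)² ≥ s².
      [s-r]²≤A : (s - r) * (s - r) ≤ A
      [s-r]²≤A = cancel² (nonNeg-resp
        (solve 3 (λ s r A → (A :* (s :* s) :- (r :* r :- s :* s) :* (r :* r :- s :* s))
            :+ ((s :- r) :* (s :- r)) :* (r :* r :+ # 2 :* (s :* r))
          := (s :* s) :* (A :- (s :- r) :* (s :- r))) s r A)
        (nonNeg-+ κ-bound (nonNeg-* (nonNeg-square (s - r)) (nonNeg-+ (nonNeg-square r) (nonNeg-scale (2 /1) (nonNeg-* 0≤s 0≤r))))))

      r≤2s : NonNeg (s + (s - r))
      r≤2s = proj₂ (square≤⇒∣∣≤s (≤-trans [s-r]²≤A A≤s²))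

      0≤A : NonNeg A
      0≤A = nonNeg-≤ (nonNeg-square (s - r)) [s-r]²≤A

      0≤Y : NonNeg Y
      0≤Y = nonNeg-≤ (nonNeg-* (nonNeg-square s) (nonNeg-square y)) y-bound

      curvature : (s * r) * (ι 4/5 * (y * y)) ≤ ι 8/5 * Y
      curvature = nonNeg-resp
        (solve 4 (λ s r y Y → con 8/5 :* (Y :- (s :* s) :* (y :* y)) :+ con 4/5 :* ((s :* (y :* y)) :* (s :+ (s :- r)))
          := con 8/5 :* Y :- (s :* r) :* (con 4/5 :* (y :* y))) s r y Y)
        (nonNeg-+ (nonNeg-scale 8/5 y-bound) (nonNeg-scale 4/5 (nonNeg-* (nonNeg-* 0≤s (nonNeg-square y)) r≤2s)))

      re-bound : ∣ ι ½ * ((s - r) * (s - r)) + (s * r) * (- (c - ι 1ℚ)) ∣≤ bound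
      re-bound = ∣∣≤-weaken
        (nonNeg-resp (solve 2 (λ A Y → con ½ :* A :+ con (ℤ.+ 7 ℚ./ 5) :* Y := (A :+ # 3 :* Y) :- (con ½ :* A :+ con 8/5 :* Y)) A Y)
          (nonNeg-+ (nonNeg-scale ½ 0≤A) (nonNeg-scale (ℤ.+ 7 ℚ./ 5) 0≤Y)))
        (∣∣≤-+ (∣∣≤-scale (ι ½) (constant ½) (∣∣≤-weaken [s-r]²≤A (∣∣≤-self (nonNeg-square (s - r)))))
          (∣∣≤-weaken curvature (∣∣≤-scale (s * r) (nonNeg-* 0≤s 0≤r) (∣∣≤-neg cos-bound))))

      -- The mixed term of second order, split by 2|ab| ≤ a² + b² with a = s - r and b = sy.
      shear : ∣ s * ((s - r) * y) ∣≤ ι ½ * (A + Y)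
      shear = ∣∣≤-weaken
        (≤-*ˡ (ι ½) (constant ½) (≤-+ [s-r]²≤A y-bound))
        ( nonNeg-resp (solve 3 (λ s r y → con ½ :* (((s :- r) :- s :* y) :* ((s :- r) :- s :* y))
            := con ½ :* ((s :- r) :* (s :- r) :+ (s :* s) :* (y :* y)) :- s :* ((s :- r) :* y)) s r y) (nonNeg-scale ½ (nonNeg-square _))
        , nonNeg-resp (solve 3 (λ s r y → con ½ :* (((s :- r) :+ s :* y) :* ((s :- r) :+ s :* y))
            := con ½ :* ((s :- r) :* (s :- r) :+ (s :* s) :* (y :* y)) :+ s :* ((s :- r) :* y)) s r y) (nonNeg-scale ½ (nonNeg-square _)))

      im-bound : ∣ (s * r) * (- (d - y)) + s * ((s - r) * y) ∣≤ bound
      im-bound = ∣∣≤-weaken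
        (nonNeg-resp (solve 2 (λ A Y → con ½ :* A :+ con (ℤ.+ 9 ℚ./ 10) :* Y := (A :+ # 3 :* Y) :- (con 8/5 :* Y :+ con ½ :* (A :+ Y))) A Y)
          (nonNeg-+ (nonNeg-scale ½ 0≤A) (nonNeg-scale (ℤ.+ 9 ℚ./ 10) 0≤Y)))
        (∣∣≤-+ (∣∣≤-weaken curvature (∣∣≤-scale (s * r) (nonNeg-* 0≤s 0≤r) (∣∣≤-neg sin-bound))) shear)

      -- h is 1/(2s²).
      error-bound : ∀ h → (s * s) * h ≈ ι ½ →
        (s * s) * ((r * c - (s + s * ((r * r - s * s) * h))) * (r * c - (s + s * ((r * r - s * s) * h))) + (r * d - s * y) * (r * d - s * y))
          ≤ ι (2 /1) * (bound * bound)
      error-bound h s²h = nonNeg-resp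
        (trans (+-congˡ (+-cong (-‿cong (*-cong re≈ re≈)) (-‿cong (*-cong im≈ im≈))))
          (solve 4 (λ s e f B → # 2 :* (B :* B) :+ ((:- ((s :* e) :* (s :* e))) :+ (:- ((s :* f) :* (s :* f))))
            := # 2 :* (B :* B) :- (s :* s) :* (e :* e :+ f :* f)) s (r * c - (s + s * ((r * r - s * s) * h))) (r * d - s * y) bound))
        (nonNeg-resp (solve 3 (λ B e f → (B :* B :- e :* e) :+ (B :* B :- f :* f)
            := # 2 :* (B :* B) :+ ((:- (e :* e)) :+ (:- (f :* f)))) bound _ _)
          (nonNeg-+ (∣∣≤⇒square≤ (∣∣≤-neg re-bound)) (∣∣≤⇒square≤ (∣∣≤-neg im-bound))))
        where
        -- The first-order terms cancel because κ/2 = s(r - s) + (r - s)²/2. Multiplied by s, the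
        -- errors are of second order and bounded; dividing by s again yields the decay like 1/√n.
        re≈ : - (ι ½ * ((s - r) * (s - r)) + (s * r) * (- (c - ι 1ℚ))) ≈ s * (r * c - (s + s * ((r * r - s * s) * h)))
        re≈ = trans (solve 3 (λ s r c → :- (con ½ :* ((s :- r) :* (s :- r)) :+ (s :* r) :* (:- (c :- con 1ℚ)))
            := s :* (r :* c) :- s :* s :- (r :* r :- s :* s) :* con ½) s r c)
          (trans (+-congˡ (-‿cong (*-congˡ (sym s²h))))
            (solve 4 (λ s r c h → s :* (r :* c) :- s :* s :- (r :* r :- s :* s) :* ((s :* s) :* h)
              := s :* (r :* c :- (s :+ s :* ((r :* r :- s :* s) :* h)))) s r c h))
        im≈ : - ((s * r) * (- (d - y)) + s * ((s - r) * y)) ≈ s * (r * d - s * y)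
        im≈ = solve 4 (λ s r d y → :- ((s :* r) :* (:- (d :- y)) :+ s :* ((s :- r) :* y)) := s :* (r :* d :- s :* y)) s r d y

    -- Since ρ ≤ s/2, r lies between s/2 and 3s/2. Therefore |κ| = |r - s|(r + s) ≤ 3ρs, which gives
    -- the 9. For the squared chord X, s²X ≤ 2rsX ≤ 2ρ², and t² ≤ 25X gives the 50.
    module NearSpiral {r c d ρ j : Carrier} (0≤r : NonNeg r) (0≤ρ : NonNeg ρ) (ρ*j : ρ * j ≈ 1#) (0≤j : NonNeg j)
      (unit : c * c + d * d ≈ ι 1ℚ) (∣c∣≤1 : ∣ c ∣≤ ι 1ℚ)
      (4ρ²≤s² : ι (4 /1) * (ρ * ρ) ≤ s * s)
      (near : (r * c - s) * (r * c - s) + (r * d) * (r * d) ≤ ρ * ρ) where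

      private
        near′ : NonNeg (ρ * ρ - ((r - s) * (r - s) + (r * s) * (ι (2 /1) - ι (2 /1) * c)))
        near′ = nonNeg-resp
          (+-congˡ (-‿cong (trans
            (solve 4 (λ r c d s → (r :* c :- s) :* (r :* c :- s) :+ (r :* d) :* (r :* d)
              := (r :* r) :* (c :* c :+ d :* d) :+ s :* s :- # 2 :* (r :* s :* c)) r c d s)
            (trans (+-congʳ (+-congʳ (*-congˡ unit)))
              (solve 3 (λ r c s → (r :* r) :* con 1ℚ :+ s :* s :- # 2 :* (r :* s :* c)
                := (r :- s) :* (r :- s) :+ (r :* s) :* (# 2 :- # 2 :* c)) r c s)))))
          near
        0≤chord : NonNeg (ι (2 /1) - ι (2 /1) * c)
        0≤chord = nonNeg-resp (solve 1 (λ c → # 2 :* (con 1ℚ :- c) := # 2 :- # 2 :* c) c)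
          (nonNeg-scale (2 /1) (proj₁ ∣c∣≤1))
        ∣r-s∣ : ∣ r - s ∣≤ ρ
        ∣r-s∣ = square≤⇒∣∣≤ ρ j ρ*j 0≤j (nonNeg-resp
          (solve 3 (λ p a b → (p :- (a :+ b)) :+ b := p :- a) (ρ * ρ) ((r - s) * (r - s)) ((r * s) * (ι (2 /1) - ι (2 /1) * c)))
          (nonNeg-+ near′ (nonNeg-* (nonNeg-* 0≤r 0≤s) 0≤chord)))
        2ρ≤s : NonNeg (s - ι (2 /1) * ρ)
        2ρ≤s = proj₁ (square≤⇒∣∣≤s (≤-resp (solve 1 (λ p → # 4 :* (p :* p) := (# 2 :* p) :* (# 2 :* p)) ρ) refl 4ρ²≤s²))
        s≤2r : NonNeg (ι (2 /1) * r - s)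
        s≤2r = nonNeg-resp (solve 3 (λ r s p → # 2 :* (p :+ (r :- s)) :+ (s :- # 2 :* p) := # 2 :* r :- s) r s ρ)
          (nonNeg-+ (nonNeg-scale (2 /1) (proj₂ ∣r-s∣)) 2ρ≤s)
        ∣r+s∣ : ∣ r + s ∣≤ ι (3 /1) * s
        ∣r+s∣ =
            nonNeg-resp (solve 3 (λ r s p → (p :- (r :- s)) :+ con ½ :* ((s :- # 2 :* p) :+ s) := # 3 :* s :- (r :+ s)) r s ρ)
              (nonNeg-+ (proj₁ ∣r-s∣) (nonNeg-scale ½ (nonNeg-+ 2ρ≤s 0≤s)))
          , nonNeg-+ (nonNeg-scale (3 /1) 0≤s) (nonNeg-+ 0≤r 0≤s)

      κ-bound : (r * r - s * s) * (r * r - s * s) ≤ ι (9 /1) * (ρ * ρ) * (s * s)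
      κ-bound = ≤-resp
        (solve 2 (λ r s → ((r :- s) :* (r :+ s)) :* ((r :- s) :* (r :+ s)) := (r :* r :- s :* s) :* (r :* r :- s :* s)) r s)
        (solve 2 (λ p s → (p :* (# 3 :* s)) :* (p :* (# 3 :* s)) := # 9 :* (p :* p) :* (s :* s)) ρ s)
        (∣∣≤⇒square≤ (∣∣≤-* ∣r-s∣ ∣r+s∣))

      chord-bound : (s * s) * (ι (2 /1) - ι (2 /1) * c) ≤ ι (2 /1) * (ρ * ρ)
      chord-bound = nonNeg-resp
        (solve 4 (λ p r s x → # 2 :* ((p :* p :- ((r :- s) :* (r :- s) :+ (r :* s) :* x)) :+ (r :- s) :* (r :- s))
            :+ (s :* x) :* (# 2 :* r :- s)
          := # 2 :* (p :* p) :- (s :* s) :* x) ρ r s (ι (2 /1) - ι (2 /1) * c))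
        (nonNeg-+ (nonNeg-scale (2 /1) (nonNeg-+ near′ (nonNeg-square (r - s)))) (nonNeg-* (nonNeg-* 0≤s 0≤chord) s≤2r))

      t-bound : ∀ t → ∣ t ∣≤ ι 11/20 → c ≈ cos (2π * t) → (s * s) * (t * t) ≤ ι (50 /1) * (ρ * ρ)
      t-bound t ∣t∣ e = nonNeg-resp
        (solve 4 (λ s t p x → # 25 :* (# 2 :* (p :* p) :- (s :* s) :* x) :+ (s :* s) :* (# 25 :* x :- t :* t)
          := # 50 :* (p :* p) :- (s :* s) :* (t :* t)) s t ρ (ι (2 /1) - ι (2 /1) * c))
        (nonNeg-+ (nonNeg-scale (25 /1) chord-bound)
          (nonNeg-* (nonNeg-square s) (≤-resp refl (*-congˡ (+-congˡ (-‿cong (*-congˡ (sym e))))) (chord-lower t ∣t∣))))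

    -- Here the squared distance is exactly n((κ/2n)² + (2πt)²). Both bounds are weakened to the
    -- constants valid for the spiral, so that one condition serves both sets; the sharper
    -- `4κ-bound` is kept for the proof that j = n + κ is not negative.
    module NearLattice {κ h t ρ : Carrier} (s²h : (s * s) * h ≈ ι ½)
      (near : (s * s) * ((κ * h) * (κ * h) + (2π * t) * (2π * t)) ≤ ρ * ρ) where

      4κ-bound : κ * κ ≤ ι (4 /1) * (ρ * ρ) * (s * s)
      4κ-bound = nonNeg-resp
        (trans (solve 5 (λ s k h y p → # 4 :* ((s :* s) :* (p :* p :- (s :* s) :* ((k :* h) :* (k :* h) :+ y :* y)) :+ (s :* s) :* ((s :* s) :* (y :* y)))
            := # 4 :* (p :* p) :* (s :* s) :- # 4 :* ((k :* k) :* (((s :* s) :* h) :* ((s :* s) :* h)))) s κ h (2π * t) ρ)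
          (+-congˡ (-‿cong (trans (*-congˡ (*-congˡ (*-cong s²h s²h))) (solve 1 (λ k → # 4 :* ((k :* k) :* (con ½ :* con ½)) := k :* k) κ)))))
        (nonNeg-scale (4 /1) (nonNeg-+ (nonNeg-* (nonNeg-square s) near)
            (nonNeg-* (nonNeg-square s) (nonNeg-* (nonNeg-square s) (nonNeg-square (2π * t))))))

      κ-bound : κ * κ ≤ ι (9 /1) * (ρ * ρ) * (s * s)
      κ-bound = ≤-trans 4κ-bound (nonNeg-resp
        (solve 2 (λ p s → # 5 :* ((p :* p) :* (s :* s)) := # 9 :* (p :* p) :* (s :* s) :- # 4 :* (p :* p) :* (s :* s)) ρ s)
        (nonNeg-scale (5 /1) (nonNeg-* (nonNeg-square ρ) (nonNeg-square s))))

      t-bound : (s * s) * (t * t) ≤ ι (50 /1) * (ρ * ρ)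
      t-bound = nonNeg-resp
        (solve 5 (λ s x t p q →
            (p :* p :- (s :* s) :* (x :* x :+ (# 2 :* (# 4 :* q) :* t) :* (# 2 :* (# 4 :* q) :* t)))
            :+ ((s :* s) :* (x :* x) :+ (# 49 :* (p :* p) :+ ((s :* s) :* (t :* t)) :* (# 64 :* ((q :- con 2/3) :* ((q :- con 2/3) :+ con (ℤ.+ 4 ℚ./ 3))) :+ con (ℤ.+ 247 ℚ./ 9))))
          := # 50 :* (p :* p) :- (s :* s) :* (t :* t)) s (κ * h) t ρ ¼π)
        (nonNeg-+ near (nonNeg-+ (nonNeg-* (nonNeg-square s) (nonNeg-square (κ * h)))
          (nonNeg-+ (nonNeg-scale (49 /1) (nonNeg-square ρ))
            (nonNeg-* (nonNeg-* (nonNeg-square s) (nonNeg-square t))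
              (nonNeg-+ (nonNeg-scale (64 /1) (nonNeg-* 2/3≤¼π (nonNeg-+ 2/3≤¼π (constant (ℤ.+ 4 ℚ./ 3))))) (constant (ℤ.+ 247 ℚ./ 9)))))))

  -- (2π)² ≤ (8·13/15)² = 10816/225 < 50, hence 2500 = 50·50.
  y-bound : ∀ {N t ρ} → NonNeg N → N * (t * t) ≤ ι (50 /1) * (ρ * ρ) → N * ((2π * t) * (2π * t)) ≤ ι (2500 /1) * (ρ * ρ)
  y-bound {N} {t} {ρ} 0≤N h = nonNeg-resp
    (solve 4 (λ N t p q → # 50 :* (# 50 :* (p :* p) :- N :* (t :* t))
        :+ (N :* (t :* t)) :* (# 64 :* ((con 13/15 :- q) :* (con 13/15 :+ q)) :+ con (ℤ.+ 434 ℚ./ 225))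
      := # 2500 :* (p :* p) :- N :* ((# 2 :* (# 4 :* q) :* t) :* (# 2 :* (# 4 :* q) :* t))) N t ρ ¼π)
    (nonNeg-+ (nonNeg-scale (50 /1) h) (nonNeg-* (nonNeg-* 0≤N (nonNeg-square t))
      (nonNeg-+ (nonNeg-scale (64 /1) (nonNeg-* ¼π≤13/15 (nonNeg-+ (constant 13/15) 0≤¼π))) (constant (ℤ.+ 434 ℚ./ 225)))))

  -- The lattice basis and its modulus.

  square : Carrier → Carrier
  square x = x * x

  square-cong : ∀ {x y} → x ≈ y → square x ≈ square y
  square-cong e = *-cong e e

  module Basis (s h θ x : Carrier) where

    c d g : Carrier
    c = cos x
    d = sin x
    g = 2π * θ

    ω₁-re ω₁-im ω₂-re ω₂-im : Carrier
    ω₁-re = s * (h * c - g * d)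
    ω₁-im = s * (h * d + g * c)
    ω₂-re = s * (- (2π * d))
    ω₂-im = s * (2π * c)

    -- With x the angle of u, aω₁ + bω₂ = s (ah + 2πi(θa + b)) e^(ix), and the unit factor e^(ix)
    -- drops out.
    combination : ∀ a b →
      square (a * ω₁-re + b * ω₂-re) + square (a * ω₁-im + b * ω₂-im) ≈ (s * s) * (square (a * h) + square (2π * (θ * a + b)))
    combination a b = trans
      (solve 8 (λ s h θ p c d a b →
        (a :* (s :* (h :* c :- (p :* θ) :* d)) :+ b :* (s :* (:- (p :* d)))) :* (a :* (s :* (h :* c :- (p :* θ) :* d)) :+ b :* (s :* (:- (p :* d))))
          :+ (a :* (s :* (h :* d :+ (p :* θ) :* c)) :+ b :* (s :* (p :* c))) :* (a :* (s :* (h :* d :+ (p :* θ) :* c)) :+ b :* (s :* (p :* c)))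
        := (s :* s) :* ((a :* h) :* (a :* h) :+ (p :* (θ :* a :+ b)) :* (p :* (θ :* a :+ b))) :* (c :* c :+ d :* d)) s h θ 2π c d a b)
      (trans (*-congˡ (cos²+sin² x)) (solve 1 (λ e → e :* con 1ℚ := e) ((s * s) * (square (a * h) + square (2π * (θ * a + b))))))

    lattice-distance : ∀ a b →
      square ((s * c + (a * ω₁-re + b * ω₂-re)) - s * c) + square ((s * d + (a * ω₁-im + b * ω₂-im)) - s * d)
        ≈ (s * s) * (square (a * h) + square (2π * (θ * a + b)))
    lattice-distance a b = trans
      (+-cong (square-cong (solve 2 (λ u v → (u :+ v) :- u := v) (s * c) (a * ω₁-re + b * ω₂-re)))
              (square-cong (solve 2 (λ u v → (u :+ v) :- u := v) (s * d) (a * ω₁-im + b * ω₂-im))))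
      (combination a b)

    module _ {i : Carrier} (0≤s : NonNeg s) (0≤i : NonNeg i) (i*s : i * s ≈ ι 1ℚ) (s²h : (s * s) * h ≈ ι ½) where

      -- By `combination` both ah and 2π(θa + b) have square at most 0. Then s²h = ½ recovers a, and
      -- 2π > 1 recovers b.
      independent : ∀ a b → a * ω₁-re + b * ω₂-re ≈ ι 0ℚ → a * ω₁-im + b * ω₂-im ≈ ι 0ℚ → a ≈ ι 0ℚ × b ≈ ι 0ℚ
      independent a b re≈0 im≈0 = a≈0 , b≈0
        where
        y : Carrier
        y = 2π * (θ * a + b)
        total : (s * s) * (square (a * h) + square y) ≈ ι 0ℚ
        total = trans (sym (combination a b)) (trans (+-cong (square-cong re≈0) (square-cong im≈0))
          (solve 0 (con 0ℚ :* con 0ℚ :+ con 0ℚ :* con 0ℚ := con 0ℚ)))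
        -total : NonNeg (- ((s * s) * (square (a * h) + square y)))
        -total = nonNeg-resp (trans (solve 0 (con 0ℚ := :- con 0ℚ)) (-‿cong (sym total))) (constant 0ℚ)
        ah≈0 : a * h ≈ 0#
        ah≈0 = square≤0⇒≈0 (≤-resp refl ι-0 (cancel² 0≤s 0≤i i*s (nonNeg-resp
          (solve 3 (λ s u v → :- ((s :* s) :* (u :* u :+ v :* v)) :+ (s :* s) :* (v :* v) := (s :* s) :* (con 0ℚ :- u :* u)) s (a * h) y)
          (nonNeg-+ -total (nonNeg-* (nonNeg-square s) (nonNeg-square y))))))
        y≈0 : y ≈ 0#
        y≈0 = square≤0⇒≈0 (≤-resp refl ι-0 (cancel² 0≤s 0≤i i*s (nonNeg-resp
          (solve 3 (λ s u v → :- ((s :* s) :* (u :* u :+ v :* v)) :+ (s :* s) :* (u :* u) := (s :* s) :* (con 0ℚ :- v :* v)) s (a * h) y)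
          (nonNeg-+ -total (nonNeg-* (nonNeg-square s) (nonNeg-square (a * h)))))))
        a≈0 : a ≈ ι 0ℚ
        a≈0 = trans (solve 1 (λ a → a := # 2 :* (a :* con ½)) a)
          (trans (*-congˡ (*-congˡ (sym s²h)))
            (trans (solve 3 (λ a s h → # 2 :* (a :* ((s :* s) :* h)) := # 2 :* ((s :* s) :* (a :* h))) a s h)
              (trans (*-congˡ (*-congˡ (trans ah≈0 0≈ι0))) (solve 1 (λ s → # 2 :* ((s :* s) :* con 0ℚ) := con 0ℚ) s))))
        2πb≈0 : 2π * b ≈ ι 0ℚ
        2πb≈0 = trans (solve 4 (λ p θ a b → p :* b := p :* (θ :* a :+ b) :- p :* (θ :* a)) 2π θ a b)
          (trans (+-cong (trans y≈0 0≈ι0) (-‿cong (*-congˡ (*-congˡ a≈0)))) (solve 2 (λ p θ → con 0ℚ :- p :* (θ :* con 0ℚ) := con 0ℚ) 2π θ))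
        b≈0 : b ≈ ι 0ℚ
        b≈0 = trans (square≤0⇒≈0 (≤-resp refl (trans (square-cong 2πb≈0) (trans (solve 0 (con 0ℚ :* con 0ℚ := con 0ℚ)) ι-0)) (nonNeg-resp
          (solve 2 (λ b q → (b :* b) :* (# 64 :* ((q :- con 2/3) :* ((q :- con 2/3) :+ con (ℤ.+ 4 ℚ./ 3))) :+ con (ℤ.+ 247 ℚ./ 9))
            := (# 2 :* (# 4 :* q) :* b) :* (# 2 :* (# 4 :* q) :* b) :- b :* b) b ¼π)
          (nonNeg-* (nonNeg-square b)
            (nonNeg-+ (nonNeg-scale (64 /1) (nonNeg-* 2/3≤¼π (nonNeg-+ 2/3≤¼π (constant (ℤ.+ 4 ℚ./ 3))))) (constant (ℤ.+ 247 ℚ./ 9))))))) 0≈ι0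

    ∣ω₁∣²≥ : (s * s) * (h * h) ≤ square ω₁-re + square ω₁-im
    ∣ω₁∣²≥ = ≤-resp refl
      (trans (sym (combination (ι 1ℚ) (ι 0ℚ))) (+-cong
        (square-cong (solve 2 (λ u v → con 1ℚ :* u :+ con 0ℚ :* v := u) ω₁-re ω₂-re))
        (square-cong (solve 2 (λ u v → con 1ℚ :* u :+ con 0ℚ :* v := u) ω₁-im ω₂-im))))
      (nonNeg-resp (solve 3 (λ s h y → (s :* s) :* (y :* y)
          := (s :* s) :* ((con 1ℚ :* h) :* (con 1ℚ :* h) :+ y :* y) :- (s :* s) :* (h :* h)) s h (2π * (θ * ι 1ℚ + ι 0ℚ)))
        (nonNeg-* (nonNeg-square s) (nonNeg-square _)))

    -- The modulus is iq/(1 + iw), where q h = 2π and w h = 2πθ.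
    module Modulus {q w v τ-re τ-im : Carrier} (q*h : q * h ≈ 2π) (w*h : w * h ≈ g) (v*∣1+iw∣² : v * (ι 1ℚ + w * w) ≈ ι 1ℚ)
      (τ-re≈ : τ-re ≈ v * (q * w)) (τ-im≈ : τ-im ≈ v * q) where

      ω₁τ-re : ω₁-re * τ-re - ω₁-im * τ-im ≈ ω₂-re
      ω₁τ-re = trans (+-cong (*-cong (*-congˡ (+-congˡ (-‿cong (*-congʳ (sym w*h))))) τ-re≈)
          (-‿cong (*-cong (*-congˡ (+-congˡ (*-congʳ (sym w*h)))) τ-im≈)))
        (trans (solve 7 (λ s h c d w q v → s :* (h :* c :- (w :* h) :* d) :* (v :* (q :* w)) :- s :* (h :* d :+ (w :* h) :* c) :* (v :* q)
            := s :* (:- ((q :* h) :* d)) :* (v :* (con 1ℚ :+ w :* w))) s h c d w q v)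
          (trans (*-cong (*-congˡ (-‿cong (*-congʳ q*h))) v*∣1+iw∣²) (solve 1 (λ e → e :* con 1ℚ := e) ω₂-re)))

      ω₁τ-im : ω₁-re * τ-im + ω₁-im * τ-re ≈ ω₂-im
      ω₁τ-im = trans (+-cong (*-cong (*-congˡ (+-congˡ (-‿cong (*-congʳ (sym w*h))))) τ-im≈)
          (*-cong (*-congˡ (+-congˡ (*-congʳ (sym w*h)))) τ-re≈))
        (trans (solve 7 (λ s h c d w q v → s :* (h :* c :- (w :* h) :* d) :* (v :* q) :+ s :* (h :* d :+ (w :* h) :* c) :* (v :* (q :* w))
            := s :* ((q :* h) :* c) :* (v :* (con 1ℚ :+ w :* w))) s h c d w q v)
          (trans (*-cong (*-congˡ (*-congʳ q*h)) v*∣1+iw∣²) (solve 1 (λ e → e :* con 1ℚ := e) ω₂-im)))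

      -- ω₂ = ω₁τ makes z ↦ ω₁z + e carry a + bτ to the lattice point. The zeros and ones reproduce
      -- the coordinates of a point of `ℤ+ℤ_` as they unfold.
      similarity-re : ∀ e a b →
        e + (a * ω₁-re + b * ω₂-re)
          ≈ (ω₁-re * (ι 0ℚ + (a * ι 1ℚ + b * τ-re)) - ω₁-im * (ι 0ℚ + (a * ι 0ℚ + b * τ-im))) + e
      similarity-re e a b = trans (+-congˡ (+-congˡ (*-congˡ (sym ω₁τ-re))))
        (solve 7 (λ e u v a b x y → e :+ (a :* u :+ b :* (u :* x :- v :* y))
          := (u :* (con 0ℚ :+ (a :* con 1ℚ :+ b :* x)) :- v :* (con 0ℚ :+ (a :* con 0ℚ :+ b :* y))) :+ e)
          e ω₁-re ω₁-im a b τ-re τ-im)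

      similarity-im : ∀ e a b →
        e + (a * ω₁-im + b * ω₂-im)
          ≈ (ω₁-re * (ι 0ℚ + (a * ι 0ℚ + b * τ-im)) + ω₁-im * (ι 0ℚ + (a * ι 1ℚ + b * τ-re))) + e
      similarity-im e a b = trans (+-congˡ (+-congˡ (*-congˡ (sym ω₁τ-im))))
        (solve 7 (λ e u v a b x y → e :+ (a :* v :+ b :* (u :* y :+ v :* x))
          := (u :* (con 0ℚ :+ (a :* con 0ℚ :+ b :* y)) :+ v :* (con 0ℚ :+ (a :* con 1ℚ :+ b :* x))) :+ e)
          e ω₁-re ω₁-im a b τ-re τ-im)

    module Spiral {r xⱼ y : Carrier} (cos-xⱼ : cos xⱼ ≈ cos (x + y)) (sin-xⱼ : sin xⱼ ≈ sin (x + y)) where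

      γ σ : Carrier
      γ = cos y
      σ = sin y

      -- Division by e^(ix) preserves distances and brings φ(n) to the positive real axis, the
      -- position assumed by `NearSpiral`.
      spiral-distance : square (r * cos xⱼ - s * c) + square (r * sin xⱼ - s * d) ≈ square (r * γ - s) + square (r * σ)
      spiral-distance = trans
        (+-cong (square-cong (+-congʳ (*-congˡ (trans cos-xⱼ (cos-+ x y))))) (square-cong (+-congʳ (*-congˡ (trans sin-xⱼ (sin-+ x y))))))
        (trans (solve 6 (λ r s c d γ σ →
            (r :* (c :* γ :- d :* σ) :- s :* c) :* (r :* (c :* γ :- d :* σ) :- s :* c)
                :+ (r :* (c :* σ :+ d :* γ) :- s :* d) :* (r :* (c :* σ :+ d :* γ) :- s :* d)
            := ((r :* γ :- s) :* (r :* γ :- s) :+ (r :* σ) :* (r :* σ)) :* (c :* c :+ d :* d)) r s c d γ σ)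
          (trans (*-congˡ (cos²+sin² x)) (solve 1 (λ e → e :* con 1ℚ := e) _)))

      approximation-error : ∀ a b → y ≈ 2π * (θ * a + b) →
        square (r * cos xⱼ - (s * c + (a * ω₁-re + b * ω₂-re))) + square (r * sin xⱼ - (s * d + (a * ω₁-im + b * ω₂-im)))
          ≈ square (r * γ - (s + s * (a * h))) + square (r * σ - s * y)
      approximation-error a b e = trans
        (+-cong (square-cong (+-congʳ (*-congˡ (trans cos-xⱼ (cos-+ x y))))) (square-cong (+-congʳ (*-congˡ (trans sin-xⱼ (sin-+ x y))))))
        (trans (+-cong
            (square-cong (solve 10 (λ r s h θ p c d C a b → r :* C :- (s :* c :+ (a :* (s :* (h :* c :- (p :* θ) :* d)) :+ b :* (s :* (:- (p :* d)))))
              := r :* C :- s :* (c :* (con 1ℚ :+ a :* h) :- d :* (p :* (θ :* a :+ b)))) r s h θ 2π c d (c * γ - d * σ) a b))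
            (square-cong (solve 10 (λ r s h θ p c d C a b → r :* C :- (s :* d :+ (a :* (s :* (h :* d :+ (p :* θ) :* c)) :+ b :* (s :* (p :* c))))
              := r :* C :- s :* (d :* (con 1ℚ :+ a :* h) :+ c :* (p :* (θ :* a :+ b)))) r s h θ 2π c d (c * σ + d * γ) a b)))
          (trans (+-cong (square-cong (+-congˡ (-‿cong (*-congˡ (+-congˡ (-‿cong (*-congˡ (sym e)))))))) (square-cong (+-congˡ (-‿cong (*-congˡ
              (+-congˡ (*-congˡ (sym e))))))))
            (trans (solve 8 (λ r s c d γ σ y k →
              (r :* (c :* γ :- d :* σ) :- s :* (c :* (con 1ℚ :+ k) :- d :* y)) :* (r :* (c :* γ :- d :* σ) :- s :* (c :* (con 1ℚ :+ k) :- d :* y))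
                :+ (r :* (c :* σ :+ d :* γ) :- s :* (d :* (con 1ℚ :+ k) :+ c :* y)) :* (r :* (c :* σ :+ d :* γ) :- s :* (d :* (con 1ℚ :+ k) :+ c :* y))
              := ((r :* γ :- (s :+ s :* k)) :* (r :* γ :- (s :+ s :* k)) :+ (r :* σ :- s :* y) :* (r :* σ :- s :* y)) :* (c :* c :+ d :* d)) r s c d γ σ y (a * h))
              (trans (*-congˡ (cos²+sin² x)) (solve 1 (λ e → e :* con 1ℚ := e) _)))))

  ∣point∣² : ∀ r x → square (r * cos x) + square (r * sin x) ≈ r * r
  ∣point∣² r x = trans (solve 3 (λ r c s → (r :* c) :* (r :* c) :+ (r :* s) :* (r :* s) := (r :* r) :* (c :* c :+ s :* s)) r (cos x) (sin x))
    (trans (*-congˡ (cos²+sin² x)) (solve 1 (λ e → e :* con 1ℚ := e) (r * r)))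

  -- Both t and t + μ are within √(50/2500) = √0.02 of 0.
  separation : ∀ {N M t ρ} μ → N * M ≈ ι 1ℚ → NonNeg N → NonNeg M → ι (2500 /1) * (ρ * ρ) ≤ N →
    N * (t * t) ≤ ι (50 /1) * (ρ * ρ) → N * ((t + μ) * (t + μ)) ≤ ι (50 /1) * (ρ * ρ) → ∣ μ ∣≤ ι ½
  separation {N} {M} {t} {ρ} μ N*M 0≤N 0≤M h t≤ t+μ≤ = square≤⇒∣∣≤ (ι ½) (ι (2 /1)) (trans (solve 0 (con ½ :* # 2
      := con 1ℚ)) ι-1) (constant (2 /1))
    (nonNeg-cancel M N (trans (*-comm M N) (trans N*M ι-1)) 0≤M (nonNeg-resp
      -- The parallelogram law μ² + (2t + μ)² = 2t² + 2(t + μ)² gives μ² ≤ 4·0.02 = 0.08 < 1/4; 2/25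
      -- + 17/100 = 1/4 accounts for the remaining weights.
      (solve 4 (λ N t m p →
          # 2 :* (# 50 :* (p :* p) :- N :* (t :* t)) :+ # 2 :* (# 50 :* (p :* p) :- N :* ((t :+ m) :* (t :+ m)))
          :+ (con (ℤ.+ 2 ℚ./ 25) :* (N :- # 2500 :* (p :* p))
              :+ (N :* ((# 2 :* t :+ m) :* (# 2 :* t :+ m)) :+ con (ℤ.+ 17 ℚ./ 100) :* N))
        := N :* (con ½ :* con ½ :- m :* m)) N t μ ρ)
      (nonNeg-+ (nonNeg-+ (nonNeg-scale (2 /1) t≤) (nonNeg-scale (2 /1) t+μ≤))
        (nonNeg-+ (nonNeg-scale (ℤ.+ 2 ℚ./ 25) h) (nonNeg-+ (nonNeg-* 0≤N (nonNeg-square _)) (nonNeg-scale (ℤ.+ 17 ℚ./ 100) 0≤N))))))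

-- Integers inside the rationals.

module Integers where

  open ≡
  open +-*-Solver using (solve; _:+_; _:*_; :-_; _:-_; _:=_; con)

  [a+b]/1 : ∀ a b → (a ℤ.+ b) ℚ./ 1 ≡ a ℚ./ 1 ℚ.+ b ℚ./ 1
  [a+b]/1 a b = ℚ.toℚᵘ-injective (ℚᵘ.≃-trans (Estimates.toℚᵘ-/ (a ℤ.+ b) 0)
    (ℚᵘ.≃-trans (ℚᵘ.*≡* (cong (ℤ._* ℤ.+ 1) (cong₂ ℤ._+_ (sym (ℤ.*-identityʳ a)) (sym (ℤ.*-identityʳ b)))))
      (ℚᵘ.≃-trans (ℚᵘ.+-cong (ℚᵘ.≃-sym (Estimates.toℚᵘ-/ a 0)) (ℚᵘ.≃-sym (Estimates.toℚᵘ-/ b 0)))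
        (ℚᵘ.≃-sym (ℚ.toℚᵘ-homo-+ (a ℚ./ 1) (b ℚ./ 1))))))

  [a-b]/1 : ∀ a b → (a ℤ.- b) ℚ./ 1 ≡ a ℚ./ 1 ℚ.- b ℚ./ 1
  [a-b]/1 a b = trans (solve 2 (λ x y → x := (x :+ y) :- y) refl ((a ℤ.- b) ℚ./ 1) (b ℚ./ 1))
    (cong (ℚ._- b ℚ./ 1) (trans (sym ([a+b]/1 (a ℤ.- b) b)) (cong (ℚ._/ 1)
      (trans (ℤ.+-assoc a (ℤ.- b) b) (trans (cong (λ t → a ℤ.+ t) (ℤ.+-inverseˡ b)) (ℤ.+-identityʳ a))))))

  /1-mono : ∀ {a b} → a ℤ.≤ b → a ℚ./ 1 ℚ.≤ b ℚ./ 1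
  /1-mono {a} {b} h = Estimates./-≤ a 0 b 0 (ℤ.*-monoʳ-≤-nonNeg (ℤ.+ 1) h)

  -- Otherwise a - b would be at least 1. The slack ½ is what lets approximate comparisons of
  -- integers in the ring become exact.
  /1-≤½ : ∀ a b → a ℚ./ 1 ℚ.- b ℚ./ 1 ℚ.≤ ½ → a ℤ.≤ b
  /1-≤½ a b h with a ℤ.≤? b
  ... | yes a≤b = a≤b
  ... | no a≰b  = ⊥-elim (ℚ.<-irrefl refl (ℚ.<-≤-trans ½<1 (ℚ.≤-trans 1≤a-b h)))
    where
    ½<1 : ½ ℚ.< 1ℚ
    ½<1 = toWitness {a? = ½ ℚ.<? 1ℚ} _
    1≤a-b : 1ℚ ℚ.≤ a ℚ./ 1 ℚ.- b ℚ./ 1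
    1≤a-b = subst (ℚ._≤ a ℚ./ 1 ℚ.- b ℚ./ 1) (solve 2 (λ o y → (o :+ y) :- y := o) refl 1ℚ (b ℚ./ 1))
      (ℚ.+-monoˡ-≤ (ℚ.- (b ℚ./ 1)) (subst (ℚ._≤ a ℚ./ 1) ([a+b]/1 (ℤ.+ 1) b) (/1-mono (ℤ.i<j⇒suc[i]≤j (ℤ.≰⇒> a≰b)))))

  /1-nonNeg : ∀ a → 0ℚ ℚ.≤ a ℚ./ 1 → ℤ.+ 0 ℤ.≤ a
  /1-nonNeg a h = /1-≤½ (ℤ.+ 0) a (ℚ.≤-trans
    (subst (0ℚ ℚ.- a ℚ./ 1 ℚ.≤_) (ℚ.+-inverseʳ (a ℚ./ 1)) (ℚ.+-monoˡ-≤ (ℚ.- (a ℚ./ 1)) h)) (ℚ.nonNegative⁻¹ ½))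

  floor : ∀ p → ∃ λ m → m ℚ./ 1 ℚ.≤ p × p ℚ.≤ (ℤ.suc m) ℚ./ 1
  floor p@(mkℚ a d _) = m
    , ℚ.toℚᵘ-cancel-≤ (ℚᵘ.≤-trans (ℚᵘ.≤-reflexive (Estimates.toℚᵘ-/ m 0)) (ℚᵘ.*≤*
        (subst (m ℤ.* ℤ.+ suc d ℤ.≤_) (trans (sym (ℤ.a≡a%ℕn+[a/ℕn]*n a (suc d))) (sym (ℤ.*-identityʳ a)))
          (ℤ.i≤j⇒i≤k+j (ℤ.+ (a ℤ.%ℕ suc d)) ℤ.≤-refl))))
    , ℚ.toℚᵘ-cancel-≤ (ℚᵘ.≤-trans (ℚᵘ.*≤*
        (subst (ℤ._≤ ℤ.suc m ℤ.* ℤ.+ suc d) (sym (ℤ.*-identityʳ a)) (ℤ.<⇒≤ (ℤ.n<s[n/ℕd]*d a (suc d)))))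
        (ℚᵘ.≤-reflexive (ℚᵘ.≃-sym (Estimates.toℚᵘ-/ (ℤ.suc m) 0))))
    where
    m : ℤ
    m = a ℤ./ℕ suc d

  nearest : ∀ q → ∃ λ m → ℚ.∣ q ℚ.+ m ℚ./ 1 ∣ ℚ.≤ ½
  nearest q = let m , m≤ , ≤m = floor (q ℚ.+ ½) in ℤ.- m , subst (λ t → ℚ.∣ q ℚ.+ t ∣ ℚ.≤ ½) (sym (neg m))
    (bound q (m ℚ./ 1) m≤ (subst (q ℚ.+ ½ ℚ.≤_) ([a+b]/1 (ℤ.+ 1) m) ≤m))
    where
    neg : ∀ m → (ℤ.- m) ℚ./ 1 ≡ ℚ.- (m ℚ./ 1)
    neg m = trans (cong (ℚ._/ 1) (sym (ℤ.+-identityˡ (ℤ.- m)))) (trans ([a-b]/1 (ℤ.+ 0) m) (ℚ.+-identityˡ (ℚ.- (m ℚ./ 1))))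
    bound : ∀ q m → m ℚ.≤ q ℚ.+ ½ → q ℚ.+ ½ ℚ.≤ 1ℚ ℚ.+ m → ℚ.∣ q ℚ.+ ℚ.- m ∣ ℚ.≤ ½
    bound q m lower upper = Estimates.abs≤ {q ℚ.- m} {½}
      (Estimates.≤-to-sub {q} {m} {½} (begin
        q ≡⟨ solve 1 (λ q → q := (q :+ con ½) :- con ½) refl q ⟩
        (q ℚ.+ ½) ℚ.- ½ ≤⟨ ℚ.+-monoˡ-≤ (ℚ.- ½) upper ⟩
        (1ℚ ℚ.+ m) ℚ.- ½ ≡⟨ solve 1 (λ m → (con 1ℚ :+ m) :- con ½ := con ½ :+ m) refl m ⟩
        ½ ℚ.+ m ∎))
      (begin
        ℚ.- (q ℚ.- m) ≡⟨ solve 2 (λ q m → :- (q :- m) := m :- q) refl q m ⟩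
        m ℚ.- q ≤⟨ ℚ.+-monoˡ-≤ (ℚ.- q) lower ⟩
        q ℚ.+ ½ ℚ.- q ≡⟨ solve 1 (λ q → q :+ con ½ :- q := con ½) refl q ⟩
        ½ ∎)
      where open ℚ.≤-Reasoning

-- The construction over an abstract ordered ring.

-- `nearest` asks for 11/20 because a real is rounded through a rational within 1/20 of it.
-- `ι-reflects` brings inequalities obtained in the ring back to ℚ, where integers can be compared.
record Completeness (O : OrderedRing) : Set where
  open OrderedRingProperties O
  field
    root        : ℕ → Carrier
    root-nonNeg : ∀ j → NonNeg (root j)
    root²       : ∀ j → root j * root j ≈ ι (fromℕ j)
    ι-reflects  : ∀ q → NonNeg (ι q) → 0ℚ ℚ.≤ q
    nearest     : ∀ x → ∃ λ m → ∣ x + ι (m ℚ./ 1) ∣≤ ι (ℤ.+ 11 ℚ./ 20)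

-- The first condition makes y = 2πt at most 1 in absolute value and m unique. The second makes the
-- error at most δ; 7509 = 9 + 3·2500 is the value of A + 3Y in units of ρ².
Precise : ℚ → ℚ → ℕ → Set
Precise ρ δ n = 2500 /1 ℚ.* (ρ ℚ.* ρ) ℚ.≤ fromℕ n
  × 2 /1 ℚ.* ((7509 /1 ℚ.* (ρ ℚ.* ρ)) ℚ.* (7509 /1 ℚ.* (ρ ℚ.* ρ))) ℚ.≤ δ ℚ.* δ ℚ.* fromℕ n

natural-above : ∀ x → 0ℚ ℚ.≤ x → ∃ λ N → ∀ n → suc N ℕ.≤ n → x ℚ.≤ fromℕ n
natural-above x 0≤x = ℤ.∣ ℚ.↥ x ∣ , λ n N<n → ℚ.≤-trans (CauchyProperties.≤numerator x 0≤x)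
  (Integers./1-mono (ℤ.+≤+ (ℕ.≤-trans (ℕ.n≤1+n ℤ.∣ ℚ.↥ x ∣) N<n)))

threshold : ∀ a b c → 0ℚ ℚ.≤ a → 0ℚ ℚ.≤ b → 0ℚ ℚ.< c →
  ∃ λ N → ∀ n → suc N ℕ.≤ n → a ℚ.≤ fromℕ n × b ℚ.≤ c ℚ.* fromℕ n
threshold a b c 0≤a 0≤b 0<c with Estimates.scale c 1ℚ 0<c (ℚ.positive⁻¹ 1ℚ)
... | e , 0<e , ce≡1 with natural-above (a ℚ.+ e ℚ.* b) (Estimates.+-nonNeg {a} {e ℚ.* b} 0≤a (Estimates.*-nonNeg {e} {b} (ℚ.<⇒≤ 0<e) 0≤b))
... | N , above = N , λ n N<n → split (fromℕ n) (above n N<n)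
  where
  0≤eb : 0ℚ ℚ.≤ e ℚ.* b
  0≤eb = Estimates.*-nonNeg {e} {b} (ℚ.<⇒≤ 0<e) 0≤b
  split : ∀ y → a ℚ.+ e ℚ.* b ℚ.≤ y → a ℚ.≤ y × b ℚ.≤ c ℚ.* y
  split y h =
      ℚ.≤-trans (subst (ℚ._≤ a ℚ.+ e ℚ.* b) (ℚ.+-identityʳ a) (ℚ.+-monoʳ-≤ a 0≤eb)) h
    , subst (ℚ._≤ c ℚ.* y)
        (≡.trans (≡.sym (ℚ.*-assoc c e b)) (≡.trans (cong (ℚ._* b) ce≡1) (ℚ.*-identityˡ b)))
        (ℚ.*-monoˡ-≤-nonNeg c {{ℚ.nonNegative (ℚ.<⇒≤ 0<c)}}
          (ℚ.≤-trans (subst (ℚ._≤ a ℚ.+ e ℚ.* b) (ℚ.+-identityˡ (e ℚ.* b)) (ℚ.+-monoˡ-≤ (e ℚ.* b) 0≤a)) h))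

precise-threshold : ∀ ρ δ → 0ℚ ℚ.< δ → ∃ λ N → ∀ n → suc N ℕ.≤ n → Precise ρ δ n
precise-threshold ρ δ 0<δ = threshold (2500 /1 ℚ.* (ρ ℚ.* ρ)) (2 /1 ℚ.* ((7509 /1 ℚ.* (ρ ℚ.* ρ)) ℚ.* (7509 /1 ℚ.* (ρ ℚ.* ρ)))) (δ ℚ.* δ)
  (Estimates.*-nonNeg {2500 /1} {ρ ℚ.* ρ} (ℚ.nonNegative⁻¹ (2500 /1)) (Estimates.sq-nonNeg ρ))
  (Estimates.*-nonNeg {2 /1} {(7509 /1 ℚ.* (ρ ℚ.* ρ)) ℚ.* (7509 /1 ℚ.* (ρ ℚ.* ρ))}
      (ℚ.nonNegative⁻¹ (2 /1)) (Estimates.sq-nonNeg (7509 /1 ℚ.* (ρ ℚ.* ρ))))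
  (Estimates.*-pos {δ} {δ} 0<δ 0<δ)

-- The coordinates of φ θ j are parameters: unfolding √ and exp would be far too slow.
record SpiralCoordinates (O : OrderedRing) (T : Trigonometry O) (C : Completeness O) : Set where
  open OrderedRing O
  open Trigonometry T
  open Completeness C
  field
    θ      : Carrier
    angle  : ℕ → Carrier
    angle≈ : ∀ j → angle j ≈ TrigonometryProperties.2π O T * θ * ι (fromℕ j)
    abscissa ordinate : ℕ → Carrier
    abscissa≈ : ∀ j → abscissa j ≈ root j * cos (angle j)
    ordinate≈ : ∀ j → ordinate j ≈ root j * sin (angle j)

module Construction (O : OrderedRing) (T : Trigonometry O) (C : Completeness O)
  (ρ δ : ℚ) (0<ρ : 0ℚ ℚ.< ρ) (n n′ : ℕ) (n≡ : n ≡ suc n′) (precise : Precise ρ δ n)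
  (Θ : SpiralCoordinates O T C) where

  open OrderedRingProperties O
  open Trigonometry T
  open TrigonometryProperties O T
  open Completeness C
  open SpiralCoordinates Θ
  open Integers using ([a-b]/1; [a+b]/1; /1-≤½; /1-nonNeg)

  N N⁻¹ s i h : Carrier
  N   = ι (fromℕ n)
  N⁻¹ = ι (1/suc n′)
  s   = root n
  i   = N⁻¹ * s
  h   = ι (½ ℚ.* 1/suc n′)

  open Basis s h θ (angle n) public

  ρ² : Carrier
  ρ² = ι ρ * ι ρ

  bound : Carrier
  bound = ι (7509 /1) * ρ²

  shift : ℕ → ℤ
  shift j = ℤ.+ j ℤ.- ℤ.+ n

  offset : ℤ → ℤ → Carrier
  offset a m = θ * ι (a ℚ./ 1) + ι (m ℚ./ 1)

  -- The same pairs (κ, m) index both subsets to be matched, so that the bijection is the identity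
  -- on indices.
  record Admissible (a m : ℤ) : Set where
    constructor admissible
    field
      shift≤  : ι (a ℚ./ 1) * ι (a ℚ./ 1) ≤ ι (9 /1) * ρ² * N
      offset≤ : N * (offset a m * offset a m) ≤ ι (50 /1) * ρ²

  0≤N : NonNeg N
  0≤N = 0≤n n

  0≤N⁻¹ : NonNeg N⁻¹
  0≤N⁻¹ = nonNeg-ι (1/suc n′) (Estimates.1/suc-nonNeg n′)

  N⁻¹*N : N⁻¹ * N ≈ ι 1ℚ
  N⁻¹*N = subst (λ k → N⁻¹ * ι (fromℕ k) ≈ ι 1ℚ) (≡.sym n≡) (n/n n′)

  N*N⁻¹ : N * N⁻¹ ≈ ι 1ℚ
  N*N⁻¹ = trans (*-comm N N⁻¹) N⁻¹*N

  0≤s : NonNeg s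
  0≤s = root-nonNeg n

  0≤i : NonNeg i
  0≤i = nonNeg-* 0≤N⁻¹ 0≤s

  i*s : i * s ≈ ι 1ℚ
  i*s = trans (*-assoc N⁻¹ s s) (trans (*-congˡ (root² n)) N⁻¹*N)

  s²h : (s * s) * h ≈ ι ½
  s²h = trans (*-cong (root² n) (ι-* ½ (1/suc n′)))
    (trans (solve 2 (λ a b → a :* (con ½ :* b) := con ½ :* (b :* a)) N N⁻¹)
      (trans (*-congˡ N⁻¹*N) (solve 0 (con ½ :* con 1ℚ := con ½))))

  private
    ρ⁻¹ = ι-inverse ρ 0<ρ

  ι[a-b] : ∀ a b → ι ((a ℤ.- b) ℚ./ 1) ≈ ι (a ℚ./ 1) - ι (b ℚ./ 1)
  ι[a-b] a b = trans (ι-cong ([a-b]/1 a b)) (trans (ι-+ (a ℚ./ 1) (ℚ.- (b ℚ./ 1))) (+-congˡ (ι-neg (b ℚ./ 1))))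

  integer-equal : ∀ a b → ∣ ι (a ℚ./ 1) - ι (b ℚ./ 1) ∣≤ ι ½ → a ≡ b
  integer-equal a b (u , v) = ℤ.≤-antisym
    (/1-≤½ a b (reflect (nonNeg-resp (sym (trans (ι-+ ½ (ℚ.- (a ℚ./ 1 ℚ.- b ℚ./ 1))) (+-congˡ (trans (ι-neg _) (-‿cong (difference a b)))))) u)))
    (/1-≤½ b a (reflect (nonNeg-resp (trans
      (solve 2 (λ x y → con ½ :+ (x :- y) := con ½ :- (y :- x)) (ι (a ℚ./ 1)) (ι (b ℚ./ 1)))
      (sym (trans (ι-+ ½ (ℚ.- (b ℚ./ 1 ℚ.- a ℚ./ 1))) (+-congˡ (trans (ι-neg _) (-‿cong (difference b a))))))) v)))
    where
    difference : ∀ a b → ι (a ℚ./ 1 ℚ.- b ℚ./ 1) ≈ ι (a ℚ./ 1) - ι (b ℚ./ 1)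
    difference a b = trans (ι-+ (a ℚ./ 1) (ℚ.- (b ℚ./ 1))) (+-congˡ (ι-neg (b ℚ./ 1)))
    reflect : ∀ {q r} → NonNeg (ι (q ℚ.- r)) → r ℚ.≤ q
    reflect {q} {r} h = subst (ℚ._≤ q) (ℚ.+-identityˡ r) (subst (0ℚ ℚ.+ r ℚ.≤_)
      (+-*-Solver.solve 2 (λ q r → (q +-*-Solver.:- r) +-*-Solver.:+ r +-*-Solver.:= q) ≡.refl q r)
      (ℚ.+-monoˡ-≤ r (ι-reflects (q ℚ.- r) h)))

  integer-≈ : ∀ a b → ι (a ℚ./ 1) ≈ ι (b ℚ./ 1) → a ≡ b
  integer-≈ a b e = integer-equal a b (∣∣≤-resp (sym (trans (+-congʳ e) (-‿inverseʳ (ι (b ℚ./ 1))))) refl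
    ( nonNeg-resp (trans (solve 0 (con ½ := con ½ :- con 0ℚ)) (+-congˡ (-‿cong ι-0))) (constant ½)
    , nonNeg-resp (trans (solve 0 (con ½ := con ½ :+ con 0ℚ)) (+-congˡ ι-0)) (constant ½)))

  κ≈ : ∀ j → ι (shift j ℚ./ 1) ≈ root j * root j - s * s
  κ≈ j = trans (ι[a-b] (ℤ.+ j) (ℤ.+ n)) (+-cong (sym (root² j)) (-‿cong (sym (root² n))))

  angle-shift : ∀ j m → angle j + ι (m ℚ./ 1) * 2π ≈ angle n + 2π * offset (shift j) m
  angle-shift j m = trans (+-congʳ (angle≈ j)) (trans
    (solve 5 (λ p θ j n m → p :* θ :* j :+ m :* p := p :* θ :* n :+ p :* (θ :* (j :- n) :+ m)) 2π θ (ι (fromℕ j)) N (ι (m ℚ./ 1)))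
    (+-cong (sym (angle≈ n)) (*-congˡ (+-congʳ (*-congˡ (sym (ι[a-b] (ℤ.+ j) (ℤ.+ n))))))))

  cos-angle : ∀ j m → cos (angle j) ≈ cos (angle n + 2π * offset (shift j) m)
  cos-angle j m = trans (sym (cos-period (angle j) m)) (cos-cong (angle-shift j m))

  sin-angle : ∀ j m → sin (angle j) ≈ sin (angle n + 2π * offset (shift j) m)
  sin-angle j m = trans (sym (sin-period (angle j) m)) (sin-cong (angle-shift j m))

  ∣spiral∣² : ∀ j → abscissa j * abscissa j + ordinate j * ordinate j ≈ ι (fromℕ j)
  ∣spiral∣² j = trans (+-cong (square-cong (abscissa≈ j)) (square-cong (ordinate≈ j))) (trans (∣point∣² (root j) (angle j)) (root² j))

  -- The index is visible in the modulus: |φ(j)|² = j.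
  spiral-injective : ∀ j j′ → abscissa j ≈ abscissa j′ → ordinate j ≈ ordinate j′ → j ≡ j′
  spiral-injective j j′ p q = ℤ.+-injective (integer-≈ (ℤ.+ j) (ℤ.+ j′)
    (trans (sym (∣spiral∣² j)) (trans (+-cong (square-cong p) (square-cong q)) (∣spiral∣² j′))))

  lattice-re lattice-im : ℤ → ℤ → Carrier
  lattice-re a m = abscissa n + (ι (a ℚ./ 1) * ω₁-re + ι (m ℚ./ 1) * ω₂-re)
  lattice-im a m = ordinate n + (ι (a ℚ./ 1) * ω₁-im + ι (m ℚ./ 1) * ω₂-im)

  ω-independent : ∀ a b → a * ω₁-re + b * ω₂-re ≈ ι 0ℚ → a * ω₁-im + b * ω₂-im ≈ ι 0ℚ → a ≈ ι 0ℚ × b ≈ ι 0ℚ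
  ω-independent = independent 0≤s 0≤i i*s s²h

  -- The first index is all that the inverse of the pairing has to recover: it determines j = n + a
  -- and with it φ(j).
  lattice-injective : ∀ a m a′ m′ → lattice-re a m ≈ lattice-re a′ m′ → lattice-im a m ≈ lattice-im a′ m′ → a ≡ a′
  lattice-injective a m a′ m′ p q = integer-≈ a a′
    (trans (solve 2 (λ x y → x := (x :- y) :+ y) (ι (a ℚ./ 1)) (ι (a′ ℚ./ 1)))
      (trans (+-congʳ (proj₁ (ω-independent (ι (a ℚ./ 1) - ι (a′ ℚ./ 1)) (ι (m ℚ./ 1) - ι (m′ ℚ./ 1))
          (difference (abscissa n) ω₁-re ω₂-re p) (difference (ordinate n) ω₁-im ω₂-im q))))
        (solve 1 (λ y → con 0ℚ :+ y := y) (ι (a′ ℚ./ 1)))))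
    where
    difference : ∀ e u v → e + (ι (a ℚ./ 1) * u + ι (m ℚ./ 1) * v) ≈ e + (ι (a′ ℚ./ 1) * u + ι (m′ ℚ./ 1) * v) →
      (ι (a ℚ./ 1) - ι (a′ ℚ./ 1)) * u + (ι (m ℚ./ 1) - ι (m′ ℚ./ 1)) * v ≈ ι 0ℚ
    difference e u v p = trans
      (solve 7 (λ e u v a m a′ m′ → (a :- a′) :* u :+ (m :- m′) :* v := (e :+ (a :* u :+ m :* v)) :- (e :+ (a′ :* u :+ m′ :* v)))
        e u v (ι (a ℚ./ 1)) (ι (m ℚ./ 1)) (ι (a′ ℚ./ 1)) (ι (m′ ℚ./ 1)))
      (trans (+-congʳ p) (trans (-‿inverseʳ _) 0≈ι0))

  ∣ω₁∣²-lower : ι (½ ℚ.* (½ ℚ.* 1/suc n′)) ≤ square ω₁-re + square ω₁-im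
  ∣ω₁∣²-lower = ≤-resp (trans (sym (*-assoc (s * s) h h)) (trans (*-congʳ s²h) (sym (ι-* ½ (½ ℚ.* 1/suc n′))))) refl ∣ω₁∣²≥

  private
    large : ι (2500 /1) * ρ² ≤ N
    large = ≤-resp (trans (ι-* (2500 /1) (ρ ℚ.* ρ)) (*-congˡ (ι-* ρ ρ))) refl (ι-≤ (proj₁ precise))
    accurate : ι (2 /1) * (bound * bound) ≤ ι δ * ι δ * N
    accurate = ≤-resp
      (trans (ι-* (2 /1) ((7509 /1 ℚ.* (ρ ℚ.* ρ)) ℚ.* (7509 /1 ℚ.* (ρ ℚ.* ρ)))) (*-congˡ (trans (ι-* _ _) (*-cong ι-bound ι-bound))))
      (trans (ι-* (δ ℚ.* δ) (fromℕ n)) (*-congʳ (ι-* δ δ)))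
      (ι-≤ (proj₂ precise))
      where
      ι-bound : ι (7509 /1 ℚ.* (ρ ℚ.* ρ)) ≈ bound
      ι-bound = trans (ι-* (7509 /1) (ρ ℚ.* ρ)) (*-congˡ (ι-* ρ ρ))
    large′ : ι (2500 /1) * ρ² ≤ s * s
    large′ = ≤-resp refl (sym (root² n)) large
    0≤ρ² : NonNeg ρ²
    0≤ρ² = nonNeg-square (ι ρ)

  -- Both offsets are small, so by `separation` the integers differ by at most ½. This is why the
  -- pairing is a function of the spiral point.
  offset-unique : ∀ a m m′ → Admissible a m → Admissible a m′ → m ≡ m′
  offset-unique a m m′ (admissible _ p) (admissible _ q) = ≡.sym (integer-equal m′ m (separation (ι (m′ ℚ./ 1) - ι (m ℚ./ 1)) N*N⁻¹ 0≤N 0≤N⁻¹ large p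
    (≤-resp (*-congˡ (square-cong (solve 3 (λ t m m′ → t :+ m′ := (t :+ m) :+ (m′ :- m)) (θ * ι (a ℚ./ 1)) (ι (m ℚ./ 1)) (ι (m′ ℚ./ 1))))) refl q)))

  spiral-near : ∀ j → Within ρ² (abscissa j) (ordinate j) (abscissa n) (ordinate n) →
    ∃ λ m → Admissible (shift j) m
  spiral-near j h′ = m , admissible
    (≤-resp (square-cong (sym (κ≈ j))) (*-congˡ (root² n)) κ-bound)
    (≤-resp (*-congʳ (root² n)) refl (t-bound t (proj₂ (nearest (θ * ι (shift j ℚ./ 1)))) refl))
    where
    m : ℤ
    m = proj₁ (nearest (θ * ι (shift j ℚ./ 1)))
    t : Carrier
    t = offset (shift j) m
    open Spiral {root j} {angle j} {2π * t} (cos-angle j m) (sin-angle j m)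
    open NearSpiral 0≤s 0≤i i*s {root j} {γ} {σ} {ι ρ} {ι (proj₁ ρ⁻¹)}
      (root-nonNeg j) (nonNeg-ι ρ (ℚ.<⇒≤ 0<ρ)) (proj₂ (proj₂ ρ⁻¹)) (nonNeg-ι (proj₁ ρ⁻¹) (proj₁ (proj₂ ρ⁻¹)))
      (cos²+sin² (2π * t)) (∣cos∣≤1 (2π * t))
      (≤-trans (nonNeg-resp (solve 1 (λ p → # 2496 :* p := # 2500 :* p :- # 4 :* p) ρ²) (nonNeg-scale (2496 /1) 0≤ρ²)) large′)
      (≤-resp spiral-distance refl (squared≤ (within-cong (abscissa≈ j) (ordinate≈ j) (abscissa≈ n) (ordinate≈ n) h′)))

  -- The point is that n + a is a natural number: κ² ≤ 4ρ²n and 2500ρ² ≤ n give κ² ≤ n², hence a ≥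
  -- -n.
  lattice-near : ∀ a m → Within ρ² (lattice-re a m) (lattice-im a m) (abscissa n) (ordinate n) →
    ∃ λ j → shift j ≡ a × Admissible a m
  lattice-near a m h′ = ℤ.∣ b ∣ , shift≡ ,
    admissible (≤-resp refl (*-congˡ (root² n)) κ-bound) (≤-resp (*-congʳ (root² n)) refl t-bound)
    where
    b : ℤ
    b = ℤ.+ n ℤ.+ a
    open NearLattice 0≤s 0≤i i*s {ι (a ℚ./ 1)} {h} {offset a m} {ι ρ} s²h
      (≤-resp (lattice-distance (ι (a ℚ./ 1)) (ι (m ℚ./ 1))) refl
        (squared≤ (within-cong (+-congʳ (abscissa≈ n)) (+-congʳ (ordinate≈ n)) (abscissa≈ n) (ordinate≈ n) h′)))
    ∣a∣≤N : ∣ ι (a ℚ./ 1) ∣≤ N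
    ∣a∣≤N = square≤⇒∣∣≤ N N⁻¹ (trans N*N⁻¹ ι-1) 0≤N⁻¹ (≤-trans 4κ-bound (nonNeg-resp
      (trans (solve 2 (λ p n → n :* (n :- # 2500 :* p) :+ # 2496 :* (p :* n) := n :* n :- # 4 :* p :* n) ρ² N)
        (+-congˡ (-‿cong (*-congˡ (sym (root² n))))))
      (nonNeg-+ (nonNeg-* 0≤N large) (nonNeg-scale (2496 /1) (nonNeg-* 0≤ρ² 0≤N)))))
    0≤b : ℤ.+ 0 ℤ.≤ b
    0≤b = /1-nonNeg b (ι-reflects (b ℚ./ 1) (nonNeg-resp
      (sym (trans (ι-cong ([a+b]/1 (ℤ.+ n) a)) (ι-+ (ℤ.+ n ℚ./ 1) (a ℚ./ 1)))) (proj₂ ∣a∣≤N)))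
    shift≡ : shift ℤ.∣ b ∣ ≡ a
    shift≡ = ≡.trans (cong (ℤ._- ℤ.+ n) (ℤ.0≤i⇒+∣i∣≡i 0≤b))
      (ℤ.+-*-Solver.solve 2 (λ n a → (n ℤ.+-*-Solver.:+ a) ℤ.+-*-Solver.:- n ℤ.+-*-Solver.:= a) ≡.refl (ℤ.+ n) a)

  -- The linearisation bound with A = 9ρ² and Y = 2500ρ². As ny² ≤ 2500ρ² ≤ n, y lies in the range
  -- of the Taylor bounds; the factor s² cancels in the end.
  approximation : ∀ j m → Admissible (shift j) m →
    Within (ι δ * ι δ) (abscissa j) (ordinate j) (lattice-re (shift j) m) (lattice-im (shift j) m)
  approximation j m (admissible p q) = within-cong (sym (abscissa≈ j)) (sym (ordinate≈ j)) (+-congʳ (sym (abscissa≈ n)))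
      (+-congʳ (sym (ordinate≈ n))) (within (≤-resp (sym (approximation-error (ι (shift j ℚ./ 1)) (ι (m ℚ./ 1)) refl)) refl
    (cancel² 0≤s 0≤i i*s (nonNeg-resp
      (solve 3 (λ s a b → a :* (s :* s) :- (s :* s) :* b := (s :* s) :* (a :- b)) s (ι δ * ι δ) _)
      (≤-trans (≤-resp (*-congˡ (+-congʳ (square-cong (+-congˡ (-‿cong (+-congˡ (*-congˡ (*-congʳ (sym (κ≈ j)))))))))) refl (error-bound h s²h))
        (≤-resp (*-congˡ (square-cong (solve 1 (λ p → # 7509 :* p := # 9 :* p :+ # 3 :* (# 2500 :* p)) ρ²)))
            (*-congˡ (sym (root² n))) accurate))))))
    where
    t y : Carrier
    t = offset (shift j) m
    y = 2π * t
    y-small : (s * s) * (y * y) ≤ ι (2500 /1) * ρ²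
    y-small = ≤-resp (*-congʳ (sym (root² n))) refl (y-bound {N} {t} {ι ρ} 0≤N q)
    y²≤1 : y * y ≤ ι 1ℚ
    y²≤1 = cancel² 0≤s 0≤i i*s (nonNeg-resp (solve 2 (λ s y → s :* s :- (s :* s) :* (y :* y) := (s :* s) :* (con 1ℚ :- y :* y)) s y)
      (≤-trans y-small large′))
    open Spiral {root j} {angle j} {y} (cos-angle j m) (sin-angle j m)
    open Linearisation 0≤s 0≤i i*s {root j} {y} {γ} {σ} {ι (9 /1) * ρ²} {ι (2500 /1) * ρ²} (root-nonNeg j)
      (≤-resp (square-cong (κ≈ j)) (*-congˡ (sym (root² n))) p)
      y-small
      (≤-trans (nonNeg-resp (solve 1 (λ p → # 2491 :* p := # 2500 :* p :- # 9 :* p) ρ²) (nonNeg-scale (2491 /1) 0≤ρ²)) large′)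
      (cos-taylor y y²≤1) (sin-taylor y y²≤1)
      using (error-bound)

open import Relation.Binary.PropositionalEquality using (refl; sym; trans; isEquivalence; module ≡-Reasoning)

open Estimates using
  ( fromℕ-nonNeg; fromℕ-suc; 1/suc-nonNeg; 1/suc-antitone; 1/suc-inverse; abs-self; ≤abs; abs≤
  ; half+half; half-pos; *-mono; *-nonNeg; +-nonNeg; *-pos; scale )

-- Gaussian rationals, the values of complex approximations.

module GaussianRationals where

  open Data.Rational.Base using (_+_; _*_; _-_; -_; _≤_; _<_)
  open +-*-Solver using (solve; _:+_; _:*_; :-_; _:-_; _:=_; con)

  ℚ[i] : Set
  ℚ[i] = ℚ × ℚ

  infixl 6 _⊕_
  infixl 7 _⊗_

  _⊕_ _⊗_ : ℚ[i] → ℚ[i] → ℚ[i]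
  (a , b) ⊕ (c , d) = a + c , b + d
  (a , b) ⊗ (c , d) = a * c - b * d , a * d + b * c

  ⊖_ : ℚ[i] → ℚ[i]
  ⊖ (a , b) = - a , - b

  ring : CommutativeRing 0ℓ 0ℓ
  ring = record
    { Carrier = ℚ[i]
    ; _≈_ = _≡_
    ; _+_ = _⊕_
    ; _*_ = _⊗_
    ; -_ = ⊖_
    ; 0# = 0ℚ , 0ℚ
    ; 1# = 1ℚ , 0ℚ
    ; isCommutativeRing = record
      { isRing = record
        { +-isAbelianGroup = record
          { isGroup = record
            { isMonoid = record
              { isSemigroup = record
                { isMagma = record { isEquivalence = isEquivalence ; ∙-cong = cong₂ _⊕_ }
                ; assoc = λ (a , b) (c , d) (e , f) → cong₂ _,_ (ℚ.+-assoc a c e) (ℚ.+-assoc b d f) }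
              ; identity = (λ (a , b) → cong₂ _,_ (ℚ.+-identityˡ a) (ℚ.+-identityˡ b))
                         , (λ (a , b) → cong₂ _,_ (ℚ.+-identityʳ a) (ℚ.+-identityʳ b)) }
            ; inverse = (λ (a , b) → cong₂ _,_ (ℚ.+-inverseˡ a) (ℚ.+-inverseˡ b))
                      , (λ (a , b) → cong₂ _,_ (ℚ.+-inverseʳ a) (ℚ.+-inverseʳ b))
            ; ⁻¹-cong = cong ⊖_ }
          ; comm = λ (a , b) (c , d) → cong₂ _,_ (ℚ.+-comm a c) (ℚ.+-comm b d) }
        ; *-cong = cong₂ _⊗_
        ; *-assoc = λ (a , b) (c , d) (e , f) → cong₂ _,_
            (solve 6 (λ a b c d e f → (a :* c :- b :* d) :* e :- (a :* d :+ b :* c) :* f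
               := a :* (c :* e :- d :* f) :- b :* (c :* f :+ d :* e)) refl a b c d e f)
            (solve 6 (λ a b c d e f → (a :* c :- b :* d) :* f :+ (a :* d :+ b :* c) :* e
               := a :* (c :* f :+ d :* e) :+ b :* (c :* e :- d :* f)) refl a b c d e f)
        ; *-identity = (λ (a , b) → cong₂ _,_
            (solve 2 (λ a b → con 1ℚ :* a :- con 0ℚ :* b := a) refl a b)
            (solve 2 (λ a b → con 1ℚ :* b :+ con 0ℚ :* a := b) refl a b))
                     , (λ (a , b) → cong₂ _,_
            (solve 2 (λ a b → a :* con 1ℚ :- b :* con 0ℚ := a) refl a b)
            (solve 2 (λ a b → a :* con 0ℚ :+ b :* con 1ℚ := b) refl a b))
        ; distrib = (λ (a , b) (c , d) (e , f) → cong₂ _,_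
            (solve 6 (λ a b c d e f → a :* (c :+ e) :- b :* (d :+ f)
               := (a :* c :- b :* d) :+ (a :* e :- b :* f)) refl a b c d e f)
            (solve 6 (λ a b c d e f → a :* (d :+ f) :+ b :* (c :+ e)
               := (a :* d :+ b :* c) :+ (a :* f :+ b :* e)) refl a b c d e f))
                  , (λ (a , b) (c , d) (e , f) → cong₂ _,_
            (solve 6 (λ a b c d e f → (c :+ e) :* a :- (d :+ f) :* b
               := (c :* a :- d :* b) :+ (e :* a :- f :* b)) refl a b c d e f)
            (solve 6 (λ a b c d e f → (c :+ e) :* b :+ (d :+ f) :* a
               := (c :* b :+ d :* a) :+ (e :* b :+ f :* a)) refl a b c d e f)) }
      ; *-comm = λ (a , b) (c , d) → cong₂ _,_
          (solve 4 (λ a b c d → a :* c :- b :* d := c :* a :- d :* b) refl a b c d)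
          (solve 4 (λ a b c d → a :* d :+ b :* c := c :* b :+ d :* a) refl a b c d) } }

  -- The sum norm stays rational, unlike the Euclidean one, and is still submultiplicative.
  ‖_‖ : ℚ[i] → ℚ
  ‖ a , b ‖ = ℚ.∣ a ∣ + ℚ.∣ b ∣

  ‖‖-nonNeg : ∀ g → 0ℚ ≤ ‖ g ‖
  ‖‖-nonNeg (a , b) = Estimates.+-nonNeg {ℚ.∣ a ∣} {ℚ.∣ b ∣} (ℚ.0≤∣p∣ a) (ℚ.0≤∣p∣ b)

  open ℚ.≤-Reasoning

  ‖‖-⊕ : ∀ g h → ‖ g ⊕ h ‖ ≤ ‖ g ‖ + ‖ h ‖
  ‖‖-⊕ (a , b) (c , d) = begin
    ℚ.∣ a + c ∣ + ℚ.∣ b + d ∣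
      ≤⟨ ℚ.+-mono-≤ {ℚ.∣ a + c ∣} {_} {ℚ.∣ b + d ∣} (ℚ.∣p+q∣≤∣p∣+∣q∣ a c) (ℚ.∣p+q∣≤∣p∣+∣q∣ b d) ⟩
    (ℚ.∣ a ∣ + ℚ.∣ c ∣) + (ℚ.∣ b ∣ + ℚ.∣ d ∣)
      ≡⟨ solve 4 (λ a b c d → (a :+ c) :+ (b :+ d) := (a :+ b) :+ (c :+ d)) refl ℚ.∣ a ∣ ℚ.∣ b ∣ ℚ.∣ c ∣ ℚ.∣ d ∣ ⟩
    (ℚ.∣ a ∣ + ℚ.∣ b ∣) + (ℚ.∣ c ∣ + ℚ.∣ d ∣) ∎

  ‖‖-⊗ : ∀ g h → ‖ g ⊗ h ‖ ≤ ‖ g ‖ * ‖ h ‖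
  ‖‖-⊗ (a , b) (c , d) = begin
    ℚ.∣ a * c - b * d ∣ + ℚ.∣ a * d + b * c ∣
      ≤⟨ ℚ.+-mono-≤ {ℚ.∣ a * c - b * d ∣} {_} {ℚ.∣ a * d + b * c ∣}
           (ℚ.∣p-q∣≤∣p∣+∣q∣ (a * c) (b * d)) (ℚ.∣p+q∣≤∣p∣+∣q∣ (a * d) (b * c)) ⟩
    (ℚ.∣ a * c ∣ + ℚ.∣ b * d ∣) + (ℚ.∣ a * d ∣ + ℚ.∣ b * c ∣)
      ≡⟨ cong₂ _+_ (cong₂ _+_ (ℚ.∣p*q∣≡∣p∣*∣q∣ a c) (ℚ.∣p*q∣≡∣p∣*∣q∣ b d))
                     (cong₂ _+_ (ℚ.∣p*q∣≡∣p∣*∣q∣ a d) (ℚ.∣p*q∣≡∣p∣*∣q∣ b c)) ⟩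
    (ℚ.∣ a ∣ * ℚ.∣ c ∣ + ℚ.∣ b ∣ * ℚ.∣ d ∣) + (ℚ.∣ a ∣ * ℚ.∣ d ∣ + ℚ.∣ b ∣ * ℚ.∣ c ∣)
      ≡⟨ solve 4 (λ a b c d → (a :* c :+ b :* d) :+ (a :* d :+ b :* c) := (a :+ b) :* (c :+ d)) refl ℚ.∣ a ∣ ℚ.∣ b ∣ ℚ.∣ c ∣ ℚ.∣ d ∣ ⟩
    (ℚ.∣ a ∣ + ℚ.∣ b ∣) * (ℚ.∣ c ∣ + ℚ.∣ d ∣) ∎

-- The exponential series and Cauchy products.

module ExponentialSeries where

  open Data.Rational.Base using (_+_; _*_; _-_; -_; _≤_; _<_)
  open GaussianRationals
  open CommutativeRing ring using (commutativeSemiring)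
  open NaturalSolver commutativeSemiring using (solve; _:+_; _:*_; _:=_; con)
  open CommutativeRing ring using (0#; 1#; zeroˡ; zeroʳ; +-identityˡ; +-identityʳ; *-identityˡ; *-assoc; *-comm)

  convolve : ℕ → (ℕ → ℚ[i]) → (ℕ → ℚ[i]) → ℚ[i]
  convolve zero    a b = a 0 ⊗ b 0
  convolve (suc n) a b = a 0 ⊗ b (suc n) ⊕ convolve n (a ∘ suc) b

  convolve-last : ∀ n a b → convolve (suc n) a b ≡ convolve n a (b ∘ suc) ⊕ a (suc n) ⊗ b 0
  convolve-last zero    a b = refl
  convolve-last (suc n) a b = trans (cong (a 0 ⊗ b (suc (suc n)) ⊕_) (convolve-last n (a ∘ suc) b))
    (solve 3 (λ x y z → x :+ (y :+ z) := (x :+ y) :+ z) refl (a 0 ⊗ b (suc (suc n)))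
      (convolve n (a ∘ suc) (b ∘ suc)) (a (suc (suc n)) ⊗ b 0))

  convolve-cong : ∀ n {a a′ b b′} → (∀ i → a i ≡ a′ i) → (∀ i → b i ≡ b′ i) → convolve n a b ≡ convolve n a′ b′
  convolve-cong zero    p q = cong₂ _⊗_ (p 0) (q 0)
  convolve-cong (suc n) p q = cong₂ _⊕_ (cong₂ _⊗_ (p 0) (q (suc n))) (convolve-cong n (p ∘ suc) q)

  convolve-scaleˡ : ∀ n c a b → convolve n (λ i → c ⊗ a i) b ≡ c ⊗ convolve n a b
  convolve-scaleˡ zero    c a b = *-assoc c (a 0) (b 0)
  convolve-scaleˡ (suc n) c a b = trans (cong (c ⊗ a 0 ⊗ b (suc n) ⊕_) (convolve-scaleˡ n c (a ∘ suc) b))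
    (solve 4 (λ c x y z → c :* x :* y :+ c :* z := c :* (x :* y :+ z)) refl c (a 0) (b (suc n)) (convolve n (a ∘ suc) b))

  convolve-scaleʳ : ∀ n c a b → convolve n a (λ i → c ⊗ b i) ≡ c ⊗ convolve n a b
  convolve-scaleʳ zero    c a b = solve 3 (λ c x y → x :* (c :* y) := c :* (x :* y)) refl c (a 0) (b 0)
  convolve-scaleʳ (suc n) c a b = trans (cong (a 0 ⊗ (c ⊗ b (suc n)) ⊕_) (convolve-scaleʳ n c (a ∘ suc) b))
    (solve 4 (λ c x y z → x :* (c :* y) :+ c :* z := c :* (x :* y :+ z)) refl c (a 0) (b (suc n)) (convolve n (a ∘ suc) b))

  ν : ℕ → ℚ[i]
  ν n = Estimates.fromℕ n , 0ℚ

  ν-suc : ∀ n → ν (suc n) ≡ 1# ⊕ ν n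
  ν-suc n = cong (_, 0ℚ) (trans (Estimates.fromℕ-suc n) (ℚ.+-comm (Estimates.fromℕ n) 1ℚ))

  -- The product rule for the derivation which multiplies the i-th term by i (or i + α);
  -- it turns i tᵢ = z tᵢ₋₁ into the recurrence that identifies the Cauchy product.
  convolve-weight : ∀ n α a b →
    convolve n (λ i → (ν i ⊕ α) ⊗ a i) b ⊕ convolve n a (λ i → ν i ⊗ b i) ≡ (ν n ⊕ α) ⊗ convolve n a b
  convolve-weight zero    α a b =
    solve 4 (λ ν α x y → (ν :+ α) :* x :* y :+ x :* (ν :* y) := (ν :+ ν :+ α) :* (x :* y)) refl (ν 0) α (a 0) (b 0)
  convolve-weight (suc n) α a b = begin
    ((ν 0 ⊕ α) ⊗ a 0 ⊗ b (suc n) ⊕ convolve n (λ i → (ν (suc i) ⊕ α) ⊗ a (suc i)) b)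
      ⊕ (a 0 ⊗ (ν (suc n) ⊗ b (suc n)) ⊕ convolve n (a ∘ suc) (λ i → ν i ⊗ b i))
      ≡⟨ cong (λ t → ((ν 0 ⊕ α) ⊗ a 0 ⊗ b (suc n) ⊕ t)
           ⊕ (a 0 ⊗ (ν (suc n) ⊗ b (suc n)) ⊕ convolve n (a ∘ suc) (λ i → ν i ⊗ b i)))
           (convolve-cong n (λ i → cong (_⊗ a (suc i)) (shift i)) (λ _ → refl)) ⟩
    ((ν 0 ⊕ α) ⊗ a 0 ⊗ b (suc n) ⊕ convolve n (λ i → (ν i ⊕ (1# ⊕ α)) ⊗ a (suc i)) b)
      ⊕ (a 0 ⊗ (ν (suc n) ⊗ b (suc n)) ⊕ convolve n (a ∘ suc) (λ i → ν i ⊗ b i))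
      ≡⟨ solve 7 (λ z α x y m u v → ((z :+ α) :* x :* y :+ u) :+ (x :* (m :* y) :+ v)
           := (z :+ α :+ m) :* (x :* y) :+ (u :+ v)) refl (ν 0) α (a 0) (b (suc n)) (ν (suc n))
           (convolve n (λ i → (ν i ⊕ (1# ⊕ α)) ⊗ a (suc i)) b) (convolve n (a ∘ suc) (λ i → ν i ⊗ b i)) ⟩
    (ν 0 ⊕ α ⊕ ν (suc n)) ⊗ (a 0 ⊗ b (suc n))
      ⊕ (convolve n (λ i → (ν i ⊕ (1# ⊕ α)) ⊗ a (suc i)) b ⊕ convolve n (a ∘ suc) (λ i → ν i ⊗ b i))
      ≡⟨ cong₂ (λ s t → s ⊗ (a 0 ⊗ b (suc n)) ⊕ t)
           (trans (cong (_⊕ ν (suc n)) (+-identityˡ α)) (CommutativeRing.+-comm ring α (ν (suc n))))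
           (trans (convolve-weight n (1# ⊕ α) (a ∘ suc) b) (cong (_⊗ convolve n (a ∘ suc) b) (sym (shift n)))) ⟩
    (ν (suc n) ⊕ α) ⊗ (a 0 ⊗ b (suc n)) ⊕ (ν (suc n) ⊕ α) ⊗ convolve n (a ∘ suc) b
      ≡⟨ sym (CommutativeRing.distribˡ ring (ν (suc n) ⊕ α) _ _) ⟩
    (ν (suc n) ⊕ α) ⊗ convolve (suc n) a b ∎
    where
    open ≡-Reasoning
    shift : ∀ i → ν (suc i) ⊕ α ≡ ν i ⊕ (1# ⊕ α)
    shift i = trans (cong (_⊕ α) (ν-suc i))
      (solve 3 (λ o m α → (o :+ m) :+ α := m :+ (o :+ α)) refl 1# (ν i) α)

  term : ℚ[i] → ℕ → ℚ[i]
  term z zero    = 1ℚ , 0ℚ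
  term z (suc n) = 1/suc n * proj₁ (z ⊗ term z n) , 1/suc n * proj₂ (z ⊗ term z n)

  ν-term : ∀ z n → ν (suc n) ⊗ term z (suc n) ≡ z ⊗ term z n
  ν-term z n = cong₂ _,_
    (trans (ℚsolve 3 (λ m a b → m ℚ:* a ℚ:- ℚcon 0ℚ ℚ:* b ℚ:= m ℚ:* a)
        refl (fromℕ (suc n)) (1/suc n * proj₁ (z ⊗ term z n)) (1/suc n * proj₂ (z ⊗ term z n)))
      (cancel (proj₁ (z ⊗ term z n))))
    (trans (ℚsolve 3 (λ m a b → m ℚ:* a ℚ:+ ℚcon 0ℚ ℚ:* b ℚ:= m ℚ:* a)
        refl (fromℕ (suc n)) (1/suc n * proj₂ (z ⊗ term z n)) (1/suc n * proj₁ (z ⊗ term z n)))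
      (cancel (proj₂ (z ⊗ term z n))))
    where
    open +-*-Solver renaming (solve to ℚsolve; _:+_ to _ℚ:+_; _:*_ to _ℚ:*_; _:-_ to _ℚ:-_; _:=_ to _ℚ:=_; con to ℚcon)
    cancel : ∀ a → fromℕ (suc n) * (1/suc n * a) ≡ a
    cancel a = trans (sym (ℚ.*-assoc (fromℕ (suc n)) (1/suc n) a))
      (trans (cong (_* a) (Estimates.1/suc-inverse n)) (ℚ.*-identityˡ a))

  ν-cancel : ∀ n {g h} → ν (suc n) ⊗ g ≡ ν (suc n) ⊗ h → g ≡ h
  ν-cancel n {g} {h} e = trans (sym (inv g)) (trans (cong (i ⊗_) e) (inv h))
    where
    i : ℚ[i]
    i = Estimates.1/suc n , 0ℚ
    i⊗ν : i ⊗ ν (suc n) ≡ 1#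
    i⊗ν = cong₂ _,_
      (trans (cong₂ _-_ (trans (ℚ.*-comm (Estimates.1/suc n) (Estimates.fromℕ (suc n))) (Estimates.1/suc-inverse n)) (ℚ.*-zeroˡ 0ℚ)) refl)
      (trans (cong₂ _+_ (ℚ.*-zeroʳ (Estimates.1/suc n)) (ℚ.*-zeroˡ (Estimates.fromℕ (suc n)))) refl)
    inv : ∀ g → i ⊗ (ν (suc n) ⊗ g) ≡ g
    inv g = trans (sym (*-assoc i (ν (suc n)) g)) (trans (cong (_⊗ g) i⊗ν) (*-identityˡ g))

  -- The binomial theorem for zⁱ/i!, without binomial coefficients: both sides satisfy (n+1)c' =
  -- (z+w)c, where c and c' are consecutive coefficients.
  convolve-term : ∀ z w n → convolve n (term z) (term w) ≡ term (z ⊕ w) n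
  convolve-term z w zero    = refl
  convolve-term z w (suc n) = ν-cancel n (begin
    ν (suc n) ⊗ convolve (suc n) t u
      ≡⟨ cong (_⊗ convolve (suc n) t u) (sym (+-identityʳ (ν (suc n)))) ⟩
    (ν (suc n) ⊕ 0#) ⊗ convolve (suc n) t u
      ≡⟨ sym (convolve-weight (suc n) 0# t u) ⟩
    convolve (suc n) (λ i → (ν i ⊕ 0#) ⊗ t i) u ⊕ convolve (suc n) t (λ i → ν i ⊗ u i)
      ≡⟨ cong₂ _⊕_ left right ⟩
    z ⊗ convolve n t u ⊕ w ⊗ convolve n t u
      ≡⟨ solve 3 (λ z w c → z :* c :+ w :* c := (z :+ w) :* c) refl z w (convolve n t u) ⟩
    (z ⊕ w) ⊗ convolve n t u
      ≡⟨ cong ((z ⊕ w) ⊗_) (convolve-term z w n) ⟩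
    (z ⊕ w) ⊗ term (z ⊕ w) n
      ≡⟨ sym (ν-term (z ⊕ w) n) ⟩
    ν (suc n) ⊗ term (z ⊕ w) (suc n) ∎)
    where
    open ≡-Reasoning
    t u : ℕ → ℚ[i]
    t = term z
    u = term w
    vanish : ∀ x y → x ≡ 0# → x ⊗ y ≡ 0#
    vanish x y e = trans (cong (_⊗ y) e) (zeroˡ y)
    left : convolve (suc n) (λ i → (ν i ⊕ 0#) ⊗ t i) u ≡ z ⊗ convolve n t u
    left = trans (cong₂ _⊕_ (vanish ((ν 0 ⊕ 0#) ⊗ t 0) (u (suc n)) refl)
        (trans (convolve-cong n (λ i → trans (cong (_⊗ t (suc i)) (+-identityʳ (ν (suc i)))) (ν-term z i)) (λ _ → refl))
          (convolve-scaleˡ n z t u)))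
      (+-identityˡ (z ⊗ convolve n t u))
    right : convolve (suc n) t (λ i → ν i ⊗ u i) ≡ w ⊗ convolve n t u
    right = trans (convolve-last n t (λ i → ν i ⊗ u i))
      (trans (cong₂ _⊕_
          (trans (convolve-cong n (λ _ → refl) (ν-term w)) (convolve-scaleʳ n w t u))
          (trans (cong (t (suc n) ⊗_) (refl {x = 0#})) (zeroʳ (t (suc n)))))
        (+-identityʳ (w ⊗ convolve n t u)))

  sum : ℕ → (ℕ → ℚ[i]) → ℚ[i]
  sum zero    a = 0ℚ , 0ℚ
  sum (suc n) a = sum n a ⊕ a n

  sum-first : ∀ n a → sum (suc n) a ≡ a 0 ⊕ sum n (a ∘ suc)
  sum-first zero    a = trans (+-identityˡ (a 0)) (sym (+-identityʳ (a 0)))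
  sum-first (suc n) a = trans (cong (_⊕ a (suc n)) (sum-first n a))
    (solve 3 (λ x y z → (x :+ y) :+ z := x :+ (y :+ z)) refl (a 0) (sum n (a ∘ suc)) (a (suc n)))

  -- The sum of a i ⊗ b j over i + j < n.
  triangle : ℕ → (ℕ → ℚ[i]) → (ℕ → ℚ[i]) → ℚ[i]
  triangle zero    a b = 0ℚ , 0ℚ
  triangle (suc n) a b = a 0 ⊗ sum (suc n) b ⊕ triangle n (a ∘ suc) b

  triangle-suc : ∀ n a b → triangle (suc n) a b ≡ triangle n a b ⊕ convolve n a b
  triangle-suc zero    a b = trans (+-identityʳ (a 0 ⊗ sum 1 b)) (trans (cong (a 0 ⊗_) (+-identityˡ (b 0))) (sym (+-identityˡ (a 0 ⊗ b 0))))
  triangle-suc (suc n) a b = trans (cong (a 0 ⊗ (sum (suc n) b ⊕ b (suc n)) ⊕_) (triangle-suc n (a ∘ suc) b))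
    (solve 5 (λ x s y t c → x :* (s :+ y) :+ (t :+ c) := (x :* s :+ t) :+ (x :* y :+ c)) refl
      (a 0) (sum (suc n) b) (b (suc n)) (triangle n (a ∘ suc) b) (convolve n (a ∘ suc) b))

  -- An exact identity, so that the product of two partial sums misses the partial sum of z + w only
  -- by the terms above the diagonal.
  triangle-term : ∀ z w n → triangle n (term z) (term w) ≡ sum n (term (z ⊕ w))
  triangle-term z w zero    = refl
  triangle-term z w (suc n) = trans (triangle-suc n (term z) (term w)) (cong₂ _⊕_ (triangle-term z w n) (convolve-term z w n))

-- Estimates for the exponential series.

module SeriesBounds where

  open Data.Rational.Base using (_+_; _*_; _-_; -_; _≤_; _<_)
  open GaussianRationals
  open ExponentialSeries
  open CauchyProperties using (majorant; majorant-nonNeg; majorant-halves)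
  open +-*-Solver using (solve; _:+_; _:*_; :-_; _:-_; _:=_; con)
  open CommutativeRing ring using () renaming (+-comm to ⊕-comm; +-assoc to ⊕-assoc)
  open ℚ.≤-Reasoning

  ¼ : ℚ
  ¼ = ½ * ½

  ¼^ : ℕ → ℚ
  ¼^ zero    = 1ℚ
  ¼^ (suc n) = ¼ * ¼^ n

  ¼^-nonNeg : ∀ n → 0ℚ ≤ ¼^ n
  ¼^-nonNeg zero    = ℚ.nonNegative⁻¹ 1ℚ
  ¼^-nonNeg (suc n) = *-nonNeg {¼} {¼^ n} (ℚ.nonNegative⁻¹ ¼) (¼^-nonNeg n)

  -- By induction from (n + 2)² ≤ (2(n + 1))², the ratio ¼ compensating the factor 4.
  [1+n]²¼^n≤1 : ∀ n → fromℕ (suc n) * fromℕ (suc n) * ¼^ n ≤ 1ℚ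
  [1+n]²¼^n≤1 zero    = ℚ.≤-refl
  [1+n]²¼^n≤1 (suc n) = step (fromℕ n) (fromℕ (suc n)) (fromℕ (suc (suc n))) (¼^ n)
    (fromℕ-nonNeg n) (fromℕ-suc n) (fromℕ-suc (suc n)) (¼^-nonNeg n) ([1+n]²¼^n≤1 n)
    where
    step : ∀ a b c g → 0ℚ ≤ a → b ≡ a + 1ℚ → c ≡ b + 1ℚ → 0ℚ ≤ g → b * b * g ≤ 1ℚ →
      c * c * (¼ * g) ≤ 1ℚ
    step a _ _ g 0≤a refl refl 0≤g h = begin
      (a + 1ℚ + 1ℚ) * (a + 1ℚ + 1ℚ) * (¼ * g)
        ≤⟨ ℚ.*-monoʳ-≤-nonNeg (¼ * g) {{ℚ.nonNegative (*-nonNeg {¼} {g} (ℚ.nonNegative⁻¹ ¼) 0≤g)}}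
             (*-mono {d} {e} {d} {e} 0≤e d≤e 0≤d d≤e) ⟩
      e * e * (¼ * g)
        ≡⟨ solve 2 (λ a g → (a :+ con 1ℚ :+ (a :+ con 1ℚ)) :* (a :+ con 1ℚ :+ (a :+ con 1ℚ)) :* (con ¼ :* g)
             := (a :+ con 1ℚ) :* (a :+ con 1ℚ) :* g) refl a g ⟩
      (a + 1ℚ) * (a + 1ℚ) * g ≤⟨ h ⟩
      1ℚ ∎
      where
      d e : ℚ
      d = a + 1ℚ + 1ℚ
      e = a + 1ℚ + (a + 1ℚ)
      0≤a+1 : 0ℚ ≤ a + 1ℚ
      0≤a+1 = +-nonNeg {a} {1ℚ} 0≤a (ℚ.nonNegative⁻¹ 1ℚ)
      0≤d : 0ℚ ≤ d
      0≤d = +-nonNeg {a + 1ℚ} {1ℚ} 0≤a+1 (ℚ.nonNegative⁻¹ 1ℚ)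
      0≤e : 0ℚ ≤ e
      0≤e = +-nonNeg {a + 1ℚ} {a + 1ℚ} 0≤a+1 0≤a+1
      d≤e : d ≤ e
      d≤e = ℚ.+-monoʳ-≤ (a + 1ℚ) (subst (_≤ a + 1ℚ) (ℚ.+-identityˡ 1ℚ) (ℚ.+-monoˡ-≤ 1ℚ 0≤a))

  n¼^n≤ : ∀ n → fromℕ n * ¼^ n ≤ 1/suc n
  n¼^n≤ n = begin
    fromℕ n * ¼^ n
      ≤⟨ ℚ.*-monoʳ-≤-nonNeg (¼^ n) {{ℚ.nonNegative (¼^-nonNeg n)}} n≤1+n ⟩
    fromℕ (suc n) * ¼^ n
      ≡⟨ sym (ℚ.*-identityʳ _) ⟩
    fromℕ (suc n) * ¼^ n * 1ℚ
      ≡⟨ cong (fromℕ (suc n) * ¼^ n *_) (sym (1/suc-inverse n)) ⟩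
    fromℕ (suc n) * ¼^ n * (fromℕ (suc n) * 1/suc n)
      ≡⟨ solve 3 (λ a g i → a :* g :* (a :* i) := a :* a :* g :* i) refl (fromℕ (suc n)) (¼^ n) (1/suc n) ⟩
    fromℕ (suc n) * fromℕ (suc n) * ¼^ n * 1/suc n
      ≤⟨ ℚ.*-monoʳ-≤-nonNeg (1/suc n) {{ℚ.nonNegative (1/suc-nonNeg n)}} ([1+n]²¼^n≤1 n) ⟩
    1ℚ * 1/suc n
      ≡⟨ ℚ.*-identityˡ (1/suc n) ⟩
    1/suc n ∎
    where
    n≤1+n : fromℕ n ≤ fromℕ (suc n)
    n≤1+n = subst (fromℕ n ≤_) (sym (fromℕ-suc n))
      (subst (_≤ fromℕ n + 1ℚ) (ℚ.+-identityʳ (fromℕ n)) (ℚ.+-monoʳ-≤ (fromℕ n) (ℚ.nonNegative⁻¹ 1ℚ)))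

  majorant-bounded : ∀ {M} → 0ℚ ≤ M → ∃ λ A → 0ℚ ≤ A × (∀ i → majorant M i ≤ A)
  majorant-bounded {M} 0≤M =
    let J , halves = majorant-halves 0≤M
        A , f      = initial J
    in A , ℚ.≤-trans (majorant-nonNeg 0≤M 0) (f 0 ℕ.z≤n) , bound J halves A f
    where
    initial : ∀ J → ∃ λ A → ∀ i → i ℕ.≤ J → majorant M i ≤ A
    initial zero    = majorant M 0 , λ { zero ℕ.z≤n → ℚ.≤-refl }
    initial (suc J) = let A , f = initial J in A ℚ.⊔ majorant M (suc J) , λ i h → extend A f i (ℕ.m≤n⇒m<n∨m≡n h)
      where
      extend : ∀ A → (∀ i → i ℕ.≤ J → majorant M i ≤ A) → ∀ i → i ℕ.< suc J ⊎ i ≡ suc J →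
        majorant M i ≤ A ℚ.⊔ majorant M (suc J)
      extend A f i (inj₁ (ℕ.s≤s h)) = ℚ.≤-trans (f i h) (ℚ.p≤p⊔q A (majorant M (suc J)))
      extend A f i (inj₂ refl)      = ℚ.p≤q⊔p A (majorant M (suc J))
    descend : ∀ J → (∀ n → J ℕ.≤ n → majorant M (suc n) + majorant M (suc n) ≤ majorant M n) →
      ∀ d → majorant M (d ℕ.+ J) ≤ majorant M J
    descend J halves zero    = ℚ.≤-refl
    descend J halves (suc d) = ℚ.≤-trans
      (drop (majorant M (suc (d ℕ.+ J))) (majorant M (d ℕ.+ J)) (majorant-nonNeg 0≤M (suc (d ℕ.+ J)))
        (halves (d ℕ.+ J) (ℕ.m≤n+m J d)))
      (descend J halves d)
      where
      drop : ∀ r s → 0ℚ ≤ r → r + r ≤ s → r ≤ s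
      drop r s 0≤r h = ℚ.≤-trans (subst (_≤ r + r) (ℚ.+-identityʳ r) (ℚ.+-monoʳ-≤ r 0≤r)) h
    bound : ∀ J → (∀ n → J ℕ.≤ n → majorant M (suc n) + majorant M (suc n) ≤ majorant M n) →
      ∀ A → (∀ i → i ℕ.≤ J → majorant M i ≤ A) → ∀ i → majorant M i ≤ A
    bound J halves A f i with ℕ.≤-total i J
    ... | inj₁ i≤J = f i i≤J
    ... | inj₂ J≤i = subst (λ i → majorant M i ≤ A) (ℕ.m∸n+n≡m J≤i)
      (ℚ.≤-trans (descend J halves (i ℕ.∸ J)) (f J ℕ.≤-refl))

  ‖‖-scale : ∀ c g → 0ℚ ≤ c → ‖ c * proj₁ g , c * proj₂ g ‖ ≡ c * ‖ g ‖
  ‖‖-scale c (a , b) 0≤c = trans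
    (cong₂ _+_ (trans (ℚ.∣p*q∣≡∣p∣*∣q∣ c a) (cong (_* ℚ.∣ a ∣) (ℚ.0≤p⇒∣p∣≡p 0≤c)))
                 (trans (ℚ.∣p*q∣≡∣p∣*∣q∣ c b) (cong (_* ℚ.∣ b ∣) (ℚ.0≤p⇒∣p∣≡p 0≤c))))
    (sym (ℚ.*-distribˡ-+ c ℚ.∣ a ∣ ℚ.∣ b ∣))

  ‖term-suc‖ : ∀ z n → ‖ term z (suc n) ‖ ≤ 1/suc n * (‖ z ‖ * ‖ term z n ‖)
  ‖term-suc‖ z n = begin
    ‖ term z (suc n) ‖ ≡⟨ ‖‖-scale (1/suc n) (z ⊗ term z n) (1/suc-nonNeg n) ⟩
    1/suc n * ‖ z ⊗ term z n ‖ ≤⟨ ℚ.*-monoˡ-≤-nonNeg (1/suc n) {{ℚ.nonNegative (1/suc-nonNeg n)}} (‖‖-⊗ z (term z n)) ⟩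
    1/suc n * (‖ z ‖ * ‖ term z n ‖) ∎

  -- `majorant (M + M) n` is (4M)ⁿ/n!. Doubling the argument of the majorant buys the geometric
  -- factor, and the majorant itself is bounded.
  term-decay : ∀ {M} → 0ℚ ≤ M → ∀ z → ‖ z ‖ ≤ M → ∀ n → ‖ term z n ‖ ≤ majorant (M + M) n * ¼^ n
  term-decay 0≤M z z≤M zero = ℚ.≤-refl
  term-decay {M} 0≤M z z≤M (suc n) = begin
    ‖ term z (suc n) ‖ ≤⟨ ‖term-suc‖ z n ⟩
    1/suc n * (‖ z ‖ * ‖ term z n ‖)
      ≤⟨ ℚ.*-monoˡ-≤-nonNeg (1/suc n) {{ℚ.nonNegative (1/suc-nonNeg n)}}
           (*-mono {‖ z ‖} {M} {‖ term z n ‖} {majorant (M + M) n * ¼^ n} 0≤M z≤M (‖‖-nonNeg (term z n)) (term-decay 0≤M z z≤M n)) ⟩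
    1/suc n * (M * (majorant (M + M) n * ¼^ n))
      ≡⟨ solve 4 (λ i M r g → i :* (M :* (r :* g)) := i :* ((M :+ M) :* r :+ (M :+ M) :* r) :* (con ¼ :* g)) refl
           (1/suc n) M (majorant (M + M) n) (¼^ n) ⟩
    majorant (M + M) (suc n) * ¼^ (suc n) ∎

  infixl 6 _⊝_
  _⊝_ : ℚ[i] → ℚ[i] → ℚ[i]
  g ⊝ h = g ⊕ ⊖ h

  ⊝-self : ∀ g → g ⊝ g ≡ (0ℚ , 0ℚ)
  ⊝-self = CommutativeRing.-‿inverseʳ ring

  sum-tail : ∀ {B} b → (∀ i → ‖ b i ‖ ≤ B * ¼^ i) → 0ℚ ≤ B → ∀ n d →
    ‖ sum (d ℕ.+ n) b ⊝ sum n b ‖ ≤ (B + B) * ¼^ n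
  sum-tail {B} b b≤ 0≤B n d = ℚ.≤-trans
    (drop ‖ sum (d ℕ.+ n) b ⊝ sum n b ‖ (*-nonNeg {B + B} {¼^ (d ℕ.+ n)} (+-nonNeg {B} {B} 0≤B 0≤B) (¼^-nonNeg (d ℕ.+ n))))
    (go d)
    where
    drop : ∀ a {c} → 0ℚ ≤ c → a ≤ a + c
    drop a {c} 0≤c = subst (_≤ a + c) (ℚ.+-identityʳ a) (ℚ.+-monoʳ-≤ a 0≤c)
    -- The claim is strengthened by the allowance for terms not yet added; each step spends B¼^m of
    -- it and shrinks it to a quarter.
    go : ∀ d → ‖ sum (d ℕ.+ n) b ⊝ sum n b ‖ + (B + B) * ¼^ (d ℕ.+ n) ≤ (B + B) * ¼^ n
    go zero = ℚ.≤-reflexive (trans (cong (λ g → ‖ g ‖ + (B + B) * ¼^ n) (⊝-self (sum n b))) (ℚ.+-identityˡ _))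
    go (suc d) = begin
      ‖ sum m b ⊕ b m ⊝ sum n b ‖ + (B + B) * (¼ * ¼^ m)
        ≡⟨ cong (λ g → ‖ g ‖ + (B + B) * (¼ * ¼^ m)) (trans (⊕-assoc (sum m b) (b m) (⊖ sum n b))
             (trans (cong (sum m b ⊕_) (⊕-comm (b m) (⊖ sum n b))) (sym (⊕-assoc (sum m b) (⊖ sum n b) (b m))))) ⟩
      ‖ (sum m b ⊝ sum n b) ⊕ b m ‖ + (B + B) * (¼ * ¼^ m)
        ≤⟨ ℚ.+-monoˡ-≤ ((B + B) * (¼ * ¼^ m)) (ℚ.≤-trans (‖‖-⊕ (sum m b ⊝ sum n b) (b m))
             (ℚ.+-monoʳ-≤ ‖ sum m b ⊝ sum n b ‖ (b≤ m))) ⟩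
      ‖ sum m b ⊝ sum n b ‖ + B * ¼^ m + (B + B) * (¼ * ¼^ m)
        ≤⟨ drop _ (*-nonNeg {½ * B} {¼^ m} (*-nonNeg {½} {B} (ℚ.nonNegative⁻¹ ½) 0≤B) (¼^-nonNeg m)) ⟩
      ‖ sum m b ⊝ sum n b ‖ + B * ¼^ m + (B + B) * (¼ * ¼^ m) + ½ * B * ¼^ m
        ≡⟨ solve 3 (λ s B g → s :+ B :* g :+ (B :+ B) :* (con ¼ :* g) :+ con ½ :* B :* g := s :+ (B :+ B) :* g) refl
             ‖ sum m b ⊝ sum n b ‖ B (¼^ m) ⟩
      ‖ sum m b ⊝ sum n b ‖ + (B + B) * ¼^ m
        ≤⟨ go d ⟩
      (B + B) * ¼^ n ∎
      where
      m : ℕ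
      m = d ℕ.+ n

  -- Outside the triangle, row i of the square is aᵢ times a tail of b starting at n - i, of norm at
  -- most A¼^i · 2B¼^(n-i). Each of the n rows thus costs 2AB¼^n. The number `d` of surplus terms of
  -- b grows as rows are removed.
  product-defect : ∀ {A B} a b → 0ℚ ≤ A → 0ℚ ≤ B →
    (∀ i → ‖ a i ‖ ≤ A * ¼^ i) → (∀ i → ‖ b i ‖ ≤ B * ¼^ i) → ∀ n d →
    ‖ sum n a ⊗ sum (d ℕ.+ n) b ⊝ triangle n a b ‖ ≤ (A * (B + B)) * (fromℕ n * ¼^ n)
  product-defect {A} {B} a b 0≤A 0≤B a≤ b≤ zero d = ℚ.≤-reflexive (trans
    (cong ‖_‖ (trans (cong (_⊝ (0ℚ , 0ℚ)) (CommutativeRing.zeroˡ ring (sum (d ℕ.+ 0) b))) (⊝-self (0ℚ , 0ℚ))))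
    (sym (ℚ.*-zeroʳ (A * (B + B)))))
  product-defect {A} {B} a b 0≤A 0≤B a≤ b≤ (suc n) d = begin
    ‖ sum (suc n) a ⊗ S ⊝ triangle (suc n) a b ‖
      ≡⟨ cong ‖_‖ (trans (cong (λ s → s ⊗ S ⊝ triangle (suc n) a b) (sum-first n a))
           (rearrange (a 0) (sum n a′) S (sum (suc n) b) (triangle n a′ b))) ⟩
    ‖ a 0 ⊗ (S ⊝ sum (suc n) b) ⊕ (sum n a′ ⊗ S ⊝ triangle n a′ b) ‖
      ≤⟨ ‖‖-⊕ (a 0 ⊗ (S ⊝ sum (suc n) b)) (sum n a′ ⊗ S ⊝ triangle n a′ b) ⟩
    ‖ a 0 ⊗ (S ⊝ sum (suc n) b) ‖ + ‖ sum n a′ ⊗ S ⊝ triangle n a′ b ‖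
      ≤⟨ ℚ.+-mono-≤ {‖ a 0 ⊗ (S ⊝ sum (suc n) b) ‖} {A * ((B + B) * ¼^ (suc n))} {‖ sum n a′ ⊗ S ⊝ triangle n a′ b ‖}
           (ℚ.≤-trans (‖‖-⊗ (a 0) (S ⊝ sum (suc n) b))
             (*-mono {‖ a 0 ‖} {A} {‖ S ⊝ sum (suc n) b ‖} {(B + B) * ¼^ (suc n)} 0≤A
               (subst (‖ a 0 ‖ ≤_) (ℚ.*-identityʳ A) (a≤ 0)) (‖‖-nonNeg (S ⊝ sum (suc n) b))
               (sum-tail b b≤ 0≤B (suc n) d)))
           (subst (λ m → ‖ sum n a′ ⊗ sum m b ⊝ triangle n a′ b ‖ ≤ (A * ¼ * (B + B)) * (fromℕ n * ¼^ n))
             (sym (ℕ.+-suc d n))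
             (product-defect a′ b (*-nonNeg {A} {¼} 0≤A (ℚ.nonNegative⁻¹ ¼)) 0≤B
               (λ i → subst (‖ a′ i ‖ ≤_) (sym (ℚ.*-assoc A ¼ (¼^ i))) (a≤ (suc i))) b≤ n (suc d))) ⟩
    A * ((B + B) * (¼ * ¼^ n)) + (A * ¼ * (B + B)) * (fromℕ n * ¼^ n)
      ≡⟨ solve 4 (λ A B g n → A :* ((B :+ B) :* (con ¼ :* g)) :+ (A :* con ¼ :* (B :+ B)) :* (n :* g)
           := (A :* (B :+ B)) :* ((n :+ con 1ℚ) :* (con ¼ :* g))) refl A B (¼^ n) (fromℕ n) ⟩
    (A * (B + B)) * ((fromℕ n + 1ℚ) * ¼^ (suc n))
      ≡⟨ cong (λ m → (A * (B + B)) * (m * ¼^ (suc n))) (sym (fromℕ-suc n)) ⟩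
    (A * (B + B)) * (fromℕ (suc n) * ¼^ (suc n)) ∎
    where
    S : ℚ[i]
    S = sum (d ℕ.+ suc n) b
    a′ : ℕ → ℚ[i]
    a′ = a ∘ suc
    rearrange : ∀ x y s t u → (x ⊕ y) ⊗ s ⊝ (x ⊗ t ⊕ u) ≡ x ⊗ (s ⊝ t) ⊕ (y ⊗ s ⊝ u)
    rearrange (x , x′) (y , y′) (s , s′) (t , t′) (u , u′) = cong₂ _,_
      (solve 10 (λ x x′ y y′ s s′ t t′ u u′ →
        ((x :+ y) :* s :- (x′ :+ y′) :* s′) :+ (:- ((x :* t :- x′ :* t′) :+ u))
        := (x :* (s :+ (:- t)) :- x′ :* (s′ :+ (:- t′))) :+ ((y :* s :- y′ :* s′) :+ (:- u))) refl x x′ y y′ s s′ t t′ u u′)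
      (solve 10 (λ x x′ y y′ s s′ t t′ u u′ →
        ((x :+ y) :* s′ :+ (x′ :+ y′) :* s) :+ (:- ((x :* t′ :+ x′ :* t) :+ u′))
        := (x :* (s′ :+ (:- t′)) :+ x′ :* (s :+ (:- t))) :+ ((y :* s′ :+ y′ :* s) :+ (:- u′))) refl x x′ y y′ s s′ t t′ u u′)

  -- Uniform in z and w: the k-th approximation of exp is the k-th partial sum at the k-th
  -- approximation of its argument, so the argument moves along with the order.
  exp-defect : ∀ {M} → 0ℚ ≤ M → ∃ λ C → 0ℚ ≤ C × (∀ z w n → ‖ z ‖ ≤ M → ‖ w ‖ ≤ M →
    ‖ sum n (term z) ⊗ sum n (term w) ⊝ sum n (term (z ⊕ w)) ‖ ≤ C * 1/suc n)
  exp-defect {M} 0≤M =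
    let A , 0≤A , f = majorant-bounded (+-nonNeg {M} {M} 0≤M 0≤M)
        0≤C         = *-nonNeg {A} {A + A} 0≤A (+-nonNeg {A} {A} 0≤A 0≤A)
        decay : ∀ z → ‖ z ‖ ≤ M → ∀ i → ‖ term z i ‖ ≤ A * ¼^ i
        decay z z≤M i = ℚ.≤-trans (term-decay 0≤M z z≤M i) (ℚ.*-monoʳ-≤-nonNeg (¼^ i) {{ℚ.nonNegative (¼^-nonNeg i)}} (f i))
    in A * (A + A) , 0≤C , λ z w n z≤M w≤M →
         subst (λ t → ‖ sum n (term z) ⊗ sum n (term w) ⊝ t ‖ ≤ A * (A + A) * 1/suc n) (triangle-term z w n)
           (ℚ.≤-trans (product-defect (term z) (term w) 0≤A 0≤A (decay z z≤M) (decay w w≤M) n 0)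
             (ℚ.*-monoˡ-≤-nonNeg (A * (A + A)) {{ℚ.nonNegative 0≤C}} (n¼^n≤ n)))

  -- 9/8 bounds late approximations of a real of absolute value at most 1. From the quadratic term
  -- on, the ratio is at most (1/3)·(9/8) = 3/8; then 1/(1 - 3/8) = 8/5, and half of it is the
  -- Taylor constant 4/5.
  ⅜ 8/5 9/8 : ℚ
  ⅜   = ℤ.+ 3 ℚ./ 8
  8/5 = ℤ.+ 8 ℚ./ 5
  9/8 = ℤ.+ 9 ℚ./ 8

  -- From the quadratic term on the series is dominated by a geometric one of ratio 3/8.
  sum-taylor : ∀ q → ℚ.∣ q ∣ ≤ 9/8 → ∀ d →
    ‖ sum (d ℕ.+ 2) (term (0ℚ , q)) ⊝ (1ℚ , q) ‖ ≤ 4/5 * (q * q)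
  sum-taylor q q≤ d = ℚ.≤-trans
    (subst (_≤ ‖ sum (d ℕ.+ 2) t ⊝ (1ℚ , q) ‖ + 8/5 * ‖ t (d ℕ.+ 2) ‖) (ℚ.+-identityʳ _)
      (ℚ.+-monoʳ-≤ ‖ sum (d ℕ.+ 2) t ⊝ (1ℚ , q) ‖ (*-nonNeg {8/5} {‖ t (d ℕ.+ 2) ‖} (ℚ.nonNegative⁻¹ 8/5) (‖‖-nonNeg (t (d ℕ.+ 2))))))
    (ℚ.≤-trans (go d) quadratic)
    where
    z : ℚ[i]
    z = 0ℚ , q
    t : ℕ → ℚ[i]
    t = term z
    ‖z‖ : ‖ z ‖ ≡ ℚ.∣ q ∣
    ‖z‖ = ℚ.+-identityˡ ℚ.∣ q ∣
    sum2 : sum 2 t ≡ (1ℚ , q)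
    sum2 = cong₂ _,_
      (solve 1 (λ q → con 0ℚ :+ con 1ℚ :+ con 1ℚ :* (con 0ℚ :* con 1ℚ :- q :* con 0ℚ) := con 1ℚ) refl q)
      (solve 1 (λ q → con 0ℚ :+ con 0ℚ :+ con 1ℚ :* (con 0ℚ :* con 0ℚ :+ q :* con 1ℚ) := q) refl q)
    t2≤ : ‖ t 2 ‖ ≤ ½ * (ℚ.∣ q ∣ * ℚ.∣ q ∣)
    t2≤ = ℚ.≤-trans (‖term-suc‖ z 1) (ℚ.*-monoˡ-≤-nonNeg ½
      (subst (λ m → m * ‖ t 1 ‖ ≤ ℚ.∣ q ∣ * ℚ.∣ q ∣) (sym ‖z‖)
        (ℚ.*-monoˡ-≤-nonNeg ℚ.∣ q ∣ {{ℚ.nonNegative (ℚ.0≤∣p∣ q)}}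
          (ℚ.≤-trans (‖term-suc‖ z 0) (ℚ.≤-reflexive
            (trans (ℚ.*-identityˡ (‖ z ‖ * 1ℚ)) (trans (ℚ.*-identityʳ ‖ z ‖) ‖z‖)))))))
    quadratic : 8/5 * ‖ t 2 ‖ ≤ 4/5 * (q * q)
    quadratic = begin
      8/5 * ‖ t 2 ‖ ≤⟨ ℚ.*-monoˡ-≤-nonNeg 8/5 t2≤ ⟩
      8/5 * (½ * (ℚ.∣ q ∣ * ℚ.∣ q ∣)) ≡⟨ sym (ℚ.*-assoc 8/5 ½ (ℚ.∣ q ∣ * ℚ.∣ q ∣)) ⟩
      4/5 * (ℚ.∣ q ∣ * ℚ.∣ q ∣) ≡⟨ cong (4/5 *_) (trans (sym (ℚ.∣p*q∣≡∣p∣*∣q∣ q q)) (ℚ.0≤p⇒∣p∣≡p (Estimates.sq-nonNeg q))) ⟩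
      4/5 * (q * q) ∎
    ratio : ∀ n → 2 ℕ.≤ n → ‖ t (suc n) ‖ ≤ ⅜ * ‖ t n ‖
    ratio n 2≤n = begin
      ‖ t (suc n) ‖ ≤⟨ ‖term-suc‖ z n ⟩
      1/suc n * (‖ z ‖ * ‖ t n ‖)
        ≤⟨ *-mono {1/suc n} {1/suc 2} {‖ z ‖ * ‖ t n ‖} {9/8 * ‖ t n ‖} (1/suc-nonNeg 2) (1/suc-antitone 2≤n)
             (*-nonNeg {‖ z ‖} {‖ t n ‖} (‖‖-nonNeg z) (‖‖-nonNeg (t n)))
             (ℚ.*-monoʳ-≤-nonNeg ‖ t n ‖ {{ℚ.nonNegative (‖‖-nonNeg (t n))}} (subst (_≤ 9/8) (sym ‖z‖) q≤)) ⟩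
      1/suc 2 * (9/8 * ‖ t n ‖) ≡⟨ sym (ℚ.*-assoc (1/suc 2) 9/8 ‖ t n ‖) ⟩
      ⅜ * ‖ t n ‖ ∎
    go : ∀ d → ‖ sum (d ℕ.+ 2) t ⊝ (1ℚ , q) ‖ + 8/5 * ‖ t (d ℕ.+ 2) ‖ ≤ 8/5 * ‖ t 2 ‖
    go zero    = ℚ.≤-reflexive (trans (cong (λ g → ‖ g ‖ + 8/5 * ‖ t 2 ‖)
      (trans (cong (_⊝ (1ℚ , q)) sum2) (⊝-self (1ℚ , q)))) (ℚ.+-identityˡ _))
    go (suc d) = begin
      ‖ sum m t ⊕ t m ⊝ (1ℚ , q) ‖ + 8/5 * ‖ t (suc m) ‖
        ≡⟨ cong (λ g → ‖ g ‖ + 8/5 * ‖ t (suc m) ‖) (trans (⊕-assoc (sum m t) (t m) (⊖ (1ℚ , q)))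
             (trans (cong (sum m t ⊕_) (⊕-comm (t m) (⊖ (1ℚ , q)))) (sym (⊕-assoc (sum m t) (⊖ (1ℚ , q)) (t m))))) ⟩
      ‖ (sum m t ⊝ (1ℚ , q)) ⊕ t m ‖ + 8/5 * ‖ t (suc m) ‖
        ≤⟨ ℚ.+-mono-≤ {‖ (sum m t ⊝ (1ℚ , q)) ⊕ t m ‖} {‖ sum m t ⊝ (1ℚ , q) ‖ + ‖ t m ‖} {8/5 * ‖ t (suc m) ‖}
             (‖‖-⊕ (sum m t ⊝ (1ℚ , q)) (t m))
             (ℚ.*-monoˡ-≤-nonNeg 8/5 (ratio m (ℕ.m≤n+m 2 d))) ⟩
      ‖ sum m t ⊝ (1ℚ , q) ‖ + ‖ t m ‖ + 8/5 * (⅜ * ‖ t m ‖)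
        ≡⟨ solve 2 (λ s t → s :+ t :+ con 8/5 :* (con ⅜ :* t) := s :+ con 8/5 :* t) refl ‖ sum m t ⊝ (1ℚ , q) ‖ ‖ t m ‖ ⟩
      ‖ sum m t ⊝ (1ℚ , q) ‖ + 8/5 * ‖ t m ‖
        ≤⟨ go d ⟩
      8/5 * ‖ t 2 ‖ ∎
      where
      m : ℕ
      m = d ℕ.+ 2

  conjugate : ℚ[i] → ℚ[i]
  conjugate (a , b) = a , - b

  term-conjugate : ∀ z n → term (conjugate z) n ≡ conjugate (term z n)
  term-conjugate z zero    = refl
  term-conjugate z (suc n) = trans
    (cong (λ t → 1/suc n * proj₁ (conjugate z ⊗ t) , 1/suc n * proj₂ (conjugate z ⊗ t)) (term-conjugate z n))
    (cong₂ _,_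
      (solve 5 (λ i a b c d → i :* (a :* c :- (:- b) :* (:- d))
          := i :* (a :* c :- b :* d)) refl (1/suc n) (proj₁ z) (proj₂ z) (proj₁ (term z n)) (proj₂ (term z n)))
      (solve 5 (λ i a b c d → i :* (a :* (:- d) :+ (:- b) :* c)
          := :- (i :* (a :* d :+ b :* c))) refl (1/suc n) (proj₁ z) (proj₂ z) (proj₁ (term z n)) (proj₂ (term z n))))

  sum-conjugate : ∀ n {a b} → (∀ i → a i ≡ conjugate (b i)) → sum n a ≡ conjugate (sum n b)
  sum-conjugate zero    e = refl
  sum-conjugate (suc n) {a} {b} e = trans (cong₂ _⊕_ (sum-conjugate n e) (e n))
    (cong (proj₁ (sum n b) + proj₁ (b n) ,_) (sym (ℚ.neg-distrib-+ (proj₂ (sum n b)) (proj₂ (b n)))))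

open import Defs
abs≤⇒≤ : ∀ {a b} → ℚ.∣ a ∣ ℚ.≤ b → a ℚ.≤ b
abs≤⇒≤ {a} h = ℚ.≤-trans (≤abs a) h

abs≤⇒-≤ : ∀ {a b} → ℚ.∣ a ∣ ℚ.≤ b → ℚ.- b ℚ.≤ a
abs≤⇒-≤ {a} {b} h = subst (ℚ.- b ℚ.≤_) (+-*-Solver.solve 1 (λ a → +-*-Solver.:- (+-*-Solver.:- a) +-*-Solver.:= a) refl a)
  (ℚ.neg-antimono-≤ (ℚ.≤-trans (≤abs (ℚ.- a)) (subst (ℚ._≤ b) (sym (ℚ.∣-p∣≡∣p∣ a)) h)))

-- The real numbers as an ordered ring.

module RealOrder where

  open +-*-Solver using (solve; _:+_; _:*_; :-_; _:-_; _:=_; con)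
  open ℚ.≤-Reasoning
  open Equality

  ≈-pointwise : ∀ {x y} → (∀ k → seq x k ≡ seq y k) → x ≈ y
  ≈-pointwise {x} {y} e ε 0<ε = 0 , λ k _ → subst (λ t → ℚ.∣ seq x k ℚ.- t ∣ ℚ.≤ ε) (e k)
    (subst (ℚ._≤ ε) (sym (abs-self (seq x k))) (ℚ.<⇒≤ 0<ε))

  +-cong : ∀ {x y u v} → x ≈ y → u ≈ v → x + u ≈ y + v
  +-cong {x} {y} {u} {v} p q ε 0<ε =
    let M , f = p (½ ℚ.* ε) (half-pos 0<ε)
        N , g = q (½ ℚ.* ε) (half-pos 0<ε)
    in M ℕ.⊔ N , λ k h → begin
      ℚ.∣ (seq x k ℚ.+ seq u k) ℚ.- (seq y k ℚ.+ seq v k) ∣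
        ≡⟨ cong ℚ.∣_∣ (solve 4 (λ a b c d → (a :+ b) :- (c :+ d) := (a :- c) :+ (b :- d)) refl
             (seq x k) (seq u k) (seq y k) (seq v k)) ⟩
      ℚ.∣ (seq x k ℚ.- seq y k) ℚ.+ (seq u k ℚ.- seq v k) ∣
        ≤⟨ CauchyProperties.abs-+ {seq x k ℚ.- seq y k} {seq u k ℚ.- seq v k}
             (f k (ℕ.m⊔n≤o⇒m≤o M N h)) (g k (ℕ.m⊔n≤o⇒n≤o M N h)) ⟩
      ½ ℚ.* ε ℚ.+ ½ ℚ.* ε ≡⟨ half+half ε ⟩
      ε ∎

  -‿cong : ∀ {x y} → x ≈ y → - x ≈ - y
  -‿cong {x} {y} p ε 0<ε = let N , f = p ε 0<ε in N , λ k h → subst (ℚ._≤ ε)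
    (trans (sym (ℚ.∣-p∣≡∣p∣ (seq x k ℚ.- seq y k)))
      (cong ℚ.∣_∣ (solve 2 (λ a b → :- (a :- b) := (:- a) :- (:- b)) refl (seq x k) (seq y k))))
    (f k h)

  *-congˡ : ∀ {x y} u → x ≈ y → u * x ≈ u * y
  *-congˡ {x} {y} u p ε 0<ε =
    let B , 0<B , M , b = CauchyProperties.bounded {seq u} (cauchy u)
        δ , 0<δ , e     = scale B ε 0<B 0<ε
        N , f           = p δ 0<δ
    in M ℕ.⊔ N , λ k h → begin
      ℚ.∣ seq u k ℚ.* seq x k ℚ.- seq u k ℚ.* seq y k ∣
        ≡⟨ cong ℚ.∣_∣ (solve 3 (λ u x y → u :* x :- u :* y := u :* (x :- y)) refl (seq u k) (seq x k) (seq y k)) ⟩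
      ℚ.∣ seq u k ℚ.* (seq x k ℚ.- seq y k) ∣
        ≤⟨ CauchyProperties.abs-* {seq u k} {seq x k ℚ.- seq y k} {B} {δ} (ℚ.<⇒≤ 0<B)
             (b k (ℕ.m⊔n≤o⇒m≤o M N h)) (f k (ℕ.m⊔n≤o⇒n≤o M N h)) ⟩
      B ℚ.* δ ≡⟨ e ⟩
      ε ∎

  *-cong : ∀ {x y u v} → x ≈ y → u ≈ v → x * u ≈ y * v
  *-cong {x} {y} {u} {v} p q =
    ≈-trans {x * u} {x * v} {y * v} (*-congˡ {u} {v} x q)
      (≈-trans {x * v} {v * x} {y * v} (≈-pointwise {x * v} {v * x} λ k → ℚ.*-comm (seq x k) (seq v k))
        (≈-trans {v * x} {v * y} {y * v} (*-congˡ {x} {y} v p)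
          (≈-pointwise {v * y} {y * v} λ k → ℚ.*-comm (seq v k) (seq y k))))

  commutativeRing : CommutativeRing 0ℓ 0ℓ
  commutativeRing = record
    { Carrier = ℝ
    ; _≈_ = _≈_
    ; _+_ = _+_
    ; _*_ = _*_
    ; -_ = -_
    ; 0# = 0ℝ
    ; 1# = 1ℝ
    ; isCommutativeRing = record
      { isRing = record
        { +-isAbelianGroup = record
          { isGroup = record
            { isMonoid = record
              { isSemigroup = record
                { isMagma = record
                  { isEquivalence = record
                    { refl = λ {x} → ≈-refl {x}
                    ; sym = λ {x} {y} → ≈-sym {x} {y}
                    ; trans = λ {x} {y} {z} → ≈-trans {x} {y} {z} }
                  ; ∙-cong = λ {x} {y} {u} {v} → +-cong {x} {y} {u} {v} }
                ; assoc = λ x y z → ≈-pointwise {(x + y) + z} {x + (y + z)} λ k → ℚ.+-assoc (seq x k) (seq y k) (seq z k) }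
              ; identity = (λ x → ≈-pointwise {0ℝ + x} {x} λ k → ℚ.+-identityˡ (seq x k))
                         , (λ x → ≈-pointwise {x + 0ℝ} {x} λ k → ℚ.+-identityʳ (seq x k)) }
            ; inverse = (λ x → ≈-pointwise {(- x) + x} {0ℝ} λ k → ℚ.+-inverseˡ (seq x k))
                      , (λ x → ≈-pointwise {x + - x} {0ℝ} λ k → ℚ.+-inverseʳ (seq x k))
            ; ⁻¹-cong = λ {x} {y} → -‿cong {x} {y} }
          ; comm = λ x y → ≈-pointwise {x + y} {y + x} λ k → ℚ.+-comm (seq x k) (seq y k) }
        ; *-cong = λ {x} {y} {u} {v} → *-cong {x} {y} {u} {v}
        ; *-assoc = λ x y z → ≈-pointwise {(x * y) * z} {x * (y * z)} λ k → ℚ.*-assoc (seq x k) (seq y k) (seq z k)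
        ; *-identity = (λ x → ≈-pointwise {1ℝ * x} {x} λ k → ℚ.*-identityˡ (seq x k))
                     , (λ x → ≈-pointwise {x * 1ℝ} {x} λ k → ℚ.*-identityʳ (seq x k))
        ; distrib = (λ x y z → ≈-pointwise {x * (y + z)} {x * y + x * z} λ k → ℚ.*-distribˡ-+ (seq x k) (seq y k) (seq z k))
                  , (λ x y z → ≈-pointwise {(y + z) * x} {y * x + z * x} λ k → ℚ.*-distribʳ-+ (seq x k) (seq y k) (seq z k)) }
      ; *-comm = λ x y → ≈-pointwise {x * y} {y * x} λ k → ℚ.*-comm (seq x k) (seq y k) } }

  0≤-resp : ∀ {x y} → x ≈ y → 0ℝ ≤ x → 0ℝ ≤ y
  0≤-resp {x} {y} e h ε 0<ε =
    let M , f = e (½ ℚ.* ε) (half-pos 0<ε)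
        N , g = h (½ ℚ.* ε) (half-pos 0<ε)
    in M ℕ.⊔ N , λ k l → begin
      0ℚ ≤⟨ g k (ℕ.m⊔n≤o⇒n≤o M N l) ⟩
      seq x k ℚ.+ ½ ℚ.* ε ≡⟨ solve 3 (λ x y ε → x :+ ε := (x :- y) :+ (y :+ ε)) refl (seq x k) (seq y k) (½ ℚ.* ε) ⟩
      (seq x k ℚ.- seq y k) ℚ.+ (seq y k ℚ.+ ½ ℚ.* ε)
        ≤⟨ ℚ.+-monoˡ-≤ (seq y k ℚ.+ ½ ℚ.* ε) (abs≤⇒≤ {seq x k ℚ.- seq y k} (f k (ℕ.m⊔n≤o⇒m≤o M N l))) ⟩
      ½ ℚ.* ε ℚ.+ (seq y k ℚ.+ ½ ℚ.* ε) ≡⟨ solve 2 (λ y ε → con ½ :* ε :+ (y :+ con ½ :* ε) := y :+ ε) refl (seq y k) ε ⟩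
      seq y k ℚ.+ ε ∎

  0≤-+ : ∀ {x y} → 0ℝ ≤ x → 0ℝ ≤ y → 0ℝ ≤ x + y
  0≤-+ {x} {y} p q ε 0<ε =
    let M , f = p (½ ℚ.* ε) (half-pos 0<ε)
        N , g = q (½ ℚ.* ε) (half-pos 0<ε)
    in M ℕ.⊔ N , λ k l → subst (0ℚ ℚ.≤_)
      (solve 3 (λ x y ε → (x :+ con ½ :* ε) :+ (y :+ con ½ :* ε) := (x :+ y) :+ ε) refl (seq x k) (seq y k) ε)
      (+-nonNeg {seq x k ℚ.+ ½ ℚ.* ε} {seq y k ℚ.+ ½ ℚ.* ε}
        (f k (ℕ.m⊔n≤o⇒m≤o M N l)) (g k (ℕ.m⊔n≤o⇒n≤o M N l)))

  -- (x + δ)(y + δ) ≥ 0 with δ(|x| + |y| + 1) ≤ ε and δ ≤ 1.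
  0≤-* : ∀ {x y} → 0ℝ ≤ x → 0ℝ ≤ y → 0ℝ ≤ x * y
  0≤-* {x} {y} p q ε 0<ε =
    let A , 0<A , K , a = CauchyProperties.bounded {seq x} (cauchy x)
        B , 0<B , L , b = CauchyProperties.bounded {seq y} (cauchy y)
        0<A+B+1         = ℚ.+-mono-< {0ℚ} {A ℚ.+ B} {0ℚ} {1ℚ} (ℚ.+-mono-< {0ℚ} {A} {0ℚ} {B} 0<A 0<B) (ℚ.positive⁻¹ 1ℚ)
        η , 0<η , e     = scale (A ℚ.+ B ℚ.+ 1ℚ) ε 0<A+B+1 0<ε
        δ               = η ℚ.⊓ 1ℚ
        0<δ             = ⊓-pos η 1ℚ 0<η (ℚ.positive⁻¹ 1ℚ)
        M , f           = p δ 0<δ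
        N , g           = q δ 0<δ
    in (K ℕ.⊔ L) ℕ.⊔ (M ℕ.⊔ N) , λ k l →
      subst (λ t → 0ℚ ℚ.≤ seq x k ℚ.* seq y k ℚ.+ t) e
        (bound A B δ η (seq x k) (seq y k) (ℚ.<⇒≤ 0<δ) (ℚ.p⊓q≤p η 1ℚ) (ℚ.p⊓q≤q η 1ℚ) (ℚ.<⇒≤ 0<A+B+1)
          (a k (ℕ.m⊔n≤o⇒m≤o K L (ℕ.m⊔n≤o⇒m≤o (K ℕ.⊔ L) (M ℕ.⊔ N) l)))
          (b k (ℕ.m⊔n≤o⇒n≤o K L (ℕ.m⊔n≤o⇒m≤o (K ℕ.⊔ L) (M ℕ.⊔ N) l)))
          (f k (ℕ.m⊔n≤o⇒m≤o M N (ℕ.m⊔n≤o⇒n≤o (K ℕ.⊔ L) (M ℕ.⊔ N) l)))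
          (g k (ℕ.m⊔n≤o⇒n≤o M N (ℕ.m⊔n≤o⇒n≤o (K ℕ.⊔ L) (M ℕ.⊔ N) l))))
    where
    ⊓-pos : ∀ a b → 0ℚ ℚ.< a → 0ℚ ℚ.< b → 0ℚ ℚ.< a ℚ.⊓ b
    ⊓-pos a b 0<a 0<b with ℚ.⊓-sel a b
    ... | inj₁ e = subst (0ℚ ℚ.<_) (sym e) 0<a
    ... | inj₂ e = subst (0ℚ ℚ.<_) (sym e) 0<b
    bound : ∀ A B δ η x y → 0ℚ ℚ.≤ δ → δ ℚ.≤ η → δ ℚ.≤ 1ℚ → 0ℚ ℚ.≤ A ℚ.+ B ℚ.+ 1ℚ →
      ℚ.∣ x ∣ ℚ.≤ A → ℚ.∣ y ∣ ℚ.≤ B → 0ℚ ℚ.≤ x ℚ.+ δ → 0ℚ ℚ.≤ y ℚ.+ δ →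
      0ℚ ℚ.≤ x ℚ.* y ℚ.+ (A ℚ.+ B ℚ.+ 1ℚ) ℚ.* η
    bound A B δ η x y 0≤δ δ≤η δ≤1 0≤S x≤A y≤B 0≤x+δ 0≤y+δ = begin
      0ℚ ≤⟨ *-nonNeg {x ℚ.+ δ} {y ℚ.+ δ} 0≤x+δ 0≤y+δ ⟩
      (x ℚ.+ δ) ℚ.* (y ℚ.+ δ) ≡⟨ solve 3 (λ x y δ → (x :+ δ) :* (y :+ δ) := x :* y :+ (x :+ y :+ δ) :* δ) refl x y δ ⟩
      x ℚ.* y ℚ.+ (x ℚ.+ y ℚ.+ δ) ℚ.* δ
        ≤⟨ ℚ.+-monoʳ-≤ (x ℚ.* y) (ℚ.*-monoʳ-≤-nonNeg δ {{ℚ.nonNegative 0≤δ}}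
             (ℚ.+-mono-≤ {x ℚ.+ y} {A ℚ.+ B} {δ} {1ℚ} (ℚ.+-mono-≤ {x} {A} {y} {B} (abs≤⇒≤ {x} x≤A) (abs≤⇒≤ {y} y≤B)) δ≤1)) ⟩
      x ℚ.* y ℚ.+ (A ℚ.+ B ℚ.+ 1ℚ) ℚ.* δ
        ≤⟨ ℚ.+-monoʳ-≤ (x ℚ.* y) (ℚ.*-monoˡ-≤-nonNeg (A ℚ.+ B ℚ.+ 1ℚ) {{ℚ.nonNegative 0≤S}} δ≤η) ⟩
      x ℚ.* y ℚ.+ (A ℚ.+ B ℚ.+ 1ℚ) ℚ.* η ∎

  0≤-square : ∀ x → 0ℝ ≤ x * x
  0≤-square x ε 0<ε = 0 , λ k _ → +-nonNeg {seq x k ℚ.* seq x k} {ε} (Estimates.sq-nonNeg (seq x k)) (ℚ.<⇒≤ 0<ε)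

  0≤-fromℚ : ∀ q → 0ℚ ℚ.≤ q → 0ℝ ≤ fromℚ q
  0≤-fromℚ q 0≤q ε 0<ε = 0 , λ _ _ → +-nonNeg {q} {ε} 0≤q (ℚ.<⇒≤ 0<ε)

  0≤-closed : ∀ x → (∀ q → 0ℚ ℚ.< q → 0ℝ ≤ x + fromℚ q) → 0ℝ ≤ x
  0≤-closed x h ε 0<ε = let N , f = h (½ ℚ.* ε) (half-pos 0<ε) (½ ℚ.* ε) (half-pos 0<ε) in
    N , λ k l → subst (0ℚ ℚ.≤_) (solve 2 (λ x ε → x :+ con ½ :* ε :+ con ½ :* ε := x :+ ε) refl (seq x k) ε) (f k l)

  0≤-antisym : ∀ x → 0ℝ ≤ x → 0ℝ ≤ - x → x ≈ 0ℝ
  0≤-antisym x p q ε 0<ε =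
    let M , f = p ε 0<ε
        N , g = q ε 0<ε
    in M ℕ.⊔ N , λ k l → abs≤ {seq x k ℚ.- 0ℚ} {ε}
      (subst₂ (solve 2 (λ x ε → (:- x :+ ε) :+ (x :- con 0ℚ) := ε) refl (seq x k) ε) (g k (ℕ.m⊔n≤o⇒n≤o M N l)))
      (subst₂ (solve 2 (λ x ε → (x :+ ε) :+ (:- (x :- con 0ℚ)) := ε) refl (seq x k) ε) (f k (ℕ.m⊔n≤o⇒m≤o M N l)))
    where
    subst₂ : ∀ {a b c} → a ℚ.+ b ≡ c → 0ℚ ℚ.≤ a → b ℚ.≤ c
    subst₂ {a} {b} {c} e 0≤a = begin
      b ≡⟨ sym (ℚ.+-identityˡ b) ⟩
      0ℚ ℚ.+ b ≤⟨ ℚ.+-monoˡ-≤ b 0≤a ⟩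
      a ℚ.+ b ≡⟨ e ⟩
      c ∎

  ≤⇒0≤- : ∀ {x y} → x ≤ y → 0ℝ ≤ y - x
  ≤⇒0≤- {x} {y} h ε 0<ε = let N , f = h ε 0<ε in N , λ k l → begin
    0ℚ ≡⟨ sym (ℚ.+-inverseʳ (seq x k)) ⟩
    seq x k ℚ.- seq x k ≤⟨ ℚ.+-monoˡ-≤ (ℚ.- seq x k) (f k l) ⟩
    seq y k ℚ.+ ε ℚ.- seq x k ≡⟨ solve 3 (λ x y ε → y :+ ε :- x := y :- x :+ ε) refl (seq x k) (seq y k) ε ⟩
    seq y k ℚ.- seq x k ℚ.+ ε ∎

  0≤-⇒≤ : ∀ {x y} → 0ℝ ≤ y - x → x ≤ y
  0≤-⇒≤ {x} {y} h ε 0<ε = let N , f = h ε 0<ε in N , λ k l → begin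
    seq x k ≡⟨ sym (ℚ.+-identityˡ (seq x k)) ⟩
    0ℚ ℚ.+ seq x k ≤⟨ ℚ.+-monoˡ-≤ (seq x k) (f k l) ⟩
    seq y k ℚ.- seq x k ℚ.+ ε ℚ.+ seq x k ≡⟨ solve 3 (λ x y ε → y :- x :+ ε :+ x := y :+ ε) refl (seq x k) (seq y k) ε ⟩
    seq y k ℚ.+ ε ∎

  -- The abstract ring knows no strict order; a strict inequality enters it as a nonnegative
  -- difference with a rational margin.
  <⇒gap : ∀ {x y} → x < y → ∃ λ q → 0ℚ ℚ.< q × 0ℝ ≤ y - x - fromℚ q
  <⇒gap {x} {y} (q , 0<q , N , f) = q , 0<q , λ ε 0<ε → N , λ k l → begin
    0ℚ ≡⟨ sym (ℚ.+-inverseʳ (seq x k ℚ.+ q)) ⟩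
    (seq x k ℚ.+ q) ℚ.- (seq x k ℚ.+ q) ≤⟨ ℚ.+-monoˡ-≤ (ℚ.- (seq x k ℚ.+ q)) (f k l) ⟩
    seq y k ℚ.- (seq x k ℚ.+ q) ≡⟨ sym (ℚ.+-identityʳ _) ⟩
    seq y k ℚ.- (seq x k ℚ.+ q) ℚ.+ 0ℚ ≤⟨ ℚ.+-monoʳ-≤ (seq y k ℚ.- (seq x k ℚ.+ q)) (ℚ.<⇒≤ 0<ε) ⟩
    seq y k ℚ.- (seq x k ℚ.+ q) ℚ.+ ε ≡⟨ solve 4 (λ x y q ε → y :- (x :+ q) :+ ε := y :- x :- q :+ ε) refl (seq x k) (seq y k) q ε ⟩
    seq y k ℚ.- seq x k ℚ.- q ℚ.+ ε ∎

  gap⇒< : ∀ {x y} q → 0ℚ ℚ.< q → 0ℝ ≤ y - x - fromℚ q → x < y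
  gap⇒< {x} {y} q 0<q h =
    let N , f = h (½ ℚ.* q) (half-pos 0<q)
    in ½ ℚ.* q , half-pos 0<q , N , λ k l → begin
      seq x k ℚ.+ ½ ℚ.* q ≡⟨ sym (ℚ.+-identityˡ (seq x k ℚ.+ ½ ℚ.* q)) ⟩
      0ℚ ℚ.+ (seq x k ℚ.+ ½ ℚ.* q) ≤⟨ ℚ.+-monoˡ-≤ (seq x k ℚ.+ ½ ℚ.* q) (f k l) ⟩
      seq y k ℚ.- seq x k ℚ.- q ℚ.+ ½ ℚ.* q ℚ.+ (seq x k ℚ.+ ½ ℚ.* q)
        ≡⟨ solve 3 (λ x y q → y :- x :- q :+ con ½ :* q :+ (x :+ con ½ :* q) := y) refl (seq x k) (seq y k) q ⟩
      seq y k ∎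

  upperBound : ∀ x → ∃ λ B → 0ℚ ℚ.< B × x ≤ fromℚ B
  upperBound x =
    let B , 0<B , N , f = CauchyProperties.bounded {seq x} (cauchy x)
    in B , 0<B , λ ε 0<ε → N , λ k l → ℚ.≤-trans (abs≤⇒≤ {seq x k} (f k l))
      (subst (ℚ._≤ B ℚ.+ ε) (ℚ.+-identityʳ B) (ℚ.+-monoʳ-≤ B (ℚ.<⇒≤ 0<ε)))

  0≤√ : ∀ x → 0ℝ ≤ √ x
  0≤√ x ε 0<ε = 0 , λ k _ → +-nonNeg {CauchyProperties.√approx k (seq x k)} {ε}
    (CauchyProperties.√approx-nonNeg k (seq x k)) (ℚ.<⇒≤ 0<ε)

  -- a² ≤ max(x , 0) < (a + i)² for the k-th approximation a of √ x and i = 1/(k+1).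
  √-square : ∀ x → 0ℝ ≤ x → √ x * √ x ≈ x
  √-square x 0≤x ε 0<ε =
    let B , 0<B , M , b = CauchyProperties.bounded {seq (√ x)} (cauchy (√ x))
        0<2B+1          = ℚ.+-mono-< {0ℚ} {B ℚ.+ B} {0ℚ} {1ℚ} (ℚ.+-mono-< {0ℚ} {B} {0ℚ} {B} 0<B 0<B) (ℚ.positive⁻¹ 1ℚ)
        η , 0<η , e     = scale (B ℚ.+ B ℚ.+ 1ℚ) ε 0<2B+1 0<ε
        L , l           = Estimates.archimedean η 0<η
        N , f           = 0≤x ε 0<ε
    in (M ℕ.⊔ L) ℕ.⊔ N , λ k h →
      let lower , upper = CauchyProperties.√approx-bounds k (seq x k)
      in subst (ℚ.∣ seq (√ x) k ℚ.* seq (√ x) k ℚ.- seq x k ∣ ℚ.≤_) e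
        (bound (seq (√ x) k) (1/suc k) (seq x k) B η
          (Estimates.1/suc-nonNeg k)
          (ℚ.≤-trans (Estimates.1/suc-antitone (ℕ.m⊔n≤o⇒n≤o M L (ℕ.m⊔n≤o⇒m≤o (M ℕ.⊔ L) N h))) (ℚ.<⇒≤ l))
          (1/suc≤1 k)
          (abs≤⇒≤ {seq (√ x) k} (b k (ℕ.m⊔n≤o⇒m≤o M L (ℕ.m⊔n≤o⇒m≤o (M ℕ.⊔ L) N h))))
          (ℚ.<⇒≤ 0<2B+1)
          (subst (0ℚ ℚ.≤_) (cong (seq x k ℚ.+_) (sym e)) (f k (ℕ.m⊔n≤o⇒n≤o (M ℕ.⊔ L) N h)))
          (subst (0ℚ ℚ.≤_) (sym e) (ℚ.<⇒≤ 0<ε))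
          lower (ℚ.<⇒≤ upper))
    where
    open Estimates using (1/suc)
    1/suc≤1 : ∀ k → 1/suc k ℚ.≤ 1ℚ
    1/suc≤1 k = Estimates.1/suc-antitone {0} {k} ℕ.z≤n
    bound : ∀ a i x B η → 0ℚ ℚ.≤ i → i ℚ.≤ η → i ℚ.≤ 1ℚ → a ℚ.≤ B → 0ℚ ℚ.≤ B ℚ.+ B ℚ.+ 1ℚ →
      0ℚ ℚ.≤ x ℚ.+ (B ℚ.+ B ℚ.+ 1ℚ) ℚ.* η → 0ℚ ℚ.≤ (B ℚ.+ B ℚ.+ 1ℚ) ℚ.* η →
      a ℚ.* a ℚ.≤ x ℚ.⊔ 0ℚ → x ℚ.⊔ 0ℚ ℚ.≤ (a ℚ.+ i) ℚ.* (a ℚ.+ i) →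
      ℚ.∣ a ℚ.* a ℚ.- x ∣ ℚ.≤ (B ℚ.+ B ℚ.+ 1ℚ) ℚ.* η
    bound a i x B η 0≤i i≤η i≤1 a≤B 0≤S 0≤x+ε 0≤ε lower upper = abs≤ {a ℚ.* a ℚ.- x}
      (Estimates.≤-to-sub {a ℚ.* a} {x} (ℚ.≤-trans lower (ℚ.⊔-lub
        (subst (ℚ._≤ S ℚ.+ x) (ℚ.+-identityˡ x) (ℚ.+-monoˡ-≤ x 0≤ε))
        (subst (0ℚ ℚ.≤_) (ℚ.+-comm x S) 0≤x+ε))))
      (begin
        ℚ.- (a ℚ.* a ℚ.- x) ≡⟨ solve 2 (λ a x → :- (a :* a :- x) := x :- a :* a) refl a x ⟩
        x ℚ.- a ℚ.* a ≤⟨ ℚ.+-monoˡ-≤ (ℚ.- (a ℚ.* a)) (ℚ.≤-trans (ℚ.p≤p⊔q x 0ℚ) upper) ⟩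
        (a ℚ.+ i) ℚ.* (a ℚ.+ i) ℚ.- a ℚ.* a
          ≡⟨ solve 2 (λ a i → (a :+ i) :* (a :+ i) :- a :* a := (a :+ a :+ i) :* i) refl a i ⟩
        (a ℚ.+ a ℚ.+ i) ℚ.* i
          ≤⟨ ℚ.*-monoʳ-≤-nonNeg i {{ℚ.nonNegative 0≤i}}
               (ℚ.+-mono-≤ {a ℚ.+ a} {B ℚ.+ B} {i} {1ℚ} (ℚ.+-mono-≤ {a} {B} {a} {B} a≤B a≤B) i≤1) ⟩
        (B ℚ.+ B ℚ.+ 1ℚ) ℚ.* i ≤⟨ ℚ.*-monoˡ-≤-nonNeg (B ℚ.+ B ℚ.+ 1ℚ) {{ℚ.nonNegative 0≤S}} i≤η ⟩
        S ∎)
      where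
      S : ℚ
      S = (B ℚ.+ B ℚ.+ 1ℚ) ℚ.* η

orderedRing : OrderedRing
orderedRing = record
  { commutativeRing = commutativeRing
  ; ι               = fromℚ
  ; ι-+             = λ p q → ≈-pointwise {fromℚ (p ℚ.+ q)} {fromℚ p + fromℚ q} λ _ → refl
  ; ι-*             = λ p q → ≈-pointwise {fromℚ (p ℚ.* q)} {fromℚ p * fromℚ q} λ _ → refl
  ; ι-neg           = λ p → ≈-pointwise {fromℚ (ℚ.- p)} { - fromℚ p} λ _ → refl
  ; ι-0             = ≈-pointwise {0ℝ} {0ℝ} λ _ → refl
  ; ι-1             = ≈-pointwise {1ℝ} {1ℝ} λ _ → refl
  ; NonNeg          = 0ℝ ≤_
  ; nonNeg-resp     = λ {x} {y} → 0≤-resp {x} {y}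
  ; nonNeg-+        = λ {x} {y} → 0≤-+ {x} {y}
  ; nonNeg-*        = λ {x} {y} → 0≤-* {x} {y}
  ; nonNeg-square   = 0≤-square
  ; nonNeg-ι        = 0≤-fromℚ
  ; nonNeg-closed   = 0≤-closed
  ; nonNeg-antisym  = 0≤-antisym
  }
  where open RealOrder

-- The complex exponential satisfies the trigonometric axioms.

module RealTrigonometry where

  open RealOrder
  open Equality
  open GaussianRationals
  open ExponentialSeries
  open SeriesBounds
  open OrderedRingProperties orderedRing using (∣_∣≤_)
  open +-*-Solver using (solve; _:+_; _:*_; :-_; _:-_; _:=_; con)
  open ℚ.≤-Reasoning

  infixl 30 _at_

  -- Evaluation at k turns sums and products in ℂ into those of ℚ[i] definitionally, which reduces
  -- statements about exp to statements about partial sums.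
  _at_ : ℂ → ℕ → ℚ[i]
  z at k = seq (re z) k , seq (im z) k

  expTerm-at : ∀ z n k → expTerm z n at k ≡ term (z at k) n
  expTerm-at z zero    k = refl
  expTerm-at z (suc n) k = cong (λ t → 1/suc n ℚ.* proj₁ (z at k ⊗ t) , 1/suc n ℚ.* proj₂ (z at k ⊗ t)) (expTerm-at z n k)

  expSum-at : ∀ z n k → expSum z n at k ≡ sum n (term (z at k))
  expSum-at z zero    k = refl
  expSum-at z (suc n) k = cong₂ _⊕_ (expSum-at z n k) (expTerm-at z n k)

  exp-at : ∀ z n → exp z at n ≡ sum n (term (z at n))
  exp-at z n = expSum-at z n n

  components : ∀ {z w} → (∀ ε → 0ℚ ℚ.< ε → ∃ λ N → ∀ k → N ℕ.≤ k → ‖ z at k ⊝ w at k ‖ ℚ.≤ ε) → z ≈ᶜ w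
  components {z} {w} h =
      (λ ε 0<ε → let N , f = h ε 0<ε in N , λ k l → ℚ.≤-trans (∣re∣ (z at k ⊝ w at k)) (f k l))
    , (λ ε 0<ε → let N , f = h ε 0<ε in N , λ k l → ℚ.≤-trans (∣im∣ (z at k ⊝ w at k)) (f k l))
    where
    ∣re∣ : ∀ g → ℚ.∣ proj₁ g ∣ ℚ.≤ ‖ g ‖
    ∣re∣ (a , b) = subst (ℚ._≤ ℚ.∣ a ∣ ℚ.+ ℚ.∣ b ∣) (ℚ.+-identityʳ ℚ.∣ a ∣) (ℚ.+-monoʳ-≤ ℚ.∣ a ∣ (ℚ.0≤∣p∣ b))
    ∣im∣ : ∀ g → ℚ.∣ proj₂ g ∣ ℚ.≤ ‖ g ‖
    ∣im∣ (a , b) = subst (ℚ._≤ ℚ.∣ a ∣ ℚ.+ ℚ.∣ b ∣) (ℚ.+-identityˡ ℚ.∣ b ∣) (ℚ.+-monoˡ-≤ ℚ.∣ b ∣ (ℚ.0≤∣p∣ a))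

  at-bounded : ∀ z → ∃ λ M → 0ℚ ℚ.≤ M × ∃ λ N → ∀ k → N ℕ.≤ k → ‖ z at k ‖ ℚ.≤ M
  at-bounded z =
    let A , 0<A , P , f = CauchyProperties.bounded {seq (re z)} (cauchy (re z))
        B , 0<B , Q , g = CauchyProperties.bounded {seq (im z)} (cauchy (im z))
    in A ℚ.+ B , +-nonNeg {A} {B} (ℚ.<⇒≤ 0<A) (ℚ.<⇒≤ 0<B) , P ℕ.⊔ Q , λ k h →
      ℚ.+-mono-≤ {ℚ.∣ seq (re z) k ∣} {A} {ℚ.∣ seq (im z) k ∣} {B} (f k (ℕ.m⊔n≤o⇒m≤o P Q h)) (g k (ℕ.m⊔n≤o⇒n≤o P Q h))

  exp-+ : ∀ z w → exp (z +ᶜ w) ≈ᶜ exp z *ᶜ exp w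
  exp-+ z w = ≈ᶜ-sym {exp z *ᶜ exp w} {exp (z +ᶜ w)} (components {exp z *ᶜ exp w} {exp (z +ᶜ w)} λ ε 0<ε →
    let A , 0≤A , P , f = at-bounded z
        B , 0≤B , Q , g = at-bounded w
        C , 0≤C , h     = exp-defect {A ℚ.+ B} (+-nonNeg {A} {B} 0≤A 0≤B)
        L , l           = Estimates.archimedean′ C ε 0≤C 0<ε
    in (P ℕ.⊔ Q) ℕ.⊔ L , λ k m → begin
      ‖ (exp z at k ⊗ exp w at k) ⊝ exp (z +ᶜ w) at k ‖
        ≡⟨ cong ‖_‖ (cong₂ _⊝_ (cong₂ _⊗_ (exp-at z k) (exp-at w k)) (exp-at (z +ᶜ w) k)) ⟩
      ‖ (sum k (term (z at k)) ⊗ sum k (term (w at k))) ⊝ sum k (term (z at k ⊕ w at k)) ‖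
        ≤⟨ h (z at k) (w at k) k
             (ℚ.≤-trans (f k (ℕ.m⊔n≤o⇒m≤o P Q (ℕ.m⊔n≤o⇒m≤o (P ℕ.⊔ Q) L m)))
               (subst (ℚ._≤ A ℚ.+ B) (ℚ.+-identityʳ A) (ℚ.+-monoʳ-≤ A 0≤B)))
             (ℚ.≤-trans (g k (ℕ.m⊔n≤o⇒n≤o P Q (ℕ.m⊔n≤o⇒m≤o (P ℕ.⊔ Q) L m)))
               (subst (ℚ._≤ A ℚ.+ B) (ℚ.+-identityˡ B) (ℚ.+-monoˡ-≤ B 0≤A))) ⟩
      C ℚ.* 1/suc k
        ≤⟨ ℚ.*-monoˡ-≤-nonNeg C {{ℚ.nonNegative 0≤C}} (Estimates.1/suc-antitone (ℕ.m⊔n≤o⇒n≤o (P ℕ.⊔ Q) L m)) ⟩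
      C ℚ.* 1/suc L
        <⟨ l ⟩
      ε ∎)

  exp-pointwise : ∀ {z w} → (∀ k → z at k ≡ w at k) → exp z ≈ᶜ exp w
  exp-pointwise {z} {w} e =
      ≈-pointwise {re (exp z)} {re (exp w)} (λ k → cong proj₁ (same k))
    , ≈-pointwise {im (exp z)} {im (exp w)} (λ k → cong proj₂ (same k))
    where
    same : ∀ k → exp z at k ≡ exp w at k
    same k = trans (exp-at z k) (trans (cong (λ g → sum k (term g)) (e k)) (sym (exp-at w k)))

  cis : ℝ → ℂ
  cis x = exp (x ·ᶜ iℂ)

  cosine sine : ℝ → ℝ
  cosine x = re (cis x)
  sine x   = im (cis x)

  imaginary-at : ∀ x k → (x ·ᶜ iℂ) at k ≡ (0ℚ , seq x k)
  imaginary-at x k = cong₂ _,_ (ℚ.*-zeroʳ (seq x k)) (ℚ.*-identityʳ (seq x k))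

  cis-at : ∀ x k → cis x at k ≡ sum k (term (0ℚ , seq x k))
  cis-at x k = trans (exp-at (x ·ᶜ iℂ) k) (cong (λ g → sum k (term g)) (imaginary-at x k))

  -- Termwise equality of z with x + y also admits y = x + (y - x), which `cis-cong` uses at a point
  -- where exp is not yet known to respect `_≈_`.
  cis-+ : ∀ {x y z} → (∀ k → seq z k ≡ seq x k ℚ.+ seq y k) → cis z ≈ᶜ cis x *ᶜ cis y
  cis-+ {x} {y} {z} e = ≈ᶜ-trans {cis z} {exp (x ·ᶜ iℂ +ᶜ y ·ᶜ iℂ)} {cis x *ᶜ cis y}
    (exp-pointwise {z ·ᶜ iℂ} {x ·ᶜ iℂ +ᶜ y ·ᶜ iℂ} λ k → trans (imaginary-at z k)
      (trans (cong₂ _,_ refl (e k)) (sym (cong₂ _⊕_ (imaginary-at x k) (imaginary-at y k)))))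
    (exp-+ (x ·ᶜ iℂ) (y ·ᶜ iℂ))

  -- The tolerance for which x² ≤ 1 yields approximations with square at most (9/8)².
  9/8²-1 : ℚ
  9/8²-1 = ℤ.+ 17 ℚ./ 64

  cis-taylor : ∀ x → x * x ≤ 1ℝ → ∃ λ N → ∀ k → N ℕ.≤ k →
    ‖ cis x at k ⊝ (1ℚ , seq x k) ‖ ℚ.≤ 4/5 ℚ.* (seq x k ℚ.* seq x k)
  cis-taylor x h = let N , f = h 9/8²-1 (ℚ.positive⁻¹ 9/8²-1) in N ℕ.+ 2 , λ k l →
    subst (λ g → ‖ g ⊝ (1ℚ , seq x k) ‖ ℚ.≤ 4/5 ℚ.* (seq x k ℚ.* seq x k)) (sym (cis-at x k))
      (subst (λ n → ‖ sum n (term (0ℚ , seq x k)) ⊝ (1ℚ , seq x k) ‖ ℚ.≤ 4/5 ℚ.* (seq x k ℚ.* seq x k))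
        (ℕ.m∸n+n≡m (ℕ.≤-trans (ℕ.m≤n+m 2 N) l))
        (sum-taylor (seq x k) (root (seq x k) (f k (ℕ.≤-trans (ℕ.m≤m+n N 2) l))) (k ℕ.∸ 2)))
    where
    root : ∀ q → q ℚ.* q ℚ.≤ 1ℚ ℚ.+ 9/8²-1 → ℚ.∣ q ∣ ℚ.≤ 9/8
    root q h = ℚ.≮⇒≥ λ 9/8<∣q∣ → ℚ.<-irrefl refl (begin-strict
      9/8 ℚ.* 9/8 <⟨ ℚ.*-monoʳ-<-pos 9/8 9/8<∣q∣ ⟩
      9/8 ℚ.* ℚ.∣ q ∣ ≤⟨ ℚ.*-monoʳ-≤-nonNeg ℚ.∣ q ∣ {{ℚ.nonNegative (ℚ.0≤∣p∣ q)}} (ℚ.<⇒≤ 9/8<∣q∣) ⟩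
      ℚ.∣ q ∣ ℚ.* ℚ.∣ q ∣ ≡⟨ trans (sym (ℚ.∣p*q∣≡∣p∣*∣q∣ q q)) (ℚ.0≤p⇒∣p∣≡p (Estimates.sq-nonNeg q)) ⟩
      q ℚ.* q ≤⟨ h ⟩
      9/8 ℚ.* 9/8 ∎)

  eventually-bounded : ∀ x c → (∃ λ N → ∀ k → N ℕ.≤ k → ℚ.∣ seq x k ∣ ℚ.≤ seq c k) → ∣ x ∣≤ c
  eventually-bounded x c (N , f) =
      (λ ε 0<ε → N , λ k l → nonneg (seq c k) (ℚ.- seq x k) ε (ℚ.<⇒≤ 0<ε) (subst (ℚ._≤ seq c k) (sym (ℚ.∣-p∣≡∣p∣ (seq x k))) (f k l)))
    , (λ ε 0<ε → N , λ k l → nonneg (seq c k) (seq x k) ε (ℚ.<⇒≤ 0<ε) (f k l))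
    where
    nonneg : ∀ c x ε → 0ℚ ℚ.≤ ε → ℚ.∣ x ∣ ℚ.≤ c → 0ℚ ℚ.≤ c ℚ.+ x ℚ.+ ε
    nonneg c x ε 0≤ε h = +-nonNeg {c ℚ.+ x} {ε} (subst (ℚ._≤ c ℚ.+ x) (ℚ.+-inverseʳ c) (ℚ.+-monoʳ-≤ c (abs≤⇒-≤ {x} h))) 0≤ε

  cos-taylor : ∀ x → 0ℝ ≤ 1ℝ - x * x → ∣ cosine x - 1ℝ ∣≤ fromℚ 4/5 * (x * x)
  cos-taylor x h = let N , f = cis-taylor x (0≤-⇒≤ {x * x} {1ℝ} h) in
    eventually-bounded (cosine x - 1ℝ) (fromℚ 4/5 * (x * x)) (N , λ k l → ℚ.≤-trans
      (subst (ℚ._≤ ‖ cis x at k ⊝ (1ℚ , seq x k) ‖) (ℚ.+-identityʳ _)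
        (ℚ.+-monoʳ-≤ ℚ.∣ seq (cosine x - 1ℝ) k ∣ (ℚ.0≤∣p∣ (seq (sine x - x) k)))) (f k l))

  sin-taylor : ∀ x → 0ℝ ≤ 1ℝ - x * x → ∣ sine x - x ∣≤ fromℚ 4/5 * (x * x)
  sin-taylor x h = let N , f = cis-taylor x (0≤-⇒≤ {x * x} {1ℝ} h) in
    eventually-bounded (sine x - x) (fromℚ 4/5 * (x * x)) (N , λ k l → ℚ.≤-trans
      (subst (ℚ._≤ ‖ cis x at k ⊝ (1ℚ , seq x k) ‖) (ℚ.+-identityˡ _)
        (ℚ.+-monoˡ-≤ ℚ.∣ seq (sine x - x) k ∣ (ℚ.0≤∣p∣ (seq (cosine x - 1ℝ) k)))) (f k l))

  cis-small : ∀ d → d ≈ 0ℝ → cis d ≈ᶜ 1ℂ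
  cis-small d e = components {cis d} {1ℂ} λ ε 0<ε →
    let M , f = cis-taylor d (0≤-⇒≤ {d * d} {1ℝ} (0≤-resp {1ℝ} {1ℝ - d * d} 1≈1-d² (0≤-fromℚ 1ℚ (ℚ.nonNegative⁻¹ 1ℚ))))
        N , g = e (½ ℚ.* ε) (half-pos 0<ε)
        L , l = e 1ℚ (ℚ.positive⁻¹ 1ℚ)
    in M ℕ.⊔ (N ℕ.⊔ L) , λ k m → bound (cis d at k) (seq d k) ε
         (f k (ℕ.m⊔n≤o⇒m≤o M (N ℕ.⊔ L) m))
         (g k (ℕ.m⊔n≤o⇒m≤o N L (ℕ.m⊔n≤o⇒n≤o M (N ℕ.⊔ L) m)))
         (l k (ℕ.m⊔n≤o⇒n≤o N L (ℕ.m⊔n≤o⇒n≤o M (N ℕ.⊔ L) m)))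
    where
    1≈1-d² : 1ℝ ≈ 1ℝ - d * d
    1≈1-d² = ≈-sym {1ℝ - d * d} {1ℝ} (≈-trans {1ℝ - d * d} {1ℝ - 0ℝ * 0ℝ} {1ℝ}
      (+-cong {1ℝ} {1ℝ} { - (d * d)} { - (0ℝ * 0ℝ)} (≈-refl {1ℝ}) (-‿cong {d * d} {0ℝ * 0ℝ} (*-cong {d} {0ℝ} {d} {0ℝ} e e)))
      (≈-pointwise {1ℝ - 0ℝ * 0ℝ} {1ℝ} λ _ → refl))
    bound : ∀ g q ε → ‖ g ⊝ (1ℚ , q) ‖ ℚ.≤ 4/5 ℚ.* (q ℚ.* q) → ℚ.∣ q ℚ.- 0ℚ ∣ ℚ.≤ ½ ℚ.* ε → ℚ.∣ q ℚ.- 0ℚ ∣ ℚ.≤ 1ℚ →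
      ‖ g ⊝ (1ℚ , 0ℚ) ‖ ℚ.≤ ε
    bound g@(a , b) q ε h q≤ε q≤1 = begin
      ‖ g ⊝ (1ℚ , 0ℚ) ‖
        ≡⟨ cong ‖_‖ (cong₂ _,_
             (solve 1 (λ a → a :- con 1ℚ := (a :- con 1ℚ) :+ con 0ℚ) refl a)
             (solve 2 (λ b q → b :- con 0ℚ := (b :- q) :+ q) refl b q)) ⟩
      ‖ (g ⊝ (1ℚ , q)) ⊕ (0ℚ , q) ‖
        ≤⟨ ‖‖-⊕ (g ⊝ (1ℚ , q)) (0ℚ , q) ⟩
      ‖ g ⊝ (1ℚ , q) ‖ ℚ.+ ‖ 0ℚ , q ‖
        ≤⟨ ℚ.+-mono-≤ {‖ g ⊝ (1ℚ , q) ‖} {½ ℚ.* ε} {‖ 0ℚ , q ‖} {½ ℚ.* ε} (ℚ.≤-trans h q²≤) ‖q‖≤ ⟩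
      ½ ℚ.* ε ℚ.+ ½ ℚ.* ε
        ≡⟨ Estimates.half+half ε ⟩
      ε ∎
      where
      ∣q∣≤ : ℚ.∣ q ∣ ℚ.≤ ½ ℚ.* ε
      ∣q∣≤ = subst (λ t → ℚ.∣ t ∣ ℚ.≤ ½ ℚ.* ε) (ℚ.+-identityʳ q) q≤ε
      ‖q‖≤ : ‖ 0ℚ , q ‖ ℚ.≤ ½ ℚ.* ε
      ‖q‖≤ = subst (ℚ._≤ ½ ℚ.* ε) (sym (ℚ.+-identityˡ ℚ.∣ q ∣)) ∣q∣≤
      q²≤ : 4/5 ℚ.* (q ℚ.* q) ℚ.≤ ½ ℚ.* ε
      q²≤ = begin
        4/5 ℚ.* (q ℚ.* q)
          ≤⟨ *-mono {4/5} {1ℚ} {q ℚ.* q} {q ℚ.* q} (ℚ.nonNegative⁻¹ 1ℚ) (toWitness {a? = 4/5 ℚ.≤? 1ℚ} _) (Estimates.sq-nonNeg q) ℚ.≤-refl ⟩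
        1ℚ ℚ.* (q ℚ.* q)
          ≡⟨ trans (ℚ.*-identityˡ (q ℚ.* q)) (sym (trans (sym (ℚ.∣p*q∣≡∣p∣*∣q∣ q q)) (ℚ.0≤p⇒∣p∣≡p (Estimates.sq-nonNeg q)))) ⟩
        ℚ.∣ q ∣ ℚ.* ℚ.∣ q ∣
          ≤⟨ *-mono {ℚ.∣ q ∣} {1ℚ} {ℚ.∣ q ∣} {½ ℚ.* ε} (ℚ.nonNegative⁻¹ 1ℚ)
               (subst (λ t → ℚ.∣ t ∣ ℚ.≤ 1ℚ) (ℚ.+-identityʳ q) q≤1) (ℚ.0≤∣p∣ q) ∣q∣≤ ⟩
        1ℚ ℚ.* (½ ℚ.* ε)
          ≡⟨ ℚ.*-identityˡ (½ ℚ.* ε) ⟩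
        ½ ℚ.* ε ∎

  -- cis y = cis x · cis (y - x), and the Taylor bound sends the second factor to 1 as y - x
  -- vanishes.
  cis-cong : ∀ {x y} → x ≈ y → cis x ≈ᶜ cis y
  cis-cong {x} {y} e = ≈ᶜ-sym {cis y} {cis x} (≈ᶜ-trans {cis y} {cis x *ᶜ cis d} {cis x}
    (cis-+ {x} {d} {y} λ k → solve 2 (λ x y → y := x :+ (y :- x)) refl (seq x k) (seq y k))
    ( ≈-trans {cosine x * cosine d - sine x * sine d} {cosine x * 1ℝ - sine x * 0ℝ} {cosine x}
        (+-cong {cosine x * cosine d} {cosine x * 1ℝ} { - (sine x * sine d)} { - (sine x * 0ℝ)}
          (*-congˡ {cosine d} {1ℝ} (cosine x) (proj₁ small)) (-‿cong {sine x * sine d} {sine x * 0ℝ} (*-congˡ {sine d} {0ℝ} (sine x) (proj₂ small))))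
        (≈-pointwise {cosine x * 1ℝ - sine x * 0ℝ} {cosine x} λ k →
          solve 2 (λ c s → c :* con 1ℚ :- s :* con 0ℚ := c) refl (seq (cosine x) k) (seq (sine x) k))
    , ≈-trans {cosine x * sine d + sine x * cosine d} {cosine x * 0ℝ + sine x * 1ℝ} {sine x}
        (+-cong {cosine x * sine d} {cosine x * 0ℝ} {sine x * cosine d} {sine x * 1ℝ}
          (*-congˡ {sine d} {0ℝ} (cosine x) (proj₂ small)) (*-congˡ {cosine d} {1ℝ} (sine x) (proj₁ small)))
        (≈-pointwise {cosine x * 0ℝ + sine x * 1ℝ} {sine x} λ k →
          solve 2 (λ c s → c :* con 0ℚ :+ s :* con 1ℚ := s) refl (seq (cosine x) k) (seq (sine x) k)) ))
    where
    d : ℝ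
    d = y - x
    d≈0 : d ≈ 0ℝ
    d≈0 = ≈-trans {d} {x - x} {0ℝ} (+-cong {y} {x} { - x} { - x} (≈-sym {x} {y} e) (≈-refl { - x}))
      (≈-pointwise {x - x} {0ℝ} λ k → ℚ.+-inverseʳ (seq x k))
    small : cis d ≈ᶜ 1ℂ
    small = cis-small d d≈0

  cis-neg : ∀ x k → cis (- x) at k ≡ conjugate (cis x at k)
  cis-neg x k = trans (cis-at (- x) k) (trans (sum-conjugate k (term-conjugate (0ℚ , seq x k))) (cong conjugate (sym (cis-at x k))))

  quarter-π : ℝ
  quarter-π = real (CauchyProperties.leibniz 0) CauchyProperties.leibniz-cauchy

  trigonometry : Trigonometry orderedRing
  trigonometry = record
    { cos          = cosine
    ; sin          = sine
    ; cos-cong     = λ {x} {y} e → proj₁ (cis-cong {x} {y} e)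
    ; sin-cong     = λ {x} {y} e → proj₂ (cis-cong {x} {y} e)
    ; cos-+        = λ x y → proj₁ (cis-+ {x} {y} {x + y} λ _ → refl)
    ; sin-+        = λ x y → proj₂ (cis-+ {x} {y} {x + y} λ _ → refl)
    ; cos-neg      = λ x → ≈-pointwise {cosine (- x)} {cosine x} λ k → cong proj₁ (cis-neg x k)
    ; sin-neg      = λ x → ≈-pointwise {sine (- x)} { - sine x} λ k → cong proj₂ (cis-neg x k)
    ; cos-taylor   = cos-taylor
    ; sin-taylor   = sin-taylor
    ; ¼π           = quarter-π
    ; leibniz-tail = λ K → eventually-bounded (quarter-π - fromℚ (CauchyProperties.leibniz 0 K)) (fromℚ (1/suc (2 ℕ.* K)))
        (K , λ k K≤k → subst (λ m → ℚ.∣ CauchyProperties.leibniz 0 k ℚ.- CauchyProperties.leibniz 0 K ∣ ℚ.≤ 1/suc (2 ℕ.* m))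
          (ℕ.+-identityʳ K) (CauchyProperties.leibniz-tail 0 K k K≤k))
    }

-- Roots, rounding and inverses of real numbers.

module RealCompleteness where

  open RealOrder
  open OrderedRingProperties orderedRing using (∣_∣≤_)
  open +-*-Solver using (solve; _:+_; _:*_; :-_; _:-_; _:=_; con)

  reflects : ∀ q → 0ℝ ≤ fromℚ q → 0ℚ ℚ.≤ q
  reflects q h = ℚ.≮⇒≥ λ q<0 →
    let 0<-q = ℚ.neg-antimono-< q<0
        N , f = h (½ ℚ.* ℚ.- q) (half-pos 0<-q)
    in ℚ.<-irrefl refl (ℚ.<-≤-trans (half-pos 0<-q)
      (subst (ℚ._≤ 0ℚ) (solve 1 (λ q → :- (q :+ con ½ :* (:- q)) := con ½ :* (:- q)) refl q) (ℚ.neg-antimono-≤ (f N ℕ.≤-refl))))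

  nearest : ∀ x → ∃ λ m → ∣ x + fromℤ m ∣≤ fromℚ (ℤ.+ 11 ℚ./ 20)
  nearest x =
    -- The N-th term is within 1/20 of all later ones, and its own rounding error is at most 1/2;
    -- together they give 11/20.
    let N , f = cauchy x (1/suc 19) (Estimates.1/suc-pos 19)
        m , h = Integers.nearest (seq x N)
    in m , RealTrigonometry.eventually-bounded (x + fromℤ m) (fromℚ (ℤ.+ 11 ℚ./ 20)) (N , λ k N≤k →
      subst (λ t → ℚ.∣ t ∣ ℚ.≤ ℤ.+ 11 ℚ./ 20)
        (solve 3 (λ a b m → (a :- b) :+ (b :+ m) := a :+ m) refl (seq x k) (seq x N) (m ℚ./ 1))
        (CauchyProperties.abs-+ {seq x k ℚ.- seq x N} {seq x N ℚ.+ m ℚ./ 1} {1/suc 19} {½} (ℚ.<⇒≤ (f k N N≤k ℕ.≤-refl)) h))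

  completeness : Completeness orderedRing
  completeness = record
    { root        = λ j → √ (fromℤ (ℤ.+ j))
    ; root-nonNeg = λ j → 0≤√ (fromℤ (ℤ.+ j))
    ; root²       = λ j → √-square (fromℤ (ℤ.+ j)) (0≤-fromℚ (fromℕ j) (Estimates.fromℕ-nonNeg j))
    ; ι-reflects  = reflects
    ; nearest     = nearest
    }

  -- From some index on x is at least ε, and the maximum in the definition of `inverse` is x itself.
  inverse-* : ∀ x (0<x : 0ℝ < x) → inverse x 0<x * x ≈ 1ℝ
  inverse-* x (ε , 0<ε , N , f) δ 0<δ = N , λ k N≤k → subst (ℚ._≤ δ)
    (sym (trans (cong (λ t → ℚ.∣ t ℚ.- 1ℚ ∣) (product (seq x k) (subst (ℚ._≤ seq x k) (ℚ.+-identityˡ ε) (f k N≤k)))) refl)) (ℚ.<⇒≤ 0<δ)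
    where
    product : ∀ a → ε ℚ.≤ a → CauchyProperties.recip 0<ε a ℚ.* a ≡ 1ℚ
    product a ε≤a = trans (cong (CauchyProperties.recip 0<ε a ℚ.*_) (sym (ℚ.p≥q⇒p⊔q≡p ε≤a)))
      (ℚ.*-inverseˡ (a ℚ.⊔ ε) {{ℚ.>-nonZero (ℚ.<-≤-trans 0<ε (ℚ.p≤q⊔p a ε))}})

  -- Each strict inequality provides a rational margin, which gives i < 1 and i + 1 > 0 already in
  -- ℚ; hence i = 0.
  fractionalPart-unit : ∀ {f θ} → 0ℝ ≤ θ → θ < 1ℝ → IsFractionalPart f θ → f ≈ θ
  fractionalPart-unit {f} {θ} 0≤θ (η , 0<η , M , θ<1) (i , i≤θ , (ζ , 0<ζ , L , θ<i+1) , f≈) =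
    Equality.≈-trans {f} {θ - fromℤ i} {θ} f≈ (subst (λ i → θ - fromℤ i ≈ θ) (sym i≡0)
      (≈-pointwise {θ - 0ℝ} {θ} λ k → solve 1 (λ a → a :- con 0ℚ := a) refl (seq θ k)))
    where
    open ℚ.≤-Reasoning
    i<1 : i ℚ./ 1 ℚ.< 1ℚ
    i<1 = let K , g = i≤θ (½ ℚ.* η) (half-pos 0<η)
              k = M ℕ.⊔ K in begin-strict
      i ℚ./ 1 ≤⟨ g k (ℕ.m≤n⊔m M K) ⟩
      seq θ k ℚ.+ ½ ℚ.* η ≡⟨ sym (ℚ.+-identityʳ _) ⟩
      seq θ k ℚ.+ ½ ℚ.* η ℚ.+ 0ℚ <⟨ ℚ.+-monoʳ-< (seq θ k ℚ.+ ½ ℚ.* η) (half-pos 0<η) ⟩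
      seq θ k ℚ.+ ½ ℚ.* η ℚ.+ ½ ℚ.* η ≡⟨ solve 2 (λ a η → a :+ con ½ :* η :+ con ½ :* η := a :+ η) refl (seq θ k) η ⟩
      seq θ k ℚ.+ η ≤⟨ θ<1 k (ℕ.m≤m⊔n M K) ⟩
      1ℚ ∎
    0<i+1 : 0ℚ ℚ.< i ℚ./ 1 ℚ.+ 1ℚ
    0<i+1 = let K , g = 0≤θ (½ ℚ.* ζ) (half-pos 0<ζ)
                k = L ℕ.⊔ K in begin-strict
      0ℚ ≤⟨ g k (ℕ.m≤n⊔m L K) ⟩
      seq θ k ℚ.+ ½ ℚ.* ζ ≡⟨ sym (ℚ.+-identityʳ _) ⟩
      seq θ k ℚ.+ ½ ℚ.* ζ ℚ.+ 0ℚ <⟨ ℚ.+-monoʳ-< (seq θ k ℚ.+ ½ ℚ.* ζ) (half-pos 0<ζ) ⟩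
      seq θ k ℚ.+ ½ ℚ.* ζ ℚ.+ ½ ℚ.* ζ ≡⟨ solve 2 (λ a η → a :+ con ½ :* η :+ con ½ :* η := a :+ η) refl (seq θ k) ζ ⟩
      seq θ k ℚ.+ ζ ≤⟨ θ<i+1 k (ℕ.m≤m⊔n L K) ⟩
      i ℚ./ 1 ℚ.+ 1ℚ ∎
    i≡0 : i ≡ ℤ.+ 0
    i≡0 = ℤ.≤-antisym
      (lt1 i (ℤ.≰⇒> λ 1≤i → ℚ.<-irrefl refl (ℚ.<-≤-trans i<1 (Integers./1-mono 1≤i))))
      (0<suc⇒0≤ i (ℤ.≰⇒> λ i+1≤0 → ℚ.<-irrefl refl (ℚ.<-≤-trans 0<i+1
        (subst (ℚ._≤ 0ℚ) (Integers.[a+b]/1 i (ℤ.+ 1)) (Integers./1-mono i+1≤0)))))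
      where
      lt1 : ∀ i → i ℤ.< ℤ.+ 1 → i ℤ.≤ ℤ.+ 0
      lt1 (ℤ.+ zero)    _                      = ℤ.≤-refl
      lt1 (ℤ.+ suc i)   (ℤ.+<+ (ℕ.s≤s ()))
      lt1 ℤ.-[1+ i ]    _                      = ℤ.-≤+
      0<suc⇒0≤ : ∀ i → ℤ.+ 0 ℤ.< i ℤ.+ ℤ.+ 1 → ℤ.+ 0 ℤ.≤ i
      0<suc⇒0≤ (ℤ.+ i) _ = ℤ.+≤+ ℕ.z≤n
      0<suc⇒0≤ ℤ.-[1+ zero ] (ℤ.+<+ ())
      0<suc⇒0≤ ℤ.-[1+ suc i ] ()

-- Distances in ℂ and their squares.

module ComplexDistance where

  open RealOrder
  open Equality
  open OrderedRingProperties orderedRing using (∣∣≤⇒square≤; square≤⇒∣∣≤; ι-inverse; Within; within; squared≤)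
      renaming (_≤_ to _≼_; nonNeg-resp to resp; nonNeg-+ to plus)
  open +-*-Solver using (solve; _:+_; _:*_; :-_; _:-_; _:=_; con)

  normSq-cong : ∀ {z w} → z ≈ᶜ w → normSq z ≈ normSq w
  normSq-cong {z} {w} (p , q) = +-cong {re z * re z} {re w * re w} {im z * im z} {im w * im w}
    (*-cong {re z} {re w} {re z} {re w} p p) (*-cong {im z} {im w} {im z} {im w} q q)

  -ᶜ-congˡ : ∀ {z w} u → z ≈ᶜ w → z -ᶜ u ≈ᶜ w -ᶜ u
  -ᶜ-congˡ {z} {w} u (p , q) =
      +-cong {re z} {re w} { - re u} { - re u} p (≈-refl { - re u})
    , +-cong {im z} {im w} { - im u} { - im u} q (≈-refl { - im u})

  *ᶜ-+ᶜ-cong : ∀ l b {z w} → z ≈ᶜ w → l *ᶜ z +ᶜ b ≈ᶜ l *ᶜ w +ᶜ b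
  *ᶜ-+ᶜ-cong l b {z} {w} (p , q) =
      +-cong {re (l *ᶜ z)} {re (l *ᶜ w)} {re b} {re b}
        (+-cong {re l * re z} {re l * re w} { - (im l * im z)} { - (im l * im w)}
          (*-congˡ {re z} {re w} (re l) p) (-‿cong {im l * im z} {im l * im w} (*-congˡ {im z} {im w} (im l) q))) (≈-refl {re b})
    , +-cong {im (l *ᶜ z)} {im (l *ᶜ w)} {im b} {im b}
        (+-cong {re l * im z} {re l * im w} {im l * re z} {im l * re w}
          (*-congˡ {im z} {im w} (re l) q) (*-congˡ {re z} {re w} (im l) p)) (≈-refl {im b})

  0≤normSq : ∀ z → 0ℝ ≤ normSq z
  0≤normSq z = 0≤-+ {re z * re z} {im z * im z} (0≤-square (re z)) (0≤-square (im z))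

  ∣∣≤⇒normSq≤ : ∀ {z R} ρ → ∣ z ∣ ≤ R → R ≤ fromℚ ρ → normSq z ≼ fromℚ ρ * fromℚ ρ
  ∣∣≤⇒normSq≤ {z} {R} ρ h R≤ρ = resp {fromℚ ρ * fromℚ ρ - ∣ z ∣ * ∣ z ∣} {fromℚ ρ * fromℚ ρ - normSq z}
    (+-cong {fromℚ ρ * fromℚ ρ} {fromℚ ρ * fromℚ ρ} { - (∣ z ∣ * ∣ z ∣)} { - normSq z} (≈-refl {fromℚ ρ * fromℚ ρ})
      (-‿cong {∣ z ∣ * ∣ z ∣} {normSq z} (√-square (normSq z) (0≤normSq z))))
    (∣∣≤⇒square≤ {∣ z ∣} {fromℚ ρ} (below , plus {fromℚ ρ} {∣ z ∣} 0≤ρ (0≤√ (normSq z))))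
    where
    below : ∣ z ∣ ≼ fromℚ ρ
    below = resp {(R - ∣ z ∣) + (fromℚ ρ - R)} {fromℚ ρ - ∣ z ∣}
      (≈-pointwise {(R - ∣ z ∣) + (fromℚ ρ - R)} {fromℚ ρ - ∣ z ∣} λ k →
        solve 3 (λ r z p → (r :- z) :+ (p :- r) := p :- z) refl (seq R k) (seq ∣ z ∣ k) ρ)
      (plus {R - ∣ z ∣} {fromℚ ρ - R} (≤⇒0≤- {∣ z ∣} {R} h) (≤⇒0≤- {R} {fromℚ ρ} R≤ρ))
    0≤ρ : 0ℝ ≤ fromℚ ρ
    0≤ρ = resp {(fromℚ ρ - ∣ z ∣) + ∣ z ∣} {fromℚ ρ}
      (≈-pointwise {(fromℚ ρ - ∣ z ∣) + ∣ z ∣} {fromℚ ρ} λ k → solve 2 (λ z p → (p :- z) :+ z := p) refl (seq ∣ z ∣ k) ρ)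
      (plus {fromℚ ρ - ∣ z ∣} {∣ z ∣} below (0≤√ (normSq z)))

  -- Strictness comes from the slack 2δ ≤ ε: the modulus is at most δ, which leaves a margin of δ.
  normSq≤⇒∣∣< : ∀ {z ε} δ → 0ℚ ℚ.< δ → normSq z ≼ fromℚ δ * fromℚ δ → 0ℝ ≤ ε - fromℚ δ - fromℚ δ → ∣ z ∣ < ε
  normSq≤⇒∣∣< {z} {ε} δ 0<δ h 2δ≤ε = gap⇒< {∣ z ∣} {ε} δ 0<δ
    (resp {(ε - fromℚ δ - fromℚ δ) + (fromℚ δ - ∣ z ∣)} {ε - ∣ z ∣ - fromℚ δ}
      (≈-pointwise {(ε - fromℚ δ - fromℚ δ) + (fromℚ δ - ∣ z ∣)} {ε - ∣ z ∣ - fromℚ δ} λ k →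
        solve 3 (λ e d z → (e :- d :- d) :+ (d :- z) := e :- z :- d) refl (seq ε k) δ (seq ∣ z ∣ k))
      (plus {ε - fromℚ δ - fromℚ δ} {fromℚ δ - ∣ z ∣} 2δ≤ε
        (let p , 0≤p , e = ι-inverse δ 0<δ in proj₁ (square≤⇒∣∣≤ {∣ z ∣} (fromℚ δ) (fromℚ p) e (0≤-fromℚ p 0≤p)
          (resp {fromℚ δ * fromℚ δ - normSq z} {fromℚ δ * fromℚ δ - ∣ z ∣ * ∣ z ∣}
            (+-cong {fromℚ δ * fromℚ δ} {fromℚ δ * fromℚ δ} { - normSq z} { - (∣ z ∣ * ∣ z ∣)} (≈-refl {fromℚ δ * fromℚ δ})
              (-‿cong {normSq z} {∣ z ∣ * ∣ z ∣} (≈-sym {∣ z ∣ * ∣ z ∣} {normSq z} (√-square (normSq z) (0≤normSq z))))) h)))))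

  dist≤⇒within : ∀ {z w u R} ρ → z ≈ᶜ w → dist z u ≤ R → R ≤ fromℚ ρ →
    Within (fromℚ ρ * fromℚ ρ) (re w) (im w) (re u) (im u)
  dist≤⇒within {z} {w} {u} {R} ρ e h R≤ρ = within (resp {r - normSq (z -ᶜ u)} {r - normSq (w -ᶜ u)}
    (+-cong {r} {r} { - normSq (z -ᶜ u)} { - normSq (w -ᶜ u)} (≈-refl {r})
      (-‿cong {normSq (z -ᶜ u)} {normSq (w -ᶜ u)} (normSq-cong {z -ᶜ u} {w -ᶜ u} (-ᶜ-congˡ {z} {w} u e))))
    (∣∣≤⇒normSq≤ {z -ᶜ u} {R} ρ h R≤ρ))
    where
    r : ℝ
    r = fromℚ ρ * fromℚ ρ

  within⇒dist< : ∀ {z w u ε} δ → 0ℚ ℚ.< δ → z ≈ᶜ w → Within (fromℚ δ * fromℚ δ) (re w) (im w) (re u) (im u) →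
    0ℝ ≤ ε - fromℚ δ - fromℚ δ → dist z u < ε
  within⇒dist< {z} {w} {u} {ε} δ 0<δ e h = normSq≤⇒∣∣< {z -ᶜ u} {ε} δ 0<δ
    (resp {r - normSq (w -ᶜ u)} {r - normSq (z -ᶜ u)}
      (+-cong {r} {r} { - normSq (w -ᶜ u)} { - normSq (z -ᶜ u)} (≈-refl {r})
        (-‿cong {normSq (w -ᶜ u)} {normSq (z -ᶜ u)} (normSq-cong {w -ᶜ u} {z -ᶜ u} (-ᶜ-congˡ {w} {z} u (≈ᶜ-sym {z} {w} e)))))
      (squared≤ h))
    where
    r : ℝ
    r = fromℚ δ * fromℚ δ

-- The lattice and the bijection over the real numbers.

module Approximation (ρ δ : ℚ) (0<ρ : 0ℚ ℚ.< ρ) (0<δ : 0ℚ ℚ.< δ) (θ : ℝ) (n′ : ℕ) (precise : Precise ρ δ (suc n′)) where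

  open RealOrder
  open Equality
  open ComplexDistance
  open RealCompleteness using (completeness; inverse-*)
  open RealTrigonometry using (trigonometry; cosine; sine)

  coordinates : SpiralCoordinates orderedRing trigonometry completeness
  coordinates = record
    { θ         = θ
    ; angle     = λ j → fromℤ (ℤ.+ 2) * π * θ * fromℤ (ℤ.+ j)
    ; angle≈    = λ j → ≈-refl {fromℤ (ℤ.+ 2) * π * θ * fromℤ (ℤ.+ j)}
    ; abscissa  = λ j → re (φ θ j)
    ; ordinate  = λ j → im (φ θ j)
    ; abscissa≈ = λ j → ≈-refl {re (φ θ j)}
    ; ordinate≈ = λ j → ≈-refl {im (φ θ j)}
    }

  open Construction orderedRing trigonometry completeness ρ δ 0<ρ (suc n′) n′ refl precise coordinates public
  open OrderedRingProperties orderedRing using () renaming (_≤_ to _≼_; nonNeg-resp to resp)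
  open +-*-Solver using (solve; _:+_; _:*_; :-_; _:-_; _:=_; con)

  lattice : AffineLattice
  lattice = record
    { α           = φ θ (suc n′)
    ; ω₁          = ω₁-re +i ω₁-im
    ; ω₂          = ω₂-re +i ω₂-im
    ; independent = λ a b (p , q) → ω-independent a b p q
    }

  open AffineLattice lattice using (α; ω₁; ω₂; points)

  point : ℤ → ℤ → ℂ
  point a b = lattice-re a b +i lattice-im a b

  affine : ℤ → ℤ → ℂ
  affine a b = α +ᶜ (fromℤ a ·ᶜ ω₁ +ᶜ fromℤ b ·ᶜ ω₂)

  point≈ : ∀ a b → point a b ≈ᶜ affine a b
  point≈ a b = ≈ᶜ-refl {point a b}

  module _ (f : ℝ) (f≈θ : f ≈ θ) where

    private
      q w v : ℝ
      q = fromℤ (ℤ.+ 4) * π * fromℤ (ℤ.+ suc n′)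
      w = fromℤ (ℤ.+ 4) * π * f * fromℤ (ℤ.+ suc n′)
      W : ℂ
      W = 1ℂ +ᶜ w ·ᶜ iℂ
      v = inverse (normSq W) (1+yi≠0 w)
      N*h : N * h ≈ fromℚ ½
      N*h = ≈-pointwise {N * h} {fromℚ ½} λ _ → trans
        (solve 2 (λ a b → a :* (con ½ :* b) := con ½ :* (a :* b)) refl (fromℕ (suc n′)) (1/suc n′))
        (cong (½ ℚ.*_) (Estimates.1/suc-inverse n′))
      scale-h : ∀ x → fromℤ (ℤ.+ 4) * π * x * (N * h) ≈ fromℤ (ℤ.+ 2) * π * x
      scale-h x = ≈-trans {fromℤ (ℤ.+ 4) * π * x * (N * h)} {fromℤ (ℤ.+ 4) * π * x * fromℚ ½} {fromℤ (ℤ.+ 2) * π * x}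
        (*-congˡ {N * h} {fromℚ ½} (fromℤ (ℤ.+ 4) * π * x) N*h)
        (≈-pointwise {fromℤ (ℤ.+ 4) * π * x * fromℚ ½} {fromℤ (ℤ.+ 2) * π * x} λ k →
          solve 2 (λ p x → con (4 /1) :* p :* x :* con ½ := con (2 /1) :* p :* x) refl (seq π k) (seq x k))
      q*h : q * h ≈ fromℤ (ℤ.+ 2) * π
      q*h = ≈-trans {q * h} {fromℤ (ℤ.+ 4) * π * 1ℝ * (N * h)} {fromℤ (ℤ.+ 2) * π}
        (≈-pointwise {q * h} {fromℤ (ℤ.+ 4) * π * 1ℝ * (N * h)} λ k →
          solve 3 (λ p n h → con (4 /1) :* p :* n :* h := con (4 /1) :* p :* con 1ℚ :* (n :* h)) refl (seq π k) (seq N k) (seq h k))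
        (≈-trans {fromℤ (ℤ.+ 4) * π * 1ℝ * (N * h)} {fromℤ (ℤ.+ 2) * π * 1ℝ} {fromℤ (ℤ.+ 2) * π} (scale-h 1ℝ)
          (≈-pointwise {fromℤ (ℤ.+ 2) * π * 1ℝ} {fromℤ (ℤ.+ 2) * π} λ k → ℚ.*-identityʳ _))
      w*h : w * h ≈ g
      w*h = ≈-trans {w * h} {fromℤ (ℤ.+ 4) * π * f * (N * h)} {g}
        (≈-pointwise {w * h} {fromℤ (ℤ.+ 4) * π * f * (N * h)} λ k →
          solve 4 (λ p f n h → con (4 /1) :* p :* f :* n :* h := con (4 /1) :* p :* f :* (n :* h)) refl (seq π k) (seq f k) (seq N k) (seq h k))
        (≈-trans {fromℤ (ℤ.+ 4) * π * f * (N * h)} {fromℤ (ℤ.+ 2) * π * f} {g} (scale-h f)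
          (*-congˡ {f} {θ} (fromℤ (ℤ.+ 2) * π) f≈θ))
      v*∣1+iw∣² : v * (1ℝ + w * w) ≈ 1ℝ
      v*∣1+iw∣² = ≈-trans {v * (1ℝ + w * w)} {v * normSq W} {1ℝ}
        (≈-pointwise {v * (1ℝ + w * w)} {v * normSq W} λ k →
          solve 2 (λ v w → v :* (con 1ℚ :+ w :* w) := v :* ((con 1ℚ :+ w :* con 0ℚ) :* (con 1ℚ :+ w :* con 0ℚ)
            :+ (con 0ℚ :+ w :* con 1ℚ) :* (con 0ℚ :+ w :* con 1ℚ))) refl (seq v k) (seq w k))
        (inverse-* (normSq W) (1+yi≠0 w))
      τ-re≈ : re (τ f (suc n′)) ≈ v * (q * w)
      τ-re≈ = ≈-pointwise {re (τ f (suc n′))} {v * (q * w)} λ k →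
        solve 3 (λ v q w → v :* ((q :* con 0ℚ) :* (con 1ℚ :+ w :* con 0ℚ) :- (q :* con 1ℚ) :* (:- (con 0ℚ :+ w :* con 1ℚ))) := v :* (q :* w))
          refl (seq v k) (seq q k) (seq w k)
      τ-im≈ : im (τ f (suc n′)) ≈ v * q
      τ-im≈ = ≈-pointwise {im (τ f (suc n′))} {v * q} λ k →
        solve 3 (λ v q w → v :* ((q :* con 0ℚ) :* (:- (con 0ℚ :+ w :* con 1ℚ)) :+ (q :* con 1ℚ) :* (con 1ℚ :+ w :* con 0ℚ)) := v :* q)
          refl (seq v k) (seq q k) (seq w k)
      open Modulus {q} {w} {v} {re (τ f (suc n′))} {im (τ f (suc n′))} q*h w*h v*∣1+iw∣² τ-re≈ τ-im≈

    similarity : ∀ a b → point a b ≈ᶜ ω₁ *ᶜ (0ℂ +ᶜ (fromℤ a ·ᶜ 1ℂ +ᶜ fromℤ b ·ᶜ τ f (suc n′))) +ᶜ α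
    similarity a b = similarity-re (re α) (fromℤ a) (fromℤ b) , similarity-im (im α) (fromℤ a) (fromℤ b)

    equivalent : Equivalent points (ℤ+ℤ (τ f (suc n′)))
    equivalent = ω₁ , α , nonZero , λ w → mk⇔
      (λ (a , b , e) → standard a b , (a , b , ≈ᶜ-refl {standard a b}) ,
        ≈ᶜ-trans {w} {affine a b} {ω₁ *ᶜ standard a b +ᶜ α} e
          (≈ᶜ-trans {affine a b} {point a b} {ω₁ *ᶜ standard a b +ᶜ α} (≈ᶜ-sym {point a b} {affine a b} (point≈ a b)) (similarity a b)))
      (λ (z , (a , b , e) , e′) → a , b , ≈ᶜ-trans {w} {ω₁ *ᶜ z +ᶜ α} {affine a b} e′
        (≈ᶜ-trans {ω₁ *ᶜ z +ᶜ α} {ω₁ *ᶜ standard a b +ᶜ α} {affine a b} (*ᶜ-+ᶜ-cong ω₁ α {z} {standard a b} e)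
          (≈ᶜ-trans {ω₁ *ᶜ standard a b +ᶜ α} {point a b} {affine a b} (≈ᶜ-sym {point a b} {ω₁ *ᶜ standard a b +ᶜ α} (similarity a b)) (point≈ a b))))
      where
      standard : ℤ → ℤ → ℂ
      standard a b = 0ℂ +ᶜ (fromℤ a ·ᶜ 1ℂ +ᶜ fromℤ b ·ᶜ τ f (suc n′))
      e : ℚ
      e = ½ ℚ.* (½ ℚ.* 1/suc n′)
      nonZero : NonZero ω₁
      nonZero = gap⇒< {0ℝ} {normSq ω₁} e (half-pos (half-pos (Estimates.1/suc-pos n′)))
        (resp {normSq ω₁ - fromℚ e} {normSq ω₁ - 0ℝ - fromℚ e}
          (≈-pointwise {normSq ω₁ - fromℚ e} {normSq ω₁ - 0ℝ - fromℚ e} λ k →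
            solve 2 (λ a e → a :- e := a :- con 0ℚ :- e) refl (seq (normSq ω₁) k) e) ∣ω₁∣²-lower)

  module _ {ε R : ℝ} (R≤ρ : R ≤ fromℚ ρ) (2δ≤ε : 0ℝ ≤ ε - fromℚ δ - fromℚ δ) where

    -- Membership carries the indices j and m, from which the partner of a point is read off without
    -- any decision.
    spiralPart latticePart : Subset
    spiralPart = record
      { member   = λ z → ∃₂ λ j m → Admissible (shift j) m × z ≈ᶜ φ θ j
      ; respects = λ { {z} {w} z≈w (j , m , p , e) → j , m , p ,
          ≈ᶜ-trans {w} {z} {φ θ j} (≈ᶜ-sym {z} {w} z≈w) e }
      }
    latticePart = record
      { member   = λ z → ∃₂ λ j m → Admissible (shift j) m × z ≈ᶜ point (shift j) m
      ; respects = λ { {z} {w} z≈w (j , m , p , e) → j , m , p ,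
          ≈ᶜ-trans {w} {z} {point (shift j) m} (≈ᶜ-sym {z} {w} z≈w) e }
      }

    -- Equal points may come with different witnesses: the modulus fixes j, and admissibility then
    -- fixes m.
    well-defined : ∀ {j m j′ m′} → Admissible (shift j) m → Admissible (shift j′) m′ → φ θ j ≈ᶜ φ θ j′ →
      point (shift j) m ≈ᶜ point (shift j′) m′
    well-defined {j} {m} {j′} {m′} p p′ (e , e′) = same-index (spiral-injective j j′ e e′) p p′
      where
      same-offset : ∀ {a m m′} → m ≡ m′ → point a m ≈ᶜ point a m′
      same-offset {a} {m} refl = ≈ᶜ-refl {point a m}
      same-index : ∀ {j m j′ m′} → j ≡ j′ → Admissible (shift j) m → Admissible (shift j′) m′ →
        point (shift j) m ≈ᶜ point (shift j′) m′
      same-index {j} {m} {_} {m′} refl p p′ = same-offset {shift j} {m} {m′} (offset-unique (shift j) m m′ p p′)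

    bijection : Bijection (subsetoid spiralPart) (subsetoid latticePart)
    bijection = record
      { to        = to
      ; cong      = λ {x} {y} → to-cong {x} {y}
      ; bijective = (λ {x} {y} → injective {x} {y}) , surjective
      }
      where
      to : Σ ℂ (_∈ spiralPart) → Σ ℂ (_∈ latticePart)
      to (z , j , m , p , e) = point (shift j) m , j , m , p , ≈ᶜ-refl {point (shift j) m}
      to-cong : ∀ {x y} → proj₁ x ≈ᶜ proj₁ y → proj₁ (to x) ≈ᶜ proj₁ (to y)
      to-cong {z , j , m , p , e} {z′ , j′ , m′ , p′ , e′} z≈z′ = well-defined {j} {m} {j′} {m′} p p′
        (≈ᶜ-trans {φ θ j} {z} {φ θ j′} (≈ᶜ-sym {z} {φ θ j} e) (≈ᶜ-trans {z} {z′} {φ θ j′} z≈z′ e′))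
      injective : ∀ {x y} → proj₁ (to x) ≈ᶜ proj₁ (to y) → proj₁ x ≈ᶜ proj₁ y
      injective {z , j , m , p , e} {z′ , j′ , m′ , p′ , e′} (q , q′) =
        ≈ᶜ-trans {z} {φ θ j′} {z′} (subst (λ j → z ≈ᶜ φ θ j) j≡j′ e) (≈ᶜ-sym {z′} {φ θ j′} e′)
        where
        j≡j′ : j ≡ j′
        j≡j′ = ℤ.+-injective (GroupProperties.∙-cancelʳ (AbelianGroup.group ℤ.+-0-abelianGroup) (ℤ.- ℤ.+ suc n′) (ℤ.+ j) (ℤ.+ j′)
            (lattice-injective (shift j) m (shift j′) m′ q q′))
      surjective : ∀ y → ∃ λ x → ∀ {z} → proj₁ z ≈ᶜ proj₁ x → proj₁ (to z) ≈ᶜ proj₁ y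
      surjective (w , j , m , p , e) = (φ θ j , j , m , p , ≈ᶜ-refl {φ θ j}) , λ {z} z≈x →
        ≈ᶜ-trans {proj₁ (to z)} {point (shift j) m} {w}
          (to-cong {z} {φ θ j , j , m , p , ≈ᶜ-refl {φ θ j}} z≈x) (≈ᶜ-sym {w} {point (shift j) m} e)

    moves : MovesLessThan {spiralPart} {latticePart} ε bijection
    moves (z , j , m , p , e) = within⇒dist< {z} {φ θ j} {proj₁ (Bijection.to bijection (z , j , m , p , e))} {ε} δ 0<δ e (approximation j m p) 2δ≤ε

    latticePart-near : ∀ z a m → z ≈ᶜ point a m → dist z (φ θ (suc n′)) ≤ R → z ∈ latticePart
    latticePart-near z a m e h =
      let j , shift≡ , p = lattice-near a m (dist≤⇒within {z} {point a m} {φ θ (suc n′)} {R} ρ e h R≤ρ)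
      in j , m , subst (λ a → Admissible a m) (sym shift≡) p , subst (λ a → z ≈ᶜ point a m) (sym shift≡) e

    closeInBall : CloseInBall ε R (φ θ (suc n′)) (φ[ℕ] θ) points
    closeInBall = spiralPart , latticePart
      , (λ { z (j , _ , _ , e) → j , e })
      , (λ { z (j , m , _ , e) → shift j , m , ≈ᶜ-trans {z} {point (shift j) m} {affine (shift j) m} e (point≈ (shift j) m) })
      , (λ { z (j , e) h → let m , p = spiral-near j (dist≤⇒within {z} {φ θ j} {φ θ (suc n′)} {R} ρ e h R≤ρ) in j , m , p , e })
      , (λ { z (a , m , e) h → latticePart-near z a m (≈ᶜ-trans {z} {affine a m} {point a m} e (≈ᶜ-sym {point a m} {affine a m} (point≈ a m))) h })
      , bijection , moves

theorem1 : ∀ (ε R : ℝ) → 0ℝ < ε → 0ℝ < R →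
    ∃ λ (N : ℕ) →
    ∀ (θ : ℝ) → 0ℝ ≤ θ → θ < 1ℝ →
    ∀ (f : ℝ) → IsFractionalPart f θ →
    ∀ (n : ℕ) → N ℕ.≤ n →
    ∃ λ (L : AffineLattice) →
    Equivalent (AffineLattice.points L) (ℤ+ℤ (τ f n)) ×
    CloseInBall ε R (φ θ n) (φ[ℕ] θ) (AffineLattice.points L)
theorem1 ε R 0<ε _ =
  -- A rational e ≤ ε and a rational ρ ≥ R replace the real data. Half of e bounds the displacement,
  -- and the other half makes the inequality strict.
  let e , 0<e , e≤ε = RealOrder.<⇒gap {0ℝ} {ε} 0<ε
      ρ , 0<ρ , R≤ρ = RealOrder.upperBound R
      N , precise   = precise-threshold ρ (½ ℚ.* e) (half-pos 0<e)
  in suc N , λ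
    -- The threshold `suc N` excludes n = 0, so that n is a successor and 1/n is available.
    { θ 0≤θ θ<1 f frac zero     ()
    ; θ 0≤θ θ<1 f frac (suc n′) N<n →
        let open Approximation ρ (½ ℚ.* e) 0<ρ (half-pos 0<e) θ n′ (precise (suc n′) N<n)
        in lattice , equivalent f (RealCompleteness.fractionalPart-unit {f} {θ} 0≤θ θ<1 frac) , closeInBall {ε} {R} R≤ρ (halve e e≤ε)
    }
  where
  open +-*-Solver using (solve; _:+_; _:*_; :-_; _:-_; _:=_; con)
  halve : ∀ e → 0ℝ ≤ ε - 0ℝ - fromℚ e → 0ℝ ≤ ε - fromℚ (½ ℚ.* e) - fromℚ (½ ℚ.* e)
  halve e = RealOrder.0≤-resp {ε - 0ℝ - fromℚ e} {ε - fromℚ (½ ℚ.* e) - fromℚ (½ ℚ.* e)}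
    (RealOrder.≈-pointwise {ε - 0ℝ - fromℚ e} {ε - fromℚ (½ ℚ.* e) - fromℚ (½ ℚ.* e)} λ k →
      solve 2 (λ a e → a :- con 0ℚ :- e := a :- con ½ :* e :- con ½ :* e) refl (seq ε k) e)
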